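{- There is an algorithm which, given a homogeneous relation $H$ on a finite set $X$ and any subset $S\subseteq X$, computes in $O(|X|^2\log|X|)$ time the partition $MU(S)$, i.e. the coarsest partition of $X$ into umodules of $H$ that is thinner than $\{S,X\setminus S\}$.
   Context: Let $X$ be a finite set. A reflectless triple is $(x|yz)$ with $x,y,z\in X$, $x\neq y$, $x\neq z$. A homogeneous relation $H$ on $X$ is a boolean relation on reflectless triples such that for every $x\in X$ the binary relation $H_x$ on $X\setminus\{x\}$ given by $H_x(y,z)\Leftrightarrow H(x|yz)$ is an equivalence relation. The input $H$ is given by listing, for each $x\in X$, the partition of $X\setminus\{x\}$ into the equivalence classes of $H_x$. A subset $U\subseteq X$ is a umodule of $H$ if for all $u,u'\in U$ and all $x,x'\in X\setminus U$: $H(u|xx')\Leftrightarrow H(u'|xx')$. A partition $\mathcal{Q}$ of $X$ is thinner than a partition $\mathcal{P}$ (and $\mathcal{P}$ is coarser than $\mathcal{Q}$) if every part of $\mathcal{Q}$ is contained in some part of $\mathcal{P}$. For $S\subseteq X$, the inclusion-maximal umodules of $H$ contained in $S$ or in $X\setminus S$ form a partition of $X$, denoted $MU(S)$; it is the coarsest partition of $X$ into umodules which is thinner than $\{S,X\setminus S\}$. -}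

module Defs where

open import Data.Bool using (Bool; true; false; T; if_then_else_; _∧_)
open import Data.Fin using (Fin; toℕ)
open import Data.Fin.Subset
  using (Subset; _∈_; _∉_; _⊆_; _∩_; ∁; ⊤; ⁅_⁆; ⋃; Nonempty; Empty)
open import Data.Irrelevant using ([_])
open import Data.List using (List; []; _∷_; length; map; concatMap; lookup)
open import Data.List.Relation.Binary.Pointwise using (Pointwise)
open import Data.List.Relation.Unary.All using (All)
open import Data.List.Relation.Unary.AllPairs using (AllPairs)
open import Data.List.Relation.Unary.Any using (Any)
open import Data.List.Relation.Unary.Unique.Propositional using (Unique)
import Data.List.Membership.Propositional as List
open import Data.Nat using (ℕ; zero; suc; pred; _+_; _≡ᵇ_; _<ᵇ_)
open import Data.Product using (∃-syntax; _×_)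
open import Data.Refinement using (Refinement-syntax; _,_)
open import Data.Sum using (_⊎_)
open import Data.Vec using (toList)
open import Function.Bundles using (_⇔_)
open import Relation.Binary.PropositionalEquality using (_≡_; _≢_; subst)
open import Relation.Binary.Structures using (IsEquivalence)

private variable n : ℕ

-- The finite set X is Fin n throughout.

-- The elements of X ∖ {x}.  The proof component is irrelevant, so such
-- an element is determined by its value.
Other : Fin n → Set
Other {n} x = [ y ∈ Fin n ∣ x ≢ y ]

-- T (holds x y z) is H(x|yz); the type of holds makes its arguments
-- exactly the reflectless triples.
record HomogeneousRelation (n : ℕ) : Set where
  field
    holds         : (x : Fin n) → Other x → Other x → Bool
    isEquivalence : ∀ x → IsEquivalence (λ y z → T (holds x y z))

open HomogeneousRelation public

outsider : {U : Subset n} {u x : Fin n} → u ∈ U → x ∉ U → Other u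
outsider {U = U} {x = x} u∈U x∉U =
  x , [ (λ u≡x → x∉U (subst (_∈ U) u≡x u∈U)) ]

IsUmodule : HomogeneousRelation n → Subset n → Set
IsUmodule H U =
  ∀ {u u′ x x′} (u∈U : u ∈ U) (u′∈U : u′ ∈ U) (x∉U : x ∉ U) (x′∉U : x′ ∉ U) →
  T (holds H u  (outsider u∈U  x∉U) (outsider u∈U  x′∉U)) ⇔
  T (holds H u′ (outsider u′∈U x∉U) (outsider u′∈U x′∉U))

record IsPartition (A : Subset n) (P : List (Subset n)) : Set where
  field
    nonempty : All Nonempty P
    disjoint : AllPairs (λ U V → Empty (U ∩ V)) P
    covers   : ⋃ P ≡ A

Thinner : List (Subset n) → List (Subset n) → Set
Thinner Q P = All (λ U → Any (U ⊆_) P) Q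

-- Nonemptiness matters only when X is empty: otherwise the empty set is
-- never maximal, since singletons are umodules.
UmoduleWithin : HomogeneousRelation n → Subset n → Subset n → Set
UmoduleWithin H S U = Nonempty U × IsUmodule H U × (U ⊆ S ⊎ U ⊆ ∁ S)

MaximalUmoduleWithin : HomogeneousRelation n → Subset n → Subset n → Set
MaximalUmoduleWithin H S U =
  UmoduleWithin H S U × (∀ V → UmoduleWithin H S V → U ⊆ V → V ⊆ U)

record IsUmodulePartitionWithin
         (H : HomogeneousRelation n) (S : Subset n) (P : List (Subset n)) : Set where
  field
    partition : IsPartition ⊤ P
    umodules  : All (IsUmodule H) P
    -- When S is empty or full, one of the two sets is not a part, but
    -- no nonempty set is contained in it.
    thinner   : Thinner P (S ∷ ∁ S ∷ [])

-- Both descriptions of MU(S) are required: the parts are exactly the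
-- maximal umodules within S or its complement, and the partition they
-- form is the coarsest one into umodules that is thinner than {S, X ∖ S}.
record IsMU (H : HomogeneousRelation n) (S : Subset n) (P : List (Subset n)) : Set where
  field
    maximal  : ∀ U → (U List.∈ P) ⇔ MaximalUmoduleWithin H S U
    within   : IsUmodulePartitionWithin H S P
    coarsest : ∀ Q → IsUmodulePartitionWithin H S Q → Thinner Q P

-- A listing presents a partition as a list of parts, each a list of
-- elements without repetition; both orders are arbitrary.
Lists : List (Fin n) → Subset n → Set
Lists l U = Unique l × (∀ y → (y List.∈ l) ⇔ y ∈ U)

Listing : ℕ → Set
Listing n = List (List (Fin n))

ListsPartition : Listing n → List (Subset n) → Set
ListsPartition = Pointwise Lists

-- P is the partition of X ∖ {x} into the equivalence classes of H_x.
IsClassPartition : HomogeneousRelation n → Fin n → List (Subset n) → Set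
IsClassPartition H x P =
  IsPartition (∁ ⁅ x ⁆) P ×
  (∀ (y z : Other x) →
     T (holds H x y z) ⇔ Any (λ C → value y ∈ C × value z ∈ C) P)
  where open Data.Refinement using (value)

Presents : (Fin n → Listing n) → HomogeneousRelation n → Set
Presents L H = ∀ x → ∃[ P ] (IsClassPartition H x P × ListsPartition (L x) P)

-- The number of parts, then for each part its size and its elements.
encode : Listing n → List ℕ
encode L = length L ∷ concatMap (λ C → length C ∷ map toℕ C) L

-- A random access machine: structured programs over registers and
-- arrays with two indices, at unit cost per operation.  The only arithmetic is successor and
-- predecessor, so after t steps no value exceeds the largest input value
-- or program constant by more than t: in polynomial time all words have
-- O(log n) bits, and unit cost cannot be exploited through large numbers.

Reg Arr : Set
Reg = ℕ
Arr = ℕ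

data Expr : Set where
  lit     : ℕ → Expr
  reg     : Reg → Expr
  get     : Arr → Expr → Expr → Expr
  inc dec : Expr → Expr

data Test : Set where
  _==_ _<_ : Expr → Expr → Test

data Program : Set where
  skip  : Program
  set   : Reg → Expr → Program
  put   : Arr → Expr → Expr → Expr → Program   -- a[i,j] := e
  _⨾_   : Program → Program → Program
  cond  : Test → Program → Program → Program
  while : Test → Program → Program

infixr 5 _⨾_
infix  6 _==_ _<_

record State : Set where
  constructor state
  field
    regs : Reg → ℕ
    mem  : Arr → ℕ → ℕ → ℕ

open State public

eval : State → Expr → ℕ
eval s (lit k)     = k
eval s (reg r)     = regs s r
eval s (get a i j) = mem s a (eval s i) (eval s j)
eval s (inc e)     = suc (eval s e)
eval s (dec e)     = pred (eval s e)

test : State → Test → Bool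
test s (e == f) = eval s e ≡ᵇ eval s f
test s (e < f)  = eval s e <ᵇ eval s f

cost : Expr → ℕ
cost (lit _)     = 1
cost (reg _)     = 1
cost (get _ i j) = suc (cost i + cost j)
cost (inc e)     = suc (cost e)
cost (dec e)     = suc (cost e)

testCost : Test → ℕ
testCost (e == f) = suc (cost e + cost f)
testCost (e < f)  = suc (cost e + cost f)

setReg : Reg → ℕ → State → State
setReg r v s = state (λ q → if q ≡ᵇ r then v else regs s q) (mem s)

putMem : Arr → ℕ → ℕ → ℕ → State → State
putMem a i j v s = state (regs s)
  (λ b k l → if (b ≡ᵇ a) ∧ (k ≡ᵇ i) ∧ (l ≡ᵇ j) then v else mem s b k l)

-- ⟨ p , s ⟩⇓⟨ s′ , t ⟩: started in s, p halts in s′ after t steps.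
data ⟨_,_⟩⇓⟨_,_⟩ : Program → State → State → ℕ → Set where
  ⇓skip : ∀ {s} → ⟨ skip , s ⟩⇓⟨ s , 1 ⟩
  ⇓set : ∀ {r e s} → ⟨ set r e , s ⟩⇓⟨ setReg r (eval s e) s , suc (cost e) ⟩
  ⇓put : ∀ {a i j e s} →
    ⟨ put a i j e , s ⟩⇓⟨ putMem a (eval s i) (eval s j) (eval s e) s
                        , suc (cost i + cost j + cost e) ⟩
  ⇓seq : ∀ {p q s s′ s″ t t′} →
    ⟨ p , s ⟩⇓⟨ s′ , t ⟩ → ⟨ q , s′ ⟩⇓⟨ s″ , t′ ⟩ →
    ⟨ p ⨾ q , s ⟩⇓⟨ s″ , t + t′ ⟩
  ⇓then : ∀ {b p q s s′ t} → test s b ≡ true →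
    ⟨ p , s ⟩⇓⟨ s′ , t ⟩ → ⟨ cond b p q , s ⟩⇓⟨ s′ , testCost b + t ⟩
  ⇓else : ∀ {b p q s s′ t} → test s b ≡ false →
    ⟨ q , s ⟩⇓⟨ s′ , t ⟩ → ⟨ cond b p q , s ⟩⇓⟨ s′ , testCost b + t ⟩
  ⇓stop : ∀ {b p s} → test s b ≡ false →
    ⟨ while b p , s ⟩⇓⟨ s , testCost b ⟩
  ⇓loop : ∀ {b p s s′ s″ t t′} → test s b ≡ true →
    ⟨ p , s ⟩⇓⟨ s′ , t ⟩ → ⟨ while b p , s′ ⟩⇓⟨ s″ , t′ ⟩ →
    ⟨ while b p , s ⟩⇓⟨ s″ , testCost b + (t + t′) ⟩

nth : List ℕ → ℕ → ℕ
nth []       _       = 0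
nth (v ∷ _)  zero    = v
nth (_ ∷ vs) (suc j) = nth vs j

row : (Fin n → List ℕ) → ℕ → List ℕ
row {zero}  f _       = []
row {suc n} f zero    = f Fin.zero
row {suc n} f (suc i) = row (λ k → f (Fin.suc k)) i

bit : Bool → ℕ
bit b = if b then 1 else 0

-- Register 0 holds n, row 0 of array 0 the characteristic vector of S,
-- and row x of array 1 the encoded listing for x; all else is 0.
initial : Subset n → (Fin n → Listing n) → State
initial {n} S L = state regs₀ mem₀
  where
  regs₀ : Reg → ℕ
  regs₀ zero    = n
  regs₀ (suc _) = 0

  mem₀ : Arr → ℕ → ℕ → ℕ
  mem₀ 0 0 j = nth (map bit (toList S)) j
  mem₀ 1 i j = nth (row (λ x → encode (L x)) i) j
  mem₀ _ _ _ = 0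

-- Row 0 of array 2 begins with the (self-delimiting) encoding of M.
Outputs : State → Listing n → Set
Outputs s M = ∀ j → mem s 2 0 (toℕ j) ≡ lookup (encode M) j

{-# OPTIONS --safe #-}

-- Add a virtual element n to X, alone in a class of its own for every H_u and
-- outside every umodule; by decreeing that splitting by n separates S from
-- X ∖ S, MU(S) becomes the result of refining the one-part partition {X} by
-- the columns 0, ..., n until nothing changes.
--
-- For every row u and class k of H_u a representative rep u k is kept: the
-- first element of k that has been processed for u.  Processing a column a
-- for a part C not containing a sets rep u (κ u a) to a where it is still
-- missing, κ u a being the class of a in H_u, and splits C according to
-- rep u (κ u a).  Elements of one umodule always agree on representatives, so
-- umodules are never split.  Conversely, once a column has been processed for
-- C without a split, its representatives agree throughout C and never change
-- again; when this holds of all columns outside C, equality of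
-- representatives, that is H_u restricted to X ∖ C, is the same for all u ∈ C.
--
-- A processing step costs O(|C|).  There are at most n splits, each paid for
-- with O(n) credits; otherwise all the pairs (u , a) with u ∈ C become done for
-- good, which happens to each of the at most n (n + 1) pairs only once.  A split
-- restarts the scan of the columns, again for O(n).  Thus even O(n²) suffices.
module Submission where

open import Defs renaming (_<_ to _≺_)
open import Data.Bool using (Bool; true; false; T; if_then_else_; _∧_; _∨_)
open import Data.Bool.Properties using (∨-conicalˡ; ∨-conicalʳ)
open import Data.Fin using (Fin; toℕ; fromℕ<) renaming (zero to fzero; suc to fsuc)
import Data.Fin as Fin
open import Data.Fin.Properties using (toℕ-injective; toℕ<n; toℕ-fromℕ<; injective⇒≤; fromℕ<-injective)
open import Data.Fin.Subset using (Subset; ⋃; Empty; Nonempty; ∁; _∩_; ⊤) renaming (_∈_ to _∈ₛ_; _∉_ to _∉ₛ_; _⊆_ to _⊆ₛ_)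
open import Data.Fin.Subset.Properties using (x∈p∩q⁺; x∈p∩q⁻; x∈p∪q⁺; x∈p∪q⁻; ∉⊥;
  x∉p⇒x∈∁p; x∈∁p⇒x∉p; x∈⁅y⁆⇒x≡y; ⊆-antisym; ∈⊤; _∈?_)
open import Data.List using (List; []; _∷_; _++_; length; map; concatMap; concat; lookup; tabulate)
open import Data.List.Membership.Propositional using (_∈_)
open import Data.List.Membership.Propositional.Properties using (∈-lookup; ∈-tabulate⁺; ∈-tabulate⁻)
open import Data.List.Properties using (length-++; length-map; ++-assoc; ++-identityʳ; length-tabulate; map-tabulate)
open import Data.List.Relation.Binary.Disjoint.Propositional using (Disjoint)
open import Data.List.Relation.Binary.Pointwise as Pointwise using ([]; _∷_)
open import Data.List.Relation.Unary.All as All using (All; []; _∷_)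
import Data.List.Relation.Unary.All.Properties as All
open import Data.List.Relation.Unary.AllPairs using (AllPairs; []; _∷_)
import Data.List.Relation.Unary.AllPairs.Properties as AllPairs
open import Data.List.Relation.Unary.Any as Any using (Any; here; there; any?)
import Data.List.Relation.Unary.Any.Properties as Any
open import Data.List.Relation.Unary.Unique.Propositional using (Unique)
import Data.List.Relation.Unary.Unique.Propositional.Properties as Unique
open import Data.Nat
open import Data.Nat.Logarithm using (⌊log₂_⌋; ⌊log₂⌋-mono-≤)
open import Data.Nat.Properties
open import Data.Nat.Solver using (module +-*-Solver)
open import Data.Product using (∃-syntax; _×_; _,_; proj₁; proj₂)
open import Data.Refinement using (value)
open import Data.Sum using (_⊎_; inj₁; inj₂)
open import Data.Unit using (tt)
open import Data.Vec as Vec using ([]; _∷_; toList)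
open import Data.Vec.Properties using ([]=⇒lookup; lookup⇒[]=; lookup∘tabulate)
open import Function using (_∘_)
open import Function.Bundles using (_⇔_; mk⇔; Equivalence)
open import Relation.Binary.PropositionalEquality using (_≡_; _≢_; refl; sym; trans; cong; cong₂; subst)
open import Relation.Nullary using (¬_; yes; no; contradiction)

-- Class indices are assigned row by row, so `κ u b` and `κ u′ b` cannot be compared across rows; a
-- representative is a column, hence a name for a class that means the same in every row.
-- Representatives depend on the history of the run, but two members of a umodule share that
-- history: a processed column lies outside their part, hence outside the umodule, and joins
-- matching classes in both rows. The program knows no umodule, so this is stated as an invariant
-- about every umodular set at once (`closed`, `symbol`); maximality comes from it. The flags `done`
-- carry the converse direction. They are indexed by elements rather than parts, so both halves of a
-- split inherit them, and they stay valid because a representative is never overwritten. Treating S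
-- as a column rather than as a first split lets the run start from one part, and lets the same
-- flags give `partSet-umodule` and `partSet-within`.

≡ᵇ-refl : ∀ k → (k ≡ᵇ k) ≡ true
≡ᵇ-refl zero    = refl
≡ᵇ-refl (suc k) = ≡ᵇ-refl k

≡ᵇ-false : ∀ {k l} → k ≢ l → (k ≡ᵇ l) ≡ false
≡ᵇ-false {zero}  {zero}  k≢l = contradiction refl k≢l
≡ᵇ-false {zero}  {suc l} k≢l = refl
≡ᵇ-false {suc k} {zero}  k≢l = refl
≡ᵇ-false {suc k} {suc l} k≢l = ≡ᵇ-false (k≢l ∘ cong suc)

≡ᵇ-true⁻ : ∀ {k l} → (k ≡ᵇ l) ≡ true → k ≡ l
≡ᵇ-true⁻ {k} {l} eq = ≡ᵇ⇒≡ k l (subst T (sym eq) _)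

≡ᵇ-false⁻ : ∀ {k l} → (k ≡ᵇ l) ≡ false → k ≢ l
≡ᵇ-false⁻ {k} eq refl with trans (sym (≡ᵇ-refl k)) eq
... | ()

<ᵇ-true : ∀ {k l} → k < l → (k <ᵇ l) ≡ true
<ᵇ-true {zero}  (s≤s _)   = refl
<ᵇ-true {suc k} (s≤s k<l) = <ᵇ-true k<l

<ᵇ-false : ∀ {k l} → l ≤ k → (k <ᵇ l) ≡ false
<ᵇ-false z≤n       = refl
<ᵇ-false (s≤s l≤k) = <ᵇ-false l≤k

<ᵇ-true⁻ : ∀ {k l} → (k <ᵇ l) ≡ true → k < l
<ᵇ-true⁻ {k} {l} eq = <ᵇ⇒< k l (subst T (sym eq) _)

<ᵇ-false⁻ : ∀ {k l} → (k <ᵇ l) ≡ false → l ≤ k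
<ᵇ-false⁻ {k} {l} eq with k <? l
... | no k≮l  = ≮⇒≥ k≮l
... | yes k<l with trans (sym (<ᵇ-true k<l)) eq
...   | ()

-- putMem and setReg reduce to the following updates on each component.

upd : (ℕ → ℕ) → ℕ → ℕ → ℕ → ℕ
upd f j v l = if l ≡ᵇ j then v else f l

upd₂ : (ℕ → ℕ → ℕ) → ℕ → ℕ → ℕ → ℕ → ℕ → ℕ
upd₂ f i j v k l = if (k ≡ᵇ i) ∧ (l ≡ᵇ j) then v else f k l

upd-hit : ∀ f j v → upd f j v j ≡ v
upd-hit f j v rewrite ≡ᵇ-refl j = refl

upd-miss : ∀ f {j} v {l} → l ≢ j → upd f j v l ≡ f l
upd-miss f v l≢j rewrite ≡ᵇ-false l≢j = refl

upd₂-hit : ∀ f i j v → upd₂ f i j v i j ≡ v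
upd₂-hit f i j v rewrite ≡ᵇ-refl i | ≡ᵇ-refl j = refl

upd₂-missˡ : ∀ f {i} j v {k} l → k ≢ i → upd₂ f i j v k l ≡ f k l
upd₂-missˡ f j v l k≢i rewrite ≡ᵇ-false k≢i = refl

upd₂-missʳ : ∀ f i {j} v k {l} → l ≢ j → upd₂ f i j v k l ≡ f k l
upd₂-missʳ f i v k l≢j rewrite ≡ᵇ-false l≢j with k ≡ᵇ i
... | true  = refl
... | false = refl

-- Write footprints and a program logic with time bounds.

-- A syntactic over-approximation of the registers written. On a concrete program and register it
-- computes, so side conditions `sets p q ≡ false` are discharged by `refl`.
sets : Program → Reg → Bool
sets skip          q = false
sets (set r _)     q = q ≡ᵇ r
sets (put _ _ _ _) q = false
sets (p ⨾ p′)      q = sets p q ∨ sets p′ q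
sets (cond _ p p′) q = sets p q ∨ sets p′ q
sets (while _ p)   q = sets p q

puts : Program → Arr → Bool
puts skip          b = false
puts (set _ _)     b = false
puts (put a _ _ _) b = b ≡ᵇ a
puts (p ⨾ p′)      b = puts p b ∨ puts p′ b
puts (cond _ p p′) b = puts p b ∨ puts p′ b
puts (while _ p)   b = puts p b

module _ {A B : Bool} where
  ∨-falseˡ : (A ∨ B) ≡ false → A ≡ false
  ∨-falseˡ = ∨-conicalˡ A B
  ∨-falseʳ : (A ∨ B) ≡ false → B ≡ false
  ∨-falseʳ = ∨-conicalʳ A B

regs-frame : ∀ {p s s′ t q} → ⟨ p , s ⟩⇓⟨ s′ , t ⟩ → sets p q ≡ false →
             regs s′ q ≡ regs s q
regs-frame ⇓skip         _  = refl
regs-frame ⇓set          eq rewrite eq = refl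
regs-frame ⇓put          _  = refl
regs-frame (⇓seq d e)    eq = trans (regs-frame e (∨-falseʳ eq)) (regs-frame d (∨-falseˡ eq))
regs-frame (⇓then _ d)   eq = regs-frame d (∨-falseˡ eq)
regs-frame (⇓else _ d)   eq = regs-frame d (∨-falseʳ eq)
regs-frame (⇓stop _)     _  = refl
regs-frame (⇓loop _ d e) eq = trans (regs-frame e eq) (regs-frame d eq)

mem-frame : ∀ {p s s′ t b} → ⟨ p , s ⟩⇓⟨ s′ , t ⟩ → puts p b ≡ false →
            mem s′ b ≡ mem s b
mem-frame ⇓skip         _  = refl
mem-frame ⇓set          _  = refl
mem-frame ⇓put          eq rewrite eq = refl
mem-frame (⇓seq d e)    eq = trans (mem-frame e (∨-falseʳ eq)) (mem-frame d (∨-falseˡ eq))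
mem-frame (⇓then _ d)   eq = mem-frame d (∨-falseˡ eq)
mem-frame (⇓else _ d)   eq = mem-frame d (∨-falseʳ eq)
mem-frame (⇓stop _)     _  = refl
mem-frame (⇓loop _ d e) eq = trans (mem-frame e eq) (mem-frame d eq)

-- What survives any number of runs of `p`. Being reflexive and transitive, it can be carried
-- through the iterations of a loop with body `p`.
record Agree (p : Program) (s s′ : State) : Set where
  field
    same-regs : ∀ q → sets p q ≡ false → regs s′ q ≡ regs s q
    same-mem  : ∀ b → puts p b ≡ false → mem s′ b ≡ mem s b

open Agree public

⇓-agree : ∀ {p s s′ t} → ⟨ p , s ⟩⇓⟨ s′ , t ⟩ → Agree p s s′
⇓-agree d = record
  { same-regs = λ _ → regs-frame d
  ; same-mem  = λ _ → mem-frame d }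

agree-refl : ∀ {p s} → Agree p s s
agree-refl = record { same-regs = λ _ _ → refl ; same-mem = λ _ _ → refl }

agree-trans : ∀ {p s s′ s″} → Agree p s s′ → Agree p s′ s″ → Agree p s s″
agree-trans A B = record
  { same-regs = λ q h → trans (same-regs B q h) (same-regs A q h)
  ; same-mem  = λ b h → trans (same-mem B b h) (same-mem A b h) }

-- Total correctness with a time bound. The time is bounded rather than fixed, so that branches of
-- different length can share one constant.
record Run (p : Program) (s : State) (k : ℕ) (Q : State → Set) : Set where
  constructor run
  field
    {final} : State
    {time}  : ℕ
    runs    : ⟨ p , s ⟩⇓⟨ final , time ⟩
    time≤   : time ≤ k
    post    : Q final

open Run public

module _ where

  private variable
    p q body : Program
    s : State
    j k : ℕ
    Q R : State → Set

  weaken : j ≤ k → Run p s j Q → Run p s k Q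
  weaken j≤k (run d t≤j h) = run d (≤-trans t≤j j≤k) h

  conseq : (∀ {s′} → Agree p s s′ → Q s′ → R s′) → Run p s k Q → Run p s k R
  conseq f (run d t≤k h) = run d t≤k (f (⇓-agree d) h)

  skip-run : Q s → Run skip s 1 Q
  skip-run h = run ⇓skip ≤-refl h

  set-run : ∀ {r e} → Q (setReg r (eval s e) s) → Run (set r e) s (suc (cost e)) Q
  set-run h = run ⇓set ≤-refl h

  put-run : ∀ {a i j e} → Q (putMem a (eval s i) (eval s j) (eval s e) s) →
            Run (put a i j e) s (suc (cost i + cost j + cost e)) Q
  put-run h = run ⇓put ≤-refl h

  seq-run : Run p s j Q → (∀ {s′} → Agree p s s′ → Q s′ → Run q s′ k R) →
            Run (p ⨾ q) s (j + k) R
  seq-run (run d t≤j h) f with f (⇓-agree d) h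
  ... | run e t′≤k h′ = run (⇓seq d e) (+-mono-≤ t≤j t′≤k) h′

  -- Unlike `seq-run`, this needs no intermediate assertion: the rest runs in the explicit updated
  -- state, so straight-line code is verified by evaluation.
  set-then : ∀ {r e} → Run q (setReg r (eval s e) s) k R →
             Run (set r e ⨾ q) s (suc (cost e) + k) R
  set-then (run d t≤k h) = run (⇓seq ⇓set d) (+-monoʳ-≤ _ t≤k) h

  put-then : ∀ {a i j e} → Run q (putMem a (eval s i) (eval s j) (eval s e) s) k R →
             Run (put a i j e ⨾ q) s (suc (cost i + cost j + cost e) + k) R
  put-then (run d t≤k h) = run (⇓seq ⇓put d) (+-monoʳ-≤ _ t≤k) h

  cond-run : ∀ {b} → (test s b ≡ true → Run p s k R) → (test s b ≡ false → Run q s k R) →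
             Run (cond b p q) s (testCost b + k) R
  cond-run {s} {b = b} f g with test s b in eq
  ... | true  with run d t≤k h ← f refl = run (⇓then eq d) (+-monoʳ-≤ (testCost b) t≤k) h
  ... | false with run d t≤k h ← g refl = run (⇓else eq d) (+-monoʳ-≤ (testCost b) t≤k) h

  then-run : ∀ {b} → test s b ≡ true → Run p s k R → Run (cond b p q) s (testCost b + k) R
  then-run {b = b} eq (run d t≤k h) = run (⇓then eq d) (+-monoʳ-≤ (testCost b) t≤k) h

  else-run : ∀ {b} → test s b ≡ false → Run q s k R → Run (cond b p q) s (testCost b + k) R
  else-run {b = b} eq (run d t≤k h) = run (⇓else eq d) (+-monoʳ-≤ (testCost b) t≤k) h

  stop-run : ∀ {b} → test s b ≡ false → R s → Run (while b p) s (testCost b) R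
  stop-run eq h = run (⇓stop eq) ≤-refl h

  loop-run : ∀ {b} → test s b ≡ true → Run p s j Q →
             (∀ {s′} → Agree p s s′ → Q s′ → Run (while b p) s′ k R) →
             Run (while b p) s (testCost b + (j + k)) R
  loop-run {b = b} eq (run d t≤j h) f with f (⇓-agree d) h
  ... | run e t′≤k h′ = run (⇓loop eq d e) (+-monoʳ-≤ (testCost b) (+-mono-≤ t≤j t′≤k)) h′

  -- The number of rounds is fixed in advance while the guard rereads its bound from the state;
  -- `Agree` serves to show that the body has left that bound alone.
  for-run : ∀ {b N} (I : ℕ → State → Set) →
    (∀ {i s′} → Agree body s s′ → I i s′ → test s′ b ≡ (i <ᵇ N)) →
    (∀ {i s′} → Agree body s s′ → i < N → I i s′ → Run body s′ k (I (suc i))) →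
    I 0 s → Run (while b body) s (testCost b + N * (testCost b + k)) (I N)
  for-run {body = body} {s = s} {k = k} {b = b} {N = N} I guard step =
    go N (+-identityʳ N) agree-refl
    where
    go : ∀ d {i s′} → d + i ≡ N → Agree body s s′ → I i s′ →
         Run (while b body) s′ (testCost b + d * (testCost b + k)) (I N)
    go zero refl A h =
      weaken (m≤m+n _ _) (stop-run (trans (guard A h) (<ᵇ-false {N} ≤-refl)) h)
    go (suc d) {i} refl A h =
      weaken (≤-reflexive eq)
        (loop-run (trans (guard A h) (<ᵇ-true i<N)) (step A i<N h)
          (λ B h′ → go d (+-suc d i) (agree-trans A B) h′))
      where
      i<N : i < suc d + i
      i<N = s≤s (m≤n+m i d)
      T₀ = testCost b
      eq : T₀ + (k + (T₀ + d * (T₀ + k))) ≡ T₀ + (T₀ + k + d * (T₀ + k))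
      eq = cong (T₀ +_) (trans (sym (+-assoc k T₀ _)) (cong (_+ d * (T₀ + k)) (+-comm k T₀)))

  -- The credit d may depend on the state; m is the amortised potential.
  credit-run : ∀ {b} (I : ℕ → State → Set) →
    (∀ {m s} → I m s → test s b ≡ true →
       ∃[ d ] (1 ≤ d × Run body s (k * d) (λ s′ → ∃[ m′ ] (m′ + d ≤ m × I m′ s′)))) →
    ∀ {m s} → I m s →
    Run (while b body) s (testCost b + (testCost b + k) * m)
        (λ s′ → test s′ b ≡ false × ∃[ m′ ] I m′ s′)
  credit-run {body = body} {k = k} {b = b} I step {m} = go m ≤-refl
    where
    T₀ = testCost b
    -- A round lowers `m` by at least `d`, not by exactly one, so the recursion is on a bound `fuel`
    -- for `m`.
    go : ∀ fuel {m s} → m ≤ fuel → I m s →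
         Run (while b body) s (T₀ + (T₀ + k) * m) (λ s′ → test s′ b ≡ false × ∃[ m′ ] I m′ s′)
    go fuel {m} {s} m≤ h with test s b in eq
    ... | false = weaken (m≤m+n _ _) (stop-run eq (eq , m , h))
    ... | true with step h eq
    ...   | d , 1≤d , run e t≤ (m′ , m′+d≤m , h′) with fuel
    ...     | zero = contradiction (≤-trans 1≤d (≤-trans (m≤n+m d m′) (≤-trans m′+d≤m m≤))) λ ()
    ...     | suc fuel′ = weaken bound (loop-run eq (run e t≤ h′) λ _ h″ → go fuel′ m′≤ h″)
      where
      m′≤ : m′ ≤ fuel′
      m′≤ = s≤s⁻¹ (begin
        suc m′  ≡⟨ +-comm 1 m′ ⟩
        m′ + 1  ≤⟨ +-monoʳ-≤ m′ 1≤d ⟩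
        m′ + d  ≤⟨ m′+d≤m ⟩
        m       ≤⟨ m≤ ⟩
        suc fuel′ ∎)
        where open ≤-Reasoning
      -- Since `1 ≤ d`, the guard of the next round is covered by `T₀ * d`.
      bound : T₀ + (k * d + (T₀ + (T₀ + k) * m′)) ≤ T₀ + (T₀ + k) * m
      bound = +-monoʳ-≤ T₀ (begin
        k * d + (T₀ + (T₀ + k) * m′)      ≡⟨ sym (+-assoc (k * d) T₀ _) ⟩
        k * d + T₀ + (T₀ + k) * m′        ≡⟨ cong (_+ (T₀ + k) * m′) (+-comm (k * d) T₀) ⟩
        T₀ + k * d + (T₀ + k) * m′
        ≤⟨ +-monoˡ-≤ _ (+-monoˡ-≤ (k * d) (subst (_≤ T₀ * d) (*-identityʳ T₀) (*-monoʳ-≤ T₀ 1≤d))) ⟩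
        T₀ * d + k * d + (T₀ + k) * m′    ≡⟨ cong (_+ (T₀ + k) * m′) (sym (*-distribʳ-+ d T₀ k)) ⟩
        (T₀ + k) * d + (T₀ + k) * m′      ≡⟨ +-comm ((T₀ + k) * d) _ ⟩
        (T₀ + k) * m′ + (T₀ + k) * d      ≡⟨ sym (*-distribˡ-+ (T₀ + k) m′ d) ⟩
        (T₀ + k) * (m′ + d)               ≤⟨ *-monoʳ-≤ (T₀ + k) m′+d≤m ⟩
        (T₀ + k) * m                      ∎)
        where open ≤-Reasoning

  assoc-run : ∀ {p q r : Program} {s k R} → Run (p ⨾ (q ⨾ r)) s k R → Run ((p ⨾ q) ⨾ r) s k R
  assoc-run {k = k} (run (⇓seq {t = t} d (⇓seq {t = t′} {t′ = t″} e f)) t≤k h) =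
    run (⇓seq (⇓seq d e) f) (subst (_≤ k) (sym (+-assoc t t′ t″)) t≤k) h

  -- Each branch is verified together with what follows it, so the state stays explicit past the
  -- branching and no assertion joining the two branches is needed.
  cond-then : ∀ {p p′ q : Program} {s k R b} →
    (test s b ≡ true → Run (p ⨾ q) s k R) → (test s b ≡ false → Run (p′ ⨾ q) s k R) →
    Run (cond b p p′ ⨾ q) s (testCost b + k) R
  cond-then {s = s} {k = k} {b = b} f g with test s b in eq
  ... | true  with run (⇓seq {t = t} {t′ = t′} d e) t≤k h ← f refl =
    run (⇓seq (⇓then eq d) e) (subst (_≤ testCost b + k) (sym (+-assoc (testCost b) t t′)) (+-monoʳ-≤ (testCost b) t≤k)) h
  ... | false with run (⇓seq {t = t} {t′ = t′} d e) t≤k h ← g refl =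
    run (⇓seq (⇓else eq d) e) (subst (_≤ testCost b + k) (sym (+-assoc (testCost b) t t′)) (+-monoʳ-≤ (testCost b) t≤k)) h

-- The representatives r of a row after a column a in class c; entries are one
-- more than the representative, 0 meaning that there is none.
adv : ℕ → ℕ → (ℕ → ℕ) → ℕ → ℕ
adv c a r k = if (k ≡ᵇ c) ∧ (r k ≡ᵇ 0) then suc a else r k

adv-old : ∀ {c a} r {k} → r k ≢ 0 → adv c a r k ≡ r k
adv-old {c} r {k} rk≢0 rewrite ≡ᵇ-false rk≢0 with k ≡ᵇ c
... | true  = refl
... | false = refl

adv-miss : ∀ {c a} r {k} → k ≢ c → adv c a r k ≡ r k
adv-miss r k≢c rewrite ≡ᵇ-false k≢c = refl

adv-hit : ∀ c a r → adv c a r c ≢ 0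
adv-hit c a r rewrite ≡ᵇ-refl c with r c
... | zero  = λ ()
... | suc _ = λ ()

-- The two rows may number their classes differently; it is enough that `k` is the processed class
-- of one row exactly when `k′` is that of the other. For two members of a umodule, `uniform`
-- supplies this.
adv-cong : ∀ {c c′} a r r′ {k k′} → (k ≡ c → k′ ≡ c′) → (k′ ≡ c′ → k ≡ c) →
           r k ≡ r′ k′ → adv c a r k ≡ adv c′ a r′ k′
adv-cong {c} {c′} a r r′ {k} {k′} to from eq with k ≟ c | k′ ≟ c′
... | yes refl | yes refl rewrite ≡ᵇ-refl c | ≡ᵇ-refl c′ | eq = refl
... | yes p    | no ¬p    = contradiction (to p) ¬p
... | no ¬p    | yes p    = contradiction (from p) ¬p
... | no p     | no q     = trans (adv-miss r p) (trans eq (sym (adv-miss r′ q)))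

adv-inv : ∀ {c a} r {k v} → adv c a r k ≡ suc v → r k ≡ suc v ⊎ (k ≡ c × a ≡ v)
adv-inv {c} r {k} eq with k ≟ c
... | no k≢c = inj₁ (trans (sym (adv-miss r k≢c)) eq)
... | yes refl rewrite ≡ᵇ-refl c with r c
...   | zero  = inj₂ (refl , suc-injective eq)
...   | suc _ = inj₁ eq

≡-dec-elim : ∀ {A : Set} (x y : ℕ) → (x ≡ y → A) → (x ≢ y → A) → A
≡-dec-elim x y f g with x ≟ y
... | yes p = f p
... | no ¬p = g ¬p

-- The partition in memory: members, labels and positions.

module _ (n : ℕ) where

  -- Every u < n is the member number pos u of the part with index part u - 1,
  -- where V says which pairs (index of a part, index of a member) are in use.
  record Locates (V : ℕ → ℕ → Set) (M : ℕ → ℕ → ℕ) (part pos : ℕ → ℕ) : Set where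
    field
      member  : ∀ {q x} → V q x → M q x < n
      in-part : ∀ {q x} → V q x → part (M q x) ≡ suc q
      at-pos  : ∀ {q x} → V q x → pos (M q x) ≡ x
      located : ∀ {u} → u < n → ∃[ q ] (part u ≡ suc q × V q (pos u) × M q (pos u) ≡ u)

    located-in : ∀ {u q} → u < n → part u ≡ suc q → V q (pos u) × M q (pos u) ≡ u
    located-in u<n eq with located u<n
    ... | q , eq′ , v , m with suc-injective (trans (sym eq) eq′)
    ...   | refl = v , m

  Cell : ℕ → (ℕ → ℕ) → ℕ → ℕ → Set
  Cell cnt size q x = q < cnt × x < size q

  Same : ℕ × ℕ → ℕ × ℕ → Set
  Same (q , x) (r , y) = q ≡ r × x ≡ y

  locates-resp : ∀ {V V′ M part pos} → (∀ {q x} → V q x → V′ q x) → (∀ {q x} → V′ q x → V q x) →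
                 Locates V M part pos → Locates V′ M part pos
  locates-resp f g L = record
    { member = member ∘ g ; in-part = in-part ∘ g ; at-pos = at-pos ∘ g
    ; located = λ u<n → let q , eq , v , m = located u<n in q , eq , f v , m }
    where open Locates L

  upd₂-miss : ∀ f {i j} v {k l} → ¬ Same (k , l) (i , j) → upd₂ f i j v k l ≡ f k l
  upd₂-miss f {i} {j} v {k} {l} ne with k ≟ i
  ... | no k≢i = upd₂-missˡ f j v l k≢i
  ... | yes refl = upd₂-missʳ f i v k λ l≡j → ne (refl , l≡j)

  -- The last two hypotheses say that the slots in use change only by dropping `(q , x)` and adding
  -- `(r , y)`. They force the target to be the source itself or a slot not in use, so no other
  -- member is overwritten; the old cell keeps a stale value that `V′` no longer admits.
  move : ∀ {V V′ M part pos q x r y} → Locates V M part pos → V q x → V′ r y →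
         (∀ {q′ x′} → V q′ x′ → ¬ Same (q′ , x′) (q , x) → V′ q′ x′ × ¬ Same (q′ , x′) (r , y)) →
         (∀ {q′ x′} → V′ q′ x′ → ¬ Same (q′ , x′) (r , y) → V q′ x′ × ¬ Same (q′ , x′) (q , x)) →
         let u = M q x in
         Locates V′ (upd₂ M r y u) (upd part u (suc r)) (upd pos u y)
  move {V} {V′} {M} {part} {pos} {q} {x} {r} {y} L v v′ to from = record
    { member  = λ w → cell w (_< n) (member v) (λ w′ _ → member w′)
    ; in-part = in-part′
    ; at-pos  = at-pos′
    ; located = located′ }
    where
    open Locates L
    u = M q x
    same? : ∀ {A : Set} q′ x′ r y → (q′ ≡ r → x′ ≡ y → A) → (¬ Same (q′ , x′) (r , y) → A) → A
    same? q′ x′ r y f g with q′ ≟ r | x′ ≟ y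
    ... | yes a | yes b = f a b
    ... | no ¬a | _     = g (¬a ∘ proj₁)
    ... | _     | no ¬b = g (¬b ∘ proj₂)
    -- `part` and `pos` recover the slot from the element, so `M` is injective on the slots in use.
    other : ∀ {q′ x′} → V q′ x′ → ¬ Same (q′ , x′) (q , x) → M q′ x′ ≢ u
    other w ne eq = ne (suc-injective (trans (sym (in-part w)) (trans (cong part eq) (in-part v)))
                       , trans (sym (at-pos w)) (trans (cong pos eq) (at-pos v)))
    cell : ∀ {q′ x′} → V′ q′ x′ → (P : ℕ → Set) → P u →
           (V q′ x′ → ¬ Same (q′ , x′) (q , x) → P (M q′ x′)) → P (upd₂ M r y u q′ x′)
    cell {q′} {x′} w P pu f = same? q′ x′ r y
      (λ { refl refl → subst P (sym (upd₂-hit M r y u)) pu })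
      (λ ne → let w′ , ne′ = from w ne in subst P (sym (upd₂-miss M u ne)) (f w′ ne′))
    in-part′ : ∀ {q′ x′} → V′ q′ x′ → upd part u (suc r) (upd₂ M r y u q′ x′) ≡ suc q′
    in-part′ {q′} {x′} w = same? q′ x′ r y
      (λ { refl refl → trans (cong (upd part u (suc r)) (upd₂-hit M r y u)) (upd-hit part u (suc r)) })
      (λ ne → let w′ , ne′ = from w ne in
         trans (cong (upd part u (suc r)) (upd₂-miss M u ne))
               (trans (upd-miss part (suc r) (other w′ ne′)) (in-part w′)))
    at-pos′ : ∀ {q′ x′} → V′ q′ x′ → upd pos u y (upd₂ M r y u q′ x′) ≡ x′
    at-pos′ {q′} {x′} w = same? q′ x′ r y
      (λ { refl refl → trans (cong (upd pos u y) (upd₂-hit M r y u)) (upd-hit pos u y) })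
      (λ ne → let w′ , ne′ = from w ne in
         trans (cong (upd pos u y) (upd₂-miss M u ne))
               (trans (upd-miss pos y (other w′ ne′)) (at-pos w′)))
    located′ : ∀ {w} → w < n → ∃[ q′ ] (upd part u (suc r) w ≡ suc q′ ×
                 V′ q′ (upd pos u y w) × upd₂ M r y u q′ (upd pos u y w) ≡ w)
    located′ {w} w<n with w ≟ u
    ... | yes refl rewrite upd-hit part u (suc r) | upd-hit pos u y = r , refl , v′ , upd₂-hit M r y u
    ... | no w≢u rewrite upd-miss part (suc r) w≢u | upd-miss pos y w≢u with located w<n
    ...   | q′ , eq , c , m = q′ , eq , proj₁ c′ , trans (upd₂-miss M u (proj₂ c′)) m
      where
      c′ = to c (λ { (refl , e) → w≢u (trans (sym m) (cong (M q′) e)) })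

-- The refinement invariant and its preservation.

module _ (n : ℕ) (κ : ℕ → ℕ → ℕ) (σ : ℕ → ℕ) where

  -- Column n has key 0 in every row, so it is in no class of an actual element;
  -- its symbol in row u is the colour σ u.
  record Umodular (U : ℕ → Bool) : Set where
    field
      bounded : ∀ {u} → U u ≡ true → u < n
      uniform : ∀ {u u′ b b′} → U u ≡ true → U u′ ≡ true → b ≤ n → b′ ≤ n →
                U b ≡ false → U b′ ≡ false → κ u b ≡ κ u b′ → κ u′ b ≡ κ u′ b′
      colour  : ∀ {u u′} → U u ≡ true → U u′ ≡ true → σ u ≡ σ u′

  -- `closed` and `symbol` say that no umodule has been cut and provide what keeps it so. The `done`
  -- fields point the other way, towards the parts being umodules. `rep-key` makes a representative
  -- determine its class, `rep-0` puts the colour at the key of the virtual column, and `inhabited`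
  -- bounds the number of parts.
  record Core (cnt : ℕ) (size : ℕ → ℕ) (M rep done : ℕ → ℕ → ℕ) (part pos : ℕ → ℕ) : Set where
    field
      locates   : Locates n (Cell n cnt size) M part pos
      inhabited : ∀ {q} → q < cnt → 0 < size q
      part-n    : part n ≡ 0
      closed    : ∀ {U u u′} → Umodular U → U u ≡ true → U u′ ≡ true → part u ≡ part u′
      symbol    : ∀ {U u u′ b} → Umodular U → U u ≡ true → U u′ ≡ true → b ≤ n → U b ≡ false →
                  rep u (κ u b) ≡ rep u′ (κ u′ b)
      rep-key   : ∀ {u k v} → u < n → rep u (suc k) ≡ suc v → κ u v ≡ suc k
      rep-0     : ∀ {u} → u < n → rep u 0 ≡ suc (σ u)
      done-cong : ∀ {u u′} → u < n → u′ < n → part u ≡ part u′ → ∀ b → done u b ≡ done u′ b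
      done-rep  : ∀ {u b} → u < n → done u b ≢ 0 → rep u (κ u b) ≢ 0
      done-sym  : ∀ {u u′ b} → u < n → u′ < n → part u ≡ part u′ → done u b ≢ 0 →
                  rep u (κ u b) ≡ rep u′ (κ u′ b)

    open Locates locates public

  Outside : (ℕ → ℕ) → ℕ → ℕ → Set
  Outside part p a = a ≤ n × part a ≢ suc p

  record Advanced (p a : ℕ) (part : ℕ → ℕ) (rep rep′ : ℕ → ℕ → ℕ) : Set where
    field
      advanced  : ∀ {u} → u < n → part u ≡ suc p → ∀ k → rep′ u k ≡ adv (κ u a) a (rep u) k
      unchanged : ∀ {u} → u < n → part u ≢ suc p → ∀ k → rep′ u k ≡ rep u k

  record Split (p cnt : ℕ) (f : ℕ → ℕ) (f₀ : ℕ) (part part′ : ℕ → ℕ) : Set where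
    field
      moved : ∀ {u} → u < n → part′ u ≡ suc cnt → part u ≡ suc p × f u ≢ f₀
      fixed : ∀ {u} → u < n → part′ u ≢ suc cnt → part′ u ≡ part u
      kept  : ∀ {u} → u < n → part′ u ≡ suc p → f u ≡ f₀

  record Marked (p a : ℕ) (part : ℕ → ℕ) (done done′ : ℕ → ℕ → ℕ) : Set where
    field
      marked   : ∀ {u} → u < n → part u ≡ suc p → done′ u a ≡ 1
      unmarked : ∀ {u b} → u < n → part u ≢ suc p ⊎ b ≢ a → done′ u b ≡ done u b

  module _ {cnt size M rep done part pos} (C : Core cnt size M rep done part pos) where
    open Core C

    -- By `closed`, all of `U` lies in part `p`.
    outside : ∀ {U u p a} → Umodular U → U u ≡ true → part u ≡ suc p → Outside part p a → U a ≡ false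
    outside {U} {u} {p} {a} mod Uu eq (_ , a∉p) with U a in Ua
    ... | false = refl
    ... | true  = contradiction (trans (closed mod Ua Uu) eq) a∉p

    -- `uniform`, applied to `b` and `a`, says that `b` lies in the class of `a` for both rows or
    -- for neither, so `adv-cong` preserves `symbol`. The `done` fields survive because they concern
    -- existing representatives, which `adv` leaves alone.
    advance-core : ∀ {p a rep′} → Outside part p a → Advanced p a part rep rep′ →
                   Core cnt size M rep′ done part pos
    advance-core {p} {a} {rep′} out adv′ = record
      { locates = locates ; inhabited = inhabited ; part-n = part-n ; closed = closed
      ; symbol = symbol′ ; rep-key = rep-key′ ; rep-0 = rep-0′
      ; done-cong = done-cong
      ; done-rep = λ u<n d → subst (_≢ 0) (sym (old u<n (done-rep u<n d))) (done-rep u<n d)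
      ; done-sym = λ {u} {u′} {b} u<n u′<n eq d →
          trans (old u<n (done-rep u<n d))
          (trans (done-sym u<n u′<n eq d)
                 (sym (old u′<n (done-rep u′<n (subst (_≢ 0) (done-cong u<n u′<n eq b) d))))) }
      where
      open Advanced adv′
      old : ∀ {u k} → u < n → rep u k ≢ 0 → rep′ u k ≡ rep u k
      old {u} {k} u<n ne with part u ≟ suc p
      ... | yes u∈p = trans (advanced u<n u∈p k) (adv-old (rep u) ne)
      ... | no u∉p  = unchanged u<n u∉p k
      rep-key′ : ∀ {u k v} → u < n → rep′ u (suc k) ≡ suc v → κ u v ≡ suc k
      rep-key′ {u} {k} u<n eq with part u ≟ suc p
      ... | no u∉p = rep-key u<n (trans (sym (unchanged u<n u∉p _)) eq)
      ... | yes u∈p with adv-inv {κ u a} {a} (rep u) (trans (sym (advanced u<n u∈p _)) eq)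
      ...   | inj₁ eq′         = rep-key u<n eq′
      ...   | inj₂ (k≡ , refl) = sym k≡
      -- The colour is stored as its successor, so the entry at key 0 counts as present and
      -- processing column `n` cannot overwrite it.
      rep-0′ : ∀ {u} → u < n → rep′ u 0 ≡ suc (σ u)
      rep-0′ u<n = trans (old u<n (subst (_≢ 0) (sym (rep-0 u<n)) λ ())) (rep-0 u<n)
      symbol′ : ∀ {U u u′ b} → Umodular U → U u ≡ true → U u′ ≡ true → b ≤ n → U b ≡ false →
                rep′ u (κ u b) ≡ rep′ u′ (κ u′ b)
      symbol′ {U} {u} {u′} {b} mod Uu Uu′ b≤n b∉U with part u ≟ suc p
      ... | no u∉p = trans (unchanged (bounded Uu) u∉p _)
                     (trans (symbol mod Uu Uu′ b≤n b∉U)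
                            (sym (unchanged (bounded Uu′) (subst (_≢ suc p) (closed mod Uu Uu′) u∉p) _)))
        where open Umodular mod
      ... | yes u∈p = trans (advanced (bounded Uu) u∈p _)
          (trans (adv-cong a (rep u) (rep u′)
                   (uniform Uu Uu′ b≤n (proj₁ out) b∉U a∉U)
                   (uniform Uu′ Uu b≤n (proj₁ out) b∉U a∉U)
                   (symbol mod Uu Uu′ b≤n b∉U))
                 (sym (advanced (bounded Uu′) (trans (sym (closed mod Uu Uu′)) u∈p) _)))
        where
        open Umodular mod
        a∉U : U a ≡ false
        a∉U = outside mod Uu u∈p out

    -- By `symbol`, the members of a umodular set show the same symbol at `a` and go to the same
    -- side. The `done` fields speak of pairs in a common part, and a finer partition has no new
    -- such pairs.
    split-core : ∀ {p a f₀ size′ M′ part′ pos′} → Outside part p a →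
                 Split p cnt (λ u → rep u (κ u a)) f₀ part part′ →
                 Locates n (Cell n (suc cnt) size′) M′ part′ pos′ →
                 (∀ {q} → q < suc cnt → 0 < size′ q) → part′ n ≡ 0 →
                 Core (suc cnt) size′ M′ rep done part′ pos′
    split-core {p} {a} {f₀} {part′ = part′} out split loc′ inh′ n′ = record
      { locates = loc′ ; inhabited = inh′ ; part-n = n′ ; closed = closed′
      ; symbol = symbol ; rep-key = rep-key ; rep-0 = rep-0
      ; done-cong = λ u<n u′<n eq → done-cong u<n u′<n (finer u<n u′<n eq)
      ; done-rep = done-rep
      ; done-sym = λ u<n u′<n eq → done-sym u<n u′<n (finer u<n u′<n eq) }
      where
      open Split split
      finer : ∀ {u u′} → u < n → u′ < n → part′ u ≡ part′ u′ → part u ≡ part u′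
      finer {u} {u′} u<n u′<n eq with part′ u ≟ suc cnt
      ... | yes e = trans (proj₁ (moved u<n e)) (sym (proj₁ (moved u′<n (trans (sym eq) e))))
      ... | no ne = trans (sym (fixed u<n ne)) (trans eq (fixed u′<n (subst (_≢ suc cnt) eq ne)))
      apart : ∀ {U u u′} → Umodular U → U u ≡ true → U u′ ≡ true →
              part′ u ≡ suc cnt → part′ u′ ≡ suc cnt
      apart {U} {u} {u′} mod Uu Uu′ e with part′ u′ ≟ suc cnt
      ... | yes e′ = e′
      ... | no ne′ = contradiction
            (trans (symbol mod Uu Uu′ (proj₁ out) (outside mod Uu u∈p out))
                   (kept u′<n (trans (fixed u′<n ne′) (trans (closed mod Uu′ Uu) u∈p))))
            (proj₂ (moved u<n e))
        where
        open Umodular mod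
        u<n = bounded Uu
        u′<n = bounded Uu′
        u∈p = proj₁ (moved u<n e)
      closed′ : ∀ {U u u′} → Umodular U → U u ≡ true → U u′ ≡ true → part′ u ≡ part′ u′
      closed′ {U} {u} {u′} mod Uu Uu′ with part′ u ≟ suc cnt | part′ u′ ≟ suc cnt
      ... | yes e | _     = trans e (sym (apart mod Uu Uu′ e))
      ... | _     | yes e = trans (apart mod Uu′ Uu e) (sym e)
      ... | no ¬e | no ¬e′ = trans (fixed (bounded Uu) ¬e)
                               (trans (closed mod Uu Uu′) (sym (fixed (bounded Uu′) ¬e′)))
        where open Umodular mod

    -- A split that moves nothing changes at most the order of the members.
    trivial-split-core : ∀ {M′ part′ pos′} →
                 (∀ {u} → u < n → part′ u ≡ part u) →
                 Locates n (Cell n cnt size) M′ part′ pos′ → part′ n ≡ 0 →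
                 Core cnt size M′ rep done part′ pos′
    trivial-split-core {part′ = part′} same loc′ n′ = record
      { locates = loc′ ; inhabited = inhabited ; part-n = n′
      ; closed = λ mod Uu Uu′ → let open Umodular mod in
          trans (same (bounded Uu)) (trans (closed mod Uu Uu′) (sym (same (bounded Uu′))))
      ; symbol = symbol ; rep-key = rep-key ; rep-0 = rep-0
      ; done-cong = λ u<n u′<n eq → done-cong u<n u′<n (finer u<n u′<n eq)
      ; done-rep = done-rep
      ; done-sym = λ u<n u′<n eq → done-sym u<n u′<n (finer u<n u′<n eq) }
      where
      finer : ∀ {u u′} → u < n → u′ < n → part′ u ≡ part′ u′ → part u ≡ part u′
      finer u<n u′<n eq = trans (sym (same u<n)) (trans eq (same u′<n))

    -- Constancy of the symbol at `a` is what `done-sym` asks of the new flags; `f₀ ≢ 0` is what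
    -- `done-rep` asks, and it keeps later columns from changing these representatives.
    mark-core : ∀ {p a f₀ done′} → f₀ ≢ 0 →
                (∀ {u} → u < n → part u ≡ suc p → rep u (κ u a) ≡ f₀) →
                Marked p a part done done′ → Core cnt size M rep done′ part pos
    mark-core {p} {a} {f₀} {done′} f₀≢0 const mark = record
      { locates = locates ; inhabited = inhabited ; part-n = part-n ; closed = closed
      ; symbol = symbol ; rep-key = rep-key ; rep-0 = rep-0
      ; done-cong = done-cong′ ; done-rep = done-rep′ ; done-sym = done-sym′ }
      where
      open Marked mark
      cases : ∀ {A : Set} u b → (part u ≡ suc p → b ≡ a → A) → (part u ≢ suc p ⊎ b ≢ a → A) → A
      cases u b f g with part u ≟ suc p | b ≟ a
      ... | yes e | yes e′ = f e e′
      ... | no ne | _      = g (inj₁ ne)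
      ... | _     | no ne  = g (inj₂ ne)
      done-cong′ : ∀ {u u′} → u < n → u′ < n → part u ≡ part u′ → ∀ b → done′ u b ≡ done′ u′ b
      done-cong′ {u} {u′} u<n u′<n eq b = cases u b
        (λ { e refl → trans (marked u<n e) (sym (marked u′<n (trans (sym eq) e))) })
        (λ ne → trans (unmarked u<n ne) (trans (done-cong u<n u′<n eq b)
                  (sym (unmarked u′<n (subst (λ z → z ≢ suc p ⊎ b ≢ a) eq ne)))))
      done-rep′ : ∀ {u b} → u < n → done′ u b ≢ 0 → rep u (κ u b) ≢ 0
      done-rep′ {u} {b} u<n d = cases u b
        (λ { e refl eq → f₀≢0 (trans (sym (const u<n e)) eq) })
        (λ ne → done-rep u<n (subst (_≢ 0) (unmarked u<n ne) d))
      done-sym′ : ∀ {u u′ b} → u < n → u′ < n → part u ≡ part u′ → done′ u b ≢ 0 →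
                  rep u (κ u b) ≡ rep u′ (κ u′ b)
      done-sym′ {u} {u′} {b} u<n u′<n eq d = cases u b
        (λ { e refl → trans (const u<n e) (sym (const u′<n (trans (sym eq) e))) })
        (λ ne → done-sym u<n u′<n eq (subst (_≢ 0) (unmarked u<n ne) d))

-- rN: n, rP and rC: current part and number of parts, rA: current column,
-- rF: the symbol of the first member of the part being split.
rN rP rA rC rI rJ rK rU rF rQ rY rX rO rE : Reg
rN = 0
rP = 1
rA = 2
rC = 3
rI = 4
rJ = 5
rK = 6
rU = 7
rF = 8
rQ = 9
rY = 10
rX = 11
rO = 12
rE = 13

-- aKey x y: 1 + index of the class of y in H_x, or 0 for the virtual y = n;
-- aRep u k: 1 + the representative of class k for u, or 0 if there is none;
-- aMem p i: member i of part p; aSize 0 p: number of members of part p;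
-- aDone u a: whether column a has been processed for the part of u;
-- aPart 0 u: 1 + the part of u; aPos 0 u: the number of u within its part.
aKey aRep aMem aSize aDone aPart aPos : Arr
aKey  = 3
aRep  = 4
aMem  = 5
aSize = 6
aDone = 7
aPart = 8
aPos  = 9

sizeₑ keyₑ symₑ : Expr
sizeₑ = get aSize (lit 0) (reg rP)
keyₑ  = get aKey (reg rU) (reg rA)
symₑ  = get aRep (reg rU) keyₑ

advanceBody advance : Program
advanceBody =
  set rU (get aMem (reg rP) (reg rI)) ⨾
  cond (symₑ == lit 0) (put aRep (reg rU) keyₑ (inc (reg rA))) skip ⨾
  set rI (inc (reg rI))
advance = set rI (lit 0) ⨾ while (reg rI ≺ sizeₑ) advanceBody

-- Kept members are compacted towards the front of their part, the others are appended to a fresh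
-- part after the last one. `aSize` is written only after the loop, so the loop bound does not move.
splitBody splitPart : Program
splitBody =
  set rU (get aMem (reg rP) (reg rI)) ⨾
  cond (symₑ == reg rF)
    (set rQ (reg rP) ⨾ set rY (reg rJ) ⨾ set rJ (inc (reg rJ)))
    (set rQ (reg rC) ⨾ set rY (reg rK) ⨾ set rK (inc (reg rK))) ⨾
  put aMem (reg rQ) (reg rY) (reg rU) ⨾
  put aPart (lit 0) (reg rU) (inc (reg rQ)) ⨾
  put aPos (lit 0) (reg rU) (reg rY) ⨾
  set rI (inc (reg rI))
splitPart =
  set rU (get aMem (reg rP) (lit 0)) ⨾
  set rF symₑ ⨾
  set rI (lit 0) ⨾
  set rJ (lit 0) ⨾
  set rK (lit 0) ⨾
  while (reg rI ≺ sizeₑ) splitBody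

markBody mark : Program
markBody = put aDone (get aMem (reg rP) (reg rI)) (reg rA) (lit 1) ⨾ set rI (inc (reg rI))
mark     = set rI (lit 0) ⨾ while (reg rI ≺ sizeₑ) markBody

lit≤ : ∀ {m k} → T (m ≤ᵇ k) → m ≤ k
lit≤ = ≤ᵇ⇒≤ _ _

-- Invariants for the loops over one part.

module _ (n : ℕ) (κ : ℕ → ℕ → ℕ) (σ : ℕ → ℕ) where

  advanceBody-run : ∀ {s p a i M} → regs s rP ≡ p → regs s rA ≡ a → regs s rI ≡ i →
    mem s aMem ≡ M → mem s aKey ≡ κ →
    Run advanceBody s 50 (λ s′ → regs s′ rI ≡ suc i ×
      (∀ k → mem s′ aRep (M p i) k ≡ adv (κ (M p i) a) a (mem s aRep (M p i)) k) ×
      (∀ {u} → u ≢ M p i → ∀ k → mem s′ aRep u k ≡ mem s aRep u k))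
  advanceBody-run {s} refl refl refl refl refl = weaken (lit≤ tt)
    (set-then (seq-run
      (cond-run {k = 7}
        (λ eq → put-run {Q = Post} (refl , (hit (≡ᵇ-true⁻ eq) , λ u≢ k → upd₂-missˡ (mem s aRep) _ _ k u≢)))
        (λ eq → weaken (lit≤ tt) (skip-run {Q = Post}
          (refl , (λ k → sym (miss (≡ᵇ-false⁻ eq) k)) , λ _ _ → refl))))
      (λ _ h → set-run (cong suc (proj₁ h) , proj₂ h))))
    where
    u = mem s aMem (regs s rP) (regs s rI)
    a = regs s rA
    c = mem s aKey u a
    Post : State → Set
    Post s′ = regs s′ rI ≡ regs s rI ×
      (∀ k → mem s′ aRep u k ≡ adv c a (mem s aRep u) k) ×
      (∀ {w} → w ≢ u → ∀ k → mem s′ aRep w k ≡ mem s aRep w k)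
    hit : mem s aRep u c ≡ 0 → ∀ k → upd₂ (mem s aRep) u c (suc a) u k ≡ adv c a (mem s aRep u) k
    hit z k with k ≟ c
    ... | yes refl rewrite ≡ᵇ-refl u | ≡ᵇ-refl k | z = refl
    ... | no k≢c rewrite ≡ᵇ-refl u | ≡ᵇ-false k≢c = refl
    miss : mem s aRep u c ≢ 0 → ∀ k → adv c a (mem s aRep u) k ≡ mem s aRep u k
    miss nz k with k ≟ c
    ... | yes refl = adv-old (mem s aRep u) nz
    ... | no k≢c   = adv-miss (mem s aRep u) k≢c

  advance-run : ∀ {s} → mem s aKey ≡ κ →
    Locates n (Cell n (regs s rC) (mem s aSize 0)) (mem s aMem) (mem s aPart 0) (mem s aPos 0) →
    regs s rP < regs s rC →
    Run advance s (7 + mem s aSize 0 (regs s rP) * 55)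
      (λ s′ → Advanced n κ σ (regs s rP) (regs s rA) (mem s aPart 0) (mem s aRep) (mem s′ aRep))
  advance-run {s} eκ loc p<c =
    set-then (conseq (λ {s′} _ → finish {s′}) (for-run {k = 50} {N = N} Inv guard step start))
    where
    open Locates loc
    p = regs s rP
    a = regs s rA
    M = mem s aMem
    N = mem s aSize 0 p
    rep = mem s aRep
    part = mem s aPart 0
    pos = mem s aPos 0
    s₁ = setReg rI 0 s
    Inv : ℕ → State → Set
    Inv i s′ = regs s′ rI ≡ i ×
      (∀ {u} → u < n → part u ≡ suc p → pos u < i → ∀ k → mem s′ aRep u k ≡ adv (κ u a) a (rep u) k) ×
      (∀ {u} → u < n → part u ≢ suc p ⊎ i ≤ pos u → ∀ k → mem s′ aRep u k ≡ rep u k)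
    start : Inv 0 s₁
    start = refl , (λ _ _ ()) , λ _ _ _ → refl
    guard : ∀ {i s′} → Agree advanceBody s₁ s′ → Inv i s′ → test s′ (reg rI ≺ sizeₑ) ≡ (i <ᵇ N)
    guard A (e , _) rewrite e | same-regs A rP refl | same-mem A aSize refl = refl
    step : ∀ {i s′} → Agree advanceBody s₁ s′ → i < N → Inv i s′ → Run advanceBody s′ 50 (Inv (suc i))
    step {i} {s′} A i<N (e , new , old) = conseq (λ {s″} _ → next {s″})
      (advanceBody-run (same-regs A rP refl) (same-regs A rA refl) e (same-mem A aMem refl)
        (trans (same-mem A aKey refl) eκ))
      where
      v = M p i
      cell = p<c , i<N
      next : ∀ {s″} → (regs s″ rI ≡ suc i ×
        (∀ k → mem s″ aRep v k ≡ adv (κ v a) a (mem s′ aRep v) k) ×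
        (∀ {u} → u ≢ v → ∀ k → mem s″ aRep u k ≡ mem s′ aRep u k)) → Inv (suc i) s″
      next {s″} (e′ , hit , miss) = e′ , new′ , old′
        where
        new′ : ∀ {u} → u < n → part u ≡ suc p → pos u < suc i → ∀ k → mem s″ aRep u k ≡ adv (κ u a) a (rep u) k
        new′ {u} u<n u∈p lt k with u ≟ v
        -- Row `v` has not been touched before, its position being `i`.
        ... | yes refl = trans (hit k) (adv-cong a (mem s′ aRep v) (rep v) (λ x → x) (λ x → x)
                            (old u<n (inj₂ (≤-reflexive (sym (at-pos cell)))) k))
        ... | no u≢v = trans (miss u≢v k) (new u<n u∈p
                (≤∧≢⇒< (s≤s⁻¹ lt) λ eq → u≢v (trans (sym (proj₂ (located-in u<n u∈p))) (cong (M p) eq))) k)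
        old′ : ∀ {u} → u < n → part u ≢ suc p ⊎ suc i ≤ pos u → ∀ k → mem s″ aRep u k ≡ rep u k
        old′ {u} u<n (inj₁ u∉p) k = trans (miss (λ { refl → u∉p (in-part cell) }) k) (old u<n (inj₁ u∉p) k)
        old′ {u} u<n (inj₂ lt) k = trans (miss (λ { refl → <-irrefl (sym (at-pos cell)) lt }) k)
                                         (old u<n (inj₂ (<⇒≤ lt)) k)
    finish : ∀ {s′} → Inv N s′ → Advanced n κ σ p a part rep (mem s′ aRep)
    finish (_ , new , old) = record
      { advanced = λ u<n u∈p → new u<n u∈p (proj₂ (proj₁ (located-in u<n u∈p)))
      ; unchanged = λ u<n u∉p → old u<n (inj₁ u∉p) }

  -- The cells in use while part p is split in place: j members kept so far, the
  -- unread ones from i on, and k members moved to the new part cnt.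
  data Slot (size : ℕ → ℕ) (p cnt i j k : ℕ) : ℕ → ℕ → Set where
    kept    : ∀ {x} → x < j → Slot size p cnt i j k p x
    waiting : ∀ {x} → i ≤ x → x < size p → Slot size p cnt i j k p x
    moved   : ∀ {x} → x < k → Slot size p cnt i j k cnt x
    other   : ∀ {q x} → q ≢ p → q < cnt → x < size q → Slot size p cnt i j k q x

  -- A member labelled `p` may be kept or still unread, and only its position can tell the two
  -- apart: hence the alternative in `is-kept`. `size` and `part` are those before the split
  -- throughout.
  record Splitting (p cnt : ℕ) (f : ℕ → ℕ) (f₀ : ℕ) (size part : ℕ → ℕ) (i j k : ℕ)
                   (M′ : ℕ → ℕ → ℕ) (part′ pos′ : ℕ → ℕ) : Set where
    field
      tally    : j + k ≡ i
      slots    : Locates n (Slot size p cnt i j k) M′ part′ pos′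
      is-moved : ∀ {u} → u < n → part′ u ≡ suc cnt → part u ≡ suc p × f u ≢ f₀
      is-fixed : ∀ {u} → u < n → part′ u ≢ suc cnt → part′ u ≡ part u
      is-kept  : ∀ {u} → u < n → part′ u ≡ suc p → f u ≡ f₀ ⊎ i ≤ pos′ u
      part′-n  : part′ n ≡ 0

    open Locates slots public

  module _ {p cnt f f₀ size part i j k M part′ pos′} (p<c : p < cnt) (i<N : i < size p)
           (S : Splitting p cnt f f₀ size part i j k M part′ pos′) where
    open Splitting S

    private
      u = M p i
      here′ : Slot size p cnt i j k p i
      here′ = waiting ≤-refl i<N
      p≢c : p ≢ cnt
      p≢c = <⇒≢ p<c
      u<n = member here′
      u∈p : part′ u ≡ suc p
      u∈p = in-part here′
      u∈p₀ : part u ≡ suc p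
      u∈p₀ = trans (sym (is-fixed u<n λ eq → p≢c (suc-injective (trans (sym u∈p) eq)))) u∈p
      -- Keeping a member therefore overwrites only a cell that has been read, possibly its own.
      j≤i : j ≤ i
      j≤i = subst (j ≤_) tally (m≤m+n j k)
      later : ∀ {w} → w < n → w ≢ u → part′ w ≡ suc p → i ≤ pos′ w → suc i ≤ pos′ w
      later w<n w≢u w∈p le = ≤∧≢⇒< le λ eq →
        w≢u (trans (sym (proj₂ (located-in w<n w∈p))) (cong (M p) (sym eq)))
      n≢u : n ≢ u
      n≢u eq = <-irrefl (sym eq) u<n

    keep : f u ≡ f₀ →
           Splitting p cnt f f₀ size part (suc i) (suc j) k (upd₂ M p j u) (upd part′ u (suc p)) (upd pos′ u j)
    keep fu = record
      { tally = cong suc tally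
      ; slots = move n slots here′ (kept ≤-refl) to from
      ; is-moved = λ {w} w<n → ≡-dec-elim w u
          (λ { refl eq → contradiction (suc-injective (trans (sym (upd-hit part′ u (suc p))) eq)) p≢c })
          (λ w≢u eq → is-moved w<n (trans (sym (upd-miss part′ _ w≢u)) eq))
      ; is-fixed = λ {w} w<n → ≡-dec-elim w u
          (λ { refl _ → trans (upd-hit part′ u (suc p)) (sym u∈p₀) })
          (λ w≢u ne → trans (upd-miss part′ _ w≢u) (is-fixed w<n (subst (_≢ suc cnt) (upd-miss part′ _ w≢u) ne)))
      ; is-kept = λ {w} w<n → ≡-dec-elim w u
          (λ { refl _ → inj₁ fu })
          (λ w≢u eq → let w∈p = trans (sym (upd-miss part′ _ w≢u)) eq in
             case-kept w<n w≢u w∈p (is-kept w<n w∈p))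
      ; part′-n = trans (upd-miss part′ _ n≢u) part′-n }
      where
      case-kept : ∀ {w} → w < n → w ≢ u → part′ w ≡ suc p → f w ≡ f₀ ⊎ i ≤ pos′ w →
                  f w ≡ f₀ ⊎ suc i ≤ upd pos′ u j w
      case-kept _ _ _ (inj₁ e) = inj₁ e
      case-kept w<n w≢u w∈p (inj₂ le) =
        inj₂ (subst (suc i ≤_) (sym (upd-miss pos′ j w≢u)) (later w<n w≢u w∈p le))
      to : ∀ {q x} → Slot size p cnt i j k q x → ¬ Same n (q , x) (p , i) →
           Slot size p cnt (suc i) (suc j) k q x × ¬ Same n (q , x) (p , j)
      to (kept x<j) _ = kept (m<n⇒m<1+n x<j) , λ { (_ , refl) → <-irrefl refl x<j }
      to (waiting i≤x x<N) ne = waiting i<x x<N , λ { (_ , refl) → <-irrefl refl (<-≤-trans i<x j≤i) }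
        where i<x = ≤∧≢⇒< i≤x λ eq → ne (refl , sym eq)
      to (moved x<k) _ = moved x<k , λ { (e , _) → p≢c (sym e) }
      to (other q≢p q<c x<) _ = other q≢p q<c x< , q≢p ∘ proj₁
      from : ∀ {q x} → Slot size p cnt (suc i) (suc j) k q x → ¬ Same n (q , x) (p , j) →
             Slot size p cnt i j k q x × ¬ Same n (q , x) (p , i)
      from (kept x≤j) ne = kept x<j , λ { (_ , refl) → <-irrefl refl (<-≤-trans x<j j≤i) }
        where x<j = ≤∧≢⇒< (s≤s⁻¹ x≤j) λ eq → ne (refl , eq)
      from (waiting i<x x<N) _ = waiting (<⇒≤ i<x) x<N , λ { (_ , refl) → <-irrefl refl i<x }
      from (moved x<k) _ = moved x<k , λ { (e , _) → p≢c (sym e) }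
      from (other q≢p q<c x<) _ = other q≢p q<c x< , q≢p ∘ proj₁

    expel : f u ≢ f₀ →
            Splitting p cnt f f₀ size part (suc i) j (suc k) (upd₂ M cnt k u) (upd part′ u (suc cnt)) (upd pos′ u k)
    expel fu = record
      { tally = trans (+-suc j k) (cong suc tally)
      ; slots = move n slots here′ (moved ≤-refl) to from
      ; is-moved = λ {w} w<n → ≡-dec-elim w u
          (λ { refl _ → u∈p₀ , fu })
          (λ w≢u eq → is-moved w<n (trans (sym (upd-miss part′ _ w≢u)) eq))
      ; is-fixed = λ {w} w<n → ≡-dec-elim w u
          (λ { refl ne → contradiction (upd-hit part′ u (suc cnt)) ne })
          (λ w≢u ne → trans (upd-miss part′ _ w≢u) (is-fixed w<n (subst (_≢ suc cnt) (upd-miss part′ _ w≢u) ne)))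
      ; is-kept = λ {w} w<n → ≡-dec-elim w u
          (λ { refl eq → contradiction (sym (suc-injective (trans (sym (upd-hit part′ u (suc cnt))) eq))) p≢c })
          (λ w≢u eq → let w∈p = trans (sym (upd-miss part′ _ w≢u)) eq in
             case-kept w<n w≢u w∈p (is-kept w<n w∈p))
      ; part′-n = trans (upd-miss part′ _ n≢u) part′-n }
      where
      case-kept : ∀ {w} → w < n → w ≢ u → part′ w ≡ suc p → f w ≡ f₀ ⊎ i ≤ pos′ w →
                  f w ≡ f₀ ⊎ suc i ≤ upd pos′ u k w
      case-kept _ _ _ (inj₁ e) = inj₁ e
      case-kept w<n w≢u w∈p (inj₂ le) =
        inj₂ (subst (suc i ≤_) (sym (upd-miss pos′ k w≢u)) (later w<n w≢u w∈p le))
      to : ∀ {q x} → Slot size p cnt i j k q x → ¬ Same n (q , x) (p , i) →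
           Slot size p cnt (suc i) j (suc k) q x × ¬ Same n (q , x) (cnt , k)
      to (kept x<j) _ = kept x<j , p≢c ∘ proj₁
      to (waiting i≤x x<N) ne = waiting (≤∧≢⇒< i≤x λ eq → ne (refl , sym eq)) x<N , p≢c ∘ proj₁
      to (moved x<k) _ = moved (m<n⇒m<1+n x<k) , λ { (_ , refl) → <-irrefl refl x<k }
      to (other q≢p q<c x<) _ = other q≢p q<c x< , λ { (refl , _) → <-irrefl refl q<c }
      from : ∀ {q x} → Slot size p cnt (suc i) j (suc k) q x → ¬ Same n (q , x) (cnt , k) →
             Slot size p cnt i j k q x × ¬ Same n (q , x) (p , i)
      from (kept x<j) ne = kept x<j , λ { (_ , refl) → <-irrefl refl (<-≤-trans x<j j≤i) }
      from (waiting i<x x<N) _ = waiting (<⇒≤ i<x) x<N , λ { (_ , refl) → <-irrefl refl i<x }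
      from (moved x≤k) ne = moved (≤∧≢⇒< (s≤s⁻¹ x≤k) λ eq → ne (refl , eq)) , λ { (e , _) → p≢c (sym e) }
      from (other q≢p q<c x<) _ = other q≢p q<c x< , q≢p ∘ proj₁

  split-start : ∀ {p cnt f f₀ size part M pos} → p < cnt → Locates n (Cell n cnt size) M part pos →
                part n ≡ 0 → Splitting p cnt f f₀ size part 0 0 0 M part pos
  split-start {p} {cnt} {size = size} p<c loc n0 = record
    { tally = refl
    ; slots = locates-resp n to from loc
    ; is-moved = λ u<n eq → let q , eq′ , (q<c , _) , _ = located u<n in
        contradiction q<c (<-irrefl (suc-injective (trans (sym eq′) eq)))
    ; is-fixed = λ _ _ → refl
    ; is-kept = λ _ _ → inj₂ z≤n
    ; part′-n = n0 }
    where
    open Locates loc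
    to : ∀ {q x} → Cell n cnt size q x → Slot size p cnt 0 0 0 q x
    to {q} (q<c , x<) with q ≟ p
    ... | yes refl = waiting z≤n x<
    ... | no q≢p   = other q≢p q<c x<
    from : ∀ {q x} → Slot size p cnt 0 0 0 q x → Cell n cnt size q x
    from (waiting _ x<) = p<c , x<
    from (other _ q<c x<) = q<c , x<

  module _ {p cnt f f₀ size part j k M part′ pos′} (p<c : p < cnt)
           (S : Splitting p cnt f f₀ size part (size p) j k M part′ pos′) where
    open Splitting S

    private
      p≢c : p ≢ cnt
      p≢c = <⇒≢ p<c

    -- After the loop no cell is waiting.
    kept-pos : ∀ {u} → u < n → part′ u ≡ suc p → pos′ u < j
    kept-pos u<n u∈p with proj₁ (located-in u<n u∈p)
    ... | kept x<j      = x<j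
    ... | waiting i≤x x< = contradiction (<-≤-trans x< i≤x) (<-irrefl refl)
    ... | moved _       = contradiction refl p≢c
    ... | other q≢p _ _ = contradiction refl q≢p

    finished-split : Split n κ σ p cnt f f₀ part part′
    finished-split = record { moved = is-moved ; fixed = is-fixed ; kept = kept′ }
      where
      kept′ : ∀ {u} → u < n → part′ u ≡ suc p → f u ≡ f₀
      kept′ u<n u∈p with is-kept u<n u∈p
      ... | inj₁ e  = e
      ... | inj₂ le = contradiction
        (<-≤-trans (kept-pos u<n u∈p) (≤-trans (subst (j ≤_) tally (m≤m+n j k)) le)) (<-irrefl refl)

    newSize : ℕ → ℕ
    newSize = upd (upd size p j) cnt k

    size-new : newSize cnt ≡ k
    size-new = upd-hit (upd size p j) cnt k

    size-kept : newSize p ≡ j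
    size-kept = trans (upd-miss (upd size p j) k p≢c) (upd-hit size p j)

    size-other : ∀ {q} → q ≢ p → q < cnt → newSize q ≡ size q
    size-other q≢p q<c = trans (upd-miss (upd size p j) k (<⇒≢ q<c)) (upd-miss size j q≢p)

    split-cells : Locates n (Cell n (suc cnt) newSize) M part′ pos′
    split-cells = locates-resp n to from slots
      where
      to : ∀ {q x} → Slot size p cnt (size p) j k q x → Cell n (suc cnt) newSize q x
      to (kept x<j) = m<n⇒m<1+n p<c , subst (_ <_) (sym size-kept) x<j
      to (waiting i≤x x<) = contradiction (<-≤-trans x< i≤x) (<-irrefl refl)
      to (moved x<k) = ≤-refl , subst (_ <_) (sym size-new) x<k
      to (other q≢p q<c x<) = m<n⇒m<1+n q<c , subst (_ <_) (sym (size-other q≢p q<c)) x<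
      from : ∀ {q x} → Cell n (suc cnt) newSize q x → Slot size p cnt (size p) j k q x
      from {q} {x} (q≤c , x<) with q ≟ cnt | q ≟ p
      ... | yes refl | _        = moved (subst (_ <_) size-new x<)
      ... | no _     | yes refl = kept (subst (_ <_) size-kept x<)
      ... | no q≢c   | no q≢p   = other q≢p q<c (subst (_ <_) (size-other q≢p q<c) x<)
        where q<c = ≤∧≢⇒< (s≤s⁻¹ q≤c) q≢c

    -- The member `ℓ` that supplied the symbol `f₀` is itself never moved, so the old part keeps a
    -- member.
    split-inhabited : ∀ {ℓ} → ℓ < n → part ℓ ≡ suc p → f ℓ ≡ f₀ → 0 < k →
                      (∀ {q} → q < cnt → 0 < size q) → ∀ {q} → q < suc cnt → 0 < newSize q
    split-inhabited {ℓ} ℓ<n ℓ∈p fℓ 0<k inh {q} q≤c with q ≟ cnt | q ≟ p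
    ... | yes refl | _        = subst (0 <_) (sym size-new) 0<k
    ... | no _     | yes refl = subst (0 <_) (sym size-kept) (≤-<-trans z≤n (kept-pos ℓ<n ℓ∈p′))
      where
      ℓ∈p′ : part′ ℓ ≡ suc p
      ℓ∈p′ = trans (is-fixed ℓ<n λ eq → proj₂ (is-moved ℓ<n eq) fℓ) ℓ∈p
    ... | no q≢c   | no q≢p   = subst (0 <_) (sym (size-other q≢p q<c)) (inh q<c)
      where q<c = ≤∧≢⇒< (s≤s⁻¹ q≤c) q≢c

  module _ {p cnt f f₀ size part j M part′ pos′} (p<c : p < cnt)
           (S : Splitting p cnt f f₀ size part (size p) j 0 M part′ pos′) where
    open Splitting S

    unsplit-part : ∀ {u} → u < n → part′ u ≡ part u
    unsplit-part {u} u<n = is-fixed u<n λ eq → none eq (proj₁ (located-in u<n eq))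
      where
      none : ∀ {x} → part′ u ≡ suc cnt → ¬ Slot size p cnt (size p) j 0 cnt x
      none eq (kept _) = contradiction p<c (<-irrefl refl)
      none eq (waiting _ _) = contradiction p<c (<-irrefl refl)
      none eq (other _ c<c _) = contradiction c<c (<-irrefl refl)

    -- As no member was moved, every member of the part was compared with `f₀` and kept.
    unsplit-const : ∀ {u} → u < n → part u ≡ suc p → f u ≡ f₀
    unsplit-const u<n u∈p = Split.kept (finished-split p<c S) u<n (trans (unsplit-part u<n) u∈p)

    unsplit-cells : Locates n (Cell n cnt size) M part′ pos′
    unsplit-cells = locates-resp n to from slots
      where
      j≡ : j ≡ size p
      j≡ = trans (sym (+-identityʳ j)) tally
      to : ∀ {q x} → Slot size p cnt (size p) j 0 q x → Cell n cnt size q x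
      to (kept x<j) = p<c , subst (_ <_) j≡ x<j
      to (waiting i≤x x<) = p<c , x<
      to (other q≢p q<c x<) = q<c , x<
      from : ∀ {q x} → Cell n cnt size q x → Slot size p cnt (size p) j 0 q x
      from {q} (q<c , x<) with q ≟ p
      ... | yes refl = kept (subst (_ <_) (sym j≡) x<)
      ... | no q≢p   = other q≢p q<c x<

size-test : ∀ {s i p size} → regs s rI ≡ i → regs s rP ≡ p → mem s aSize ≡ size →
            test s (reg rI ≺ sizeₑ) ≡ (i <ᵇ size 0 p)
size-test refl refl refl = refl

-- Counting unprocessed pairs; runs of splitting and marking.

sumBelow : ℕ → (ℕ → ℕ) → ℕ
sumBelow zero    f = 0
sumBelow (suc m) f = f m + sumBelow m f

sumBelow-mono : ∀ m {f g} → (∀ x → f x ≤ g x) → sumBelow m f ≤ sumBelow m g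
sumBelow-mono zero    h = z≤n
sumBelow-mono (suc m) h = +-mono-≤ (h m) (sumBelow-mono m h)

sumBelow-< : ∀ {m f g x} → x < m → (∀ y → f y ≤ g y) → f x < g x → sumBelow m f < sumBelow m g
sumBelow-< {suc m} {x = x} x≤m h lt with x ≟ m
... | yes refl = +-mono-<-≤ lt (sumBelow-mono m h)
... | no x≢m   = +-mono-≤-< (h m) (sumBelow-< (≤∧≢⇒< (s≤s⁻¹ x≤m) x≢m) h lt)

sumBelow-≤ : ∀ m {f k} → (∀ x → f x ≤ k) → sumBelow m f ≤ m * k
sumBelow-≤ zero    h = z≤n
sumBelow-≤ (suc m) h = +-mono-≤ (h m) (sumBelow-≤ m h)

isZero : ℕ → ℕ
isZero zero    = 1
isZero (suc _) = 0

undone : ℕ → (ℕ → ℕ → ℕ) → ℕ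
undone n done = sumBelow n λ u → sumBelow (suc n) λ b → isZero (done u b)

undone-≤ : ∀ n done → undone n done ≤ n * suc n
undone-≤ n done = sumBelow-≤ n λ u →
  subst (sumBelow (suc n) (λ b → isZero (done u b)) ≤_) (*-identityʳ (suc n)) (sumBelow-≤ (suc n) λ b → isZero-≤ (done u b))
  where
  isZero-≤ : ∀ k → isZero k ≤ 1
  isZero-≤ zero    = ≤-refl
  isZero-≤ (suc _) = z≤n

undone-mark : ∀ {n done v a} → v < n → a ≤ n → done v a ≡ 0 →
              undone n (upd₂ done v a 1) < undone n done
undone-mark {n} {done} {v} {a} v<n a≤n z =
  sumBelow-< v<n (λ u → sumBelow-mono (suc n) (le u)) (sumBelow-< (s≤s a≤n) (le v) lt)
  where
  le : ∀ u b → isZero (upd₂ done v a 1 u b) ≤ isZero (done u b)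
  le u b with (u ≡ᵇ v) ∧ (b ≡ᵇ a)
  ... | true  = z≤n
  ... | false = ≤-refl
  lt : isZero (upd₂ done v a 1 v a) < isZero (done v a)
  lt rewrite upd₂-hit done v a 1 | z = ≤-refl

module _ (n : ℕ) (κ : ℕ → ℕ → ℕ) (σ : ℕ → ℕ) where

  SplitInv : (p cnt : ℕ) (f : ℕ → ℕ) (f₀ : ℕ) (size part : ℕ → ℕ) → ℕ → State → Set
  SplitInv p cnt f f₀ size part i s = regs s rI ≡ i ×
    Splitting n κ σ p cnt f f₀ size part i (regs s rJ) (regs s rK) (mem s aMem) (mem s aPart 0) (mem s aPos 0)

  splitBody-run : ∀ {s p cnt f₀ size part i a rep} →
    regs s rP ≡ p → regs s rC ≡ cnt → regs s rA ≡ a → regs s rF ≡ f₀ →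
    mem s aKey ≡ κ → mem s aRep ≡ rep → p < cnt → i < size p →
    SplitInv p cnt (λ u → rep u (κ u a)) f₀ size part i s →
    Run splitBody s 60 (SplitInv p cnt (λ u → rep u (κ u a)) f₀ size part (suc i))
  splitBody-run refl refl refl refl refl refl p<c i<N (refl , S) = weaken (lit≤ tt)
    (set-then (cond-then {k = 23}
      (λ eq → assoc-run (set-then (assoc-run (set-then (set-then (put-then (put-then (put-then (set-run
        (refl , keep n κ σ p<c i<N S (≡ᵇ-true⁻ eq)))))))))))
      (λ eq → assoc-run (set-then (assoc-run (set-then (set-then (put-then (put-then (put-then (set-run
        (refl , expel n κ σ p<c i<N S (≡ᵇ-false⁻ eq)))))))))))))

  split-run : ∀ {s} → mem s aKey ≡ κ →
    Locates n (Cell n (regs s rC) (mem s aSize 0)) (mem s aMem) (mem s aPart 0) (mem s aPos 0) →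
    mem s aPart 0 n ≡ 0 →
    regs s rP < regs s rC →
    let f = λ u → mem s aRep u (κ u (regs s rA)) ; p = regs s rP ; N = mem s aSize 0 p in
    Run splitPart s (21 + N * 65)
      (SplitInv p (regs s rC) f (f (mem s aMem p 0)) (mem s aSize 0) (mem s aPart 0) N)
  split-run {s} refl loc n0 p<c =
    set-then (set-then (set-then (set-then (set-then
      (for-run {k = 60} {N = N} (SplitInv p cnt f (f (mem s aMem p 0)) (mem s aSize 0) (mem s aPart 0))
        (λ {i} {s′} A (e , _) → size-test {s′} e (same-regs A rP refl) (same-mem A aSize refl))
        (λ A i<N → splitBody-run (same-regs A rP refl) (same-regs A rC refl) (same-regs A rA refl)
          (same-regs A rF refl) (same-mem A aKey refl) (same-mem A aRep refl) p<c i<N)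
        (refl , split-start n κ σ p<c loc n0))))))
    where
    f = λ u → mem s aRep u (κ u (regs s rA))
    p = regs s rP
    cnt = regs s rC
    N = mem s aSize 0 p

  -- All flags of column `a` in the part are still 0, so each of the `N` writes lowers `undone` by
  -- at least one: the drop in `undone` pays for the whole processing of the column.
  mark-run : ∀ {s} →
    Locates n (Cell n (regs s rC) (mem s aSize 0)) (mem s aMem) (mem s aPart 0) (mem s aPos 0) →
    regs s rP < regs s rC → regs s rA ≤ n →
    let p = regs s rP ; a = regs s rA ; N = mem s aSize 0 p in
    (∀ {u} → u < n → mem s aPart 0 u ≡ suc p → mem s aDone u a ≡ 0) →
    Run mark s (7 + N * 15)
      (λ s′ → Marked n κ σ p a (mem s aPart 0) (mem s aDone) (mem s′ aDone) ×
              undone n (mem s′ aDone) + N ≤ undone n (mem s aDone))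
  mark-run {s} loc p<c a≤n fresh =
    set-then (conseq (λ {s′} _ → finish {s′})
      (for-run {k = 10} {N = N} Inv
        (λ {i} {s′} A (e , _) → size-test {s′} e (same-regs A rP refl) (same-mem A aSize refl))
        step
        (refl , (λ _ _ ()) , (λ _ _ → refl) , ≤-reflexive (+-identityʳ _))))
    where
    open Locates loc
    p = regs s rP
    a = regs s rA
    M = mem s aMem
    N = mem s aSize 0 p
    done = mem s aDone
    part = mem s aPart 0
    pos = mem s aPos 0
    s₁ = setReg rI 0 s
    InvOf : ℕ → ℕ → (ℕ → ℕ → ℕ) → Set
    InvOf i r done′ = r ≡ i ×
      (∀ {u} → u < n → part u ≡ suc p → pos u < i → done′ u a ≡ 1) ×
      (∀ {u b} → u < n → (part u ≢ suc p ⊎ b ≢ a) ⊎ i ≤ pos u → done′ u b ≡ done u b) ×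
      undone n done′ + i ≤ undone n done
    Inv : ℕ → State → Set
    Inv i s′ = InvOf i (regs s′ rI) (mem s′ aDone)
    next : ∀ {i done′} → i < N → InvOf i i done′ → InvOf (suc i) (suc i) (upd₂ done′ (M p i) a 1)
    next {i} {done′} i<N (_ , new , old , count) = refl , new′ , old′ , count′
      where
      v = M p i
      cell = p<c , i<N
      new′ : ∀ {u} → u < n → part u ≡ suc p → pos u < suc i → upd₂ done′ v a 1 u a ≡ 1
      new′ {u} u<n u∈p lt with u ≟ v
      ... | yes refl = upd₂-hit done′ u a 1
      ... | no u≢v = trans (upd₂-missˡ done′ a 1 a u≢v) (new u<n u∈p
              (≤∧≢⇒< (s≤s⁻¹ lt) λ eq → u≢v (trans (sym (proj₂ (located-in u<n u∈p))) (cong (M p) eq))))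
      old′ : ∀ {u b} → u < n → (part u ≢ suc p ⊎ b ≢ a) ⊎ suc i ≤ pos u → upd₂ done′ v a 1 u b ≡ done u b
      old′ {u} {b} u<n (inj₁ (inj₁ u∉p)) =
        trans (upd₂-missˡ done′ a 1 b (λ { refl → u∉p (in-part cell) })) (old u<n (inj₁ (inj₁ u∉p)))
      old′ {u} {b} u<n (inj₁ (inj₂ b≢a)) =
        trans (upd₂-missʳ done′ v 1 u b≢a) (old u<n (inj₁ (inj₂ b≢a)))
      old′ {u} {b} u<n (inj₂ lt) =
        trans (upd₂-missˡ done′ a 1 b (λ { refl → <-irrefl (sym (at-pos cell)) lt })) (old u<n (inj₂ (<⇒≤ lt)))
      count′ : undone n (upd₂ done′ v a 1) + suc i ≤ undone n done
      count′ = begin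
        undone n (upd₂ done′ v a 1) + suc i ≡⟨ +-suc _ i ⟩
        suc (undone n (upd₂ done′ v a 1)) + i ≤⟨ +-monoˡ-≤ i (undone-mark (member cell) a≤n
          (trans (old (member cell) (inj₂ (≤-reflexive (sym (at-pos cell)))))
                 (fresh (member cell) (in-part cell)))) ⟩
        undone n done′ + i ≤⟨ count ⟩
        undone n done ∎
        where open ≤-Reasoning
    step : ∀ {i s′} → Agree markBody s₁ s′ → i < N → Inv i s′ → Run markBody s′ 10 (Inv (suc i))
    step {s′ = s′} A i<N (refl , inv) = weaken (lit≤ tt) (put-then (set-run
      (subst (λ r → InvOf (suc (regs s′ rI)) (suc (regs s′ rI)) (upd₂ (mem s′ aDone) r (regs s′ rA) 1)) v≡
        (subst (λ r → InvOf (suc (regs s′ rI)) (suc (regs s′ rI)) (upd₂ (mem s′ aDone) (M p (regs s′ rI)) r 1))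
          (sym (same-regs A rA refl))
        (next i<N (refl , inv))))))
      where
      v≡ : M p (regs s′ rI) ≡ mem s′ aMem (regs s′ rP) (regs s′ rI)
      v≡ rewrite same-mem A aMem refl | same-regs A rP refl = refl
    finish : ∀ {s′} → Inv N s′ → Marked n κ σ p a part done (mem s′ aDone) × undone n (mem s′ aDone) + N ≤ undone n done
    finish (_ , new , old , count) = record
      { marked = λ u<n u∈p → new u<n u∈p (proj₂ (proj₁ (located-in u<n u∈p)))
      ; unmarked = λ u<n ne → old u<n (inj₁ ne) } , count

-- The refinement loop and its amortised cost.

next process refineBody refine : Program
next    = set rA (inc (reg rA))
process =
  advance ⨾ splitPart ⨾
  cond (reg rK == lit 0)
    (mark ⨾ next)
    (put aSize (lit 0) (reg rP) (reg rJ) ⨾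
     put aSize (lit 0) (reg rC) (reg rK) ⨾
     set rC (inc (reg rC)) ⨾
     -- The members just moved out have become columns outside part `p`, possibly below the current
     -- one, so the scan restarts; columns already done are then skipped in constant time.
     set rA (lit 0))
refineBody =
  -- `inc` makes the scan include the virtual column `n`.
  cond (reg rA ≺ inc (reg rN))
    (cond (get aPart (lit 0) (reg rA) == inc (reg rP)) next
      -- By `done-cong`, the flag of the first member speaks for the whole part.
      (cond (lit 0 ≺ get aDone (get aMem (reg rP) (lit 0)) (reg rA)) next process))
    (set rP (inc (reg rP)) ⨾ set rA (lit 0))
refine = while (reg rP ≺ reg rC) refineBody

suc-∸ : ∀ {k m} → k < m → m ∸ k ≡ suc (m ∸ suc k)
suc-∸ {zero}  (s≤s _)   = refl
suc-∸ {suc k} (s≤s k<m) = suc-∸ k<m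

affine-≤ : ∀ {b c k} N → b ≤ k → c ≤ k → b + N * c ≤ k * suc N
affine-≤ {b} {c} {k} N b≤k c≤k = begin
  b + N * c  ≤⟨ +-mono-≤ b≤k (*-monoʳ-≤ N c≤k) ⟩
  k + N * k  ≡⟨ *-comm (suc N) k ⟩
  k * suc N  ∎
  where open ≤-Reasoning

injection-≤ : ∀ {m n} (f : ∀ {i} → i < m → ℕ) → (∀ {i} (h : i < m) → f h < n) →
              (∀ {i j} (h : i < m) (h′ : j < m) → f h ≡ f h′ → i ≡ j) → m ≤ n
injection-≤ f f<n inj = injective⇒≤ {f = λ i → fromℕ< (f<n (toℕ<n i))}
  λ {i} {j} eq → toℕ-injective (inj (toℕ<n i) (toℕ<n j) (fromℕ<-injective _ _ _ _ eq))

module _ (n : ℕ) (κ : ℕ → ℕ → ℕ) (σ : ℕ → ℕ) where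

  module _ {cnt size M rep done part pos} (C : Core n κ σ cnt size M rep done part pos) where
    open Core C

    -- The first members of the parts are distinct elements.
    count-≤ : cnt ≤ n
    count-≤ = injection-≤ (λ {q} _ → M q 0) (λ h → member (h , inhabited h))
      λ h h′ eq → suc-injective (trans (sym (in-part (h , inhabited h)))
                    (trans (cong part eq) (in-part (h′ , inhabited h′))))

    size-≤ : ∀ {q} → q < cnt → size q ≤ n
    size-≤ {q} q<c = injection-≤ (λ {x} _ → M q x) (λ h → member (q<c , h))
      λ h h′ eq → trans (sym (at-pos (q<c , h))) (trans (cong pos eq) (at-pos (q<c , h′)))

  Finished : (part : ℕ → ℕ) (done : ℕ → ℕ → ℕ) (q a : ℕ) → Set
  Finished part done q a = ∀ {u b} → u < n → part u ≡ suc q → b < a → b ≤ n → part b ≢ suc q → done u b ≢ 0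

  -- The remaining columns of the current scan; then, for each part yet to be passed, a new scan of
  -- n + 1 columns and the step that starts it; for each split still possible, a new scan and up to
  -- n + 1 credits for the step that splits; finally the unprocessed pairs. Parts are counted up to
  -- `n` rather than `cnt`, as `cnt` may still grow.
  potential : (cnt p a d : ℕ) → ℕ
  potential cnt p a d = (suc n ∸ a) + ((n ∸ p) * (2 + n) + ((n ∸ cnt) * (2 + n + n) + d))

  record Refining (cnt p a : ℕ) (size : ℕ → ℕ) (M rep done : ℕ → ℕ → ℕ) (part pos : ℕ → ℕ) : Set where
    field
      core     : Core n κ σ cnt size M rep done part pos
      p≤cnt    : p ≤ cnt
      finished : ∀ {q} → q < p → Finished part done q (suc n)
      current  : Finished part done p a

  RefiningState : State → Set
  RefiningState s = regs s rN ≡ n × mem s aKey ≡ κ ×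
    Refining (regs s rC) (regs s rP) (regs s rA) (mem s aSize 0) (mem s aMem) (mem s aRep) (mem s aDone)
             (mem s aPart 0) (mem s aPos 0)

  statePotential : State → ℕ
  statePotential s = potential (regs s rC) (regs s rP) (regs s rA) (undone n (mem s aDone))

  potential-next : ∀ cnt p {a d d′ N} → a < suc n → d′ + N ≤ d →
                   potential cnt p (suc a) d′ + suc N ≤ potential cnt p a d
  potential-next cnt p {a} {d} {d′} {N} a≤n le rewrite suc-∸ a≤n = begin
    (n ∸ a) + (Y + (Z + d′)) + suc N  ≡⟨ solve 5 (λ x y z d′ N →
        x :+ (y :+ (z :+ d′)) :+ (con 1 :+ N) := con 1 :+ (x :+ (y :+ (z :+ (d′ :+ N))))) refl (n ∸ a) Y Z d′ N ⟩
    suc ((n ∸ a) + (Y + (Z + (d′ + N)))) ≤⟨ s≤s (+-monoʳ-≤ (n ∸ a) (+-monoʳ-≤ Y (+-monoʳ-≤ Z le))) ⟩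
    suc ((n ∸ a) + (Y + (Z + d))) ∎
    where
    open ≤-Reasoning
    open +-*-Solver
    Y = (n ∸ p) * (2 + n)
    Z = (n ∸ cnt) * (2 + n + n)

  potential-advance : ∀ cnt {p} a d → p < n →
                      potential cnt (suc p) 0 d + 1 ≤ potential cnt p a d
  potential-advance cnt {p} a d p<n rewrite suc-∸ p<n = begin
    suc n + (y * (2 + n) + W) + 1   ≡⟨ solve 3 (λ n y W →
        con 1 :+ n :+ (y :* (con 2 :+ n) :+ W) :+ con 1 := (con 1 :+ y) :* (con 2 :+ n) :+ W) refl n y W ⟩
    suc y * (2 + n) + W             ≤⟨ m≤n+m _ (suc n ∸ a) ⟩
    (suc n ∸ a) + (suc y * (2 + n) + W) ∎
    where
    open ≤-Reasoning
    open +-*-Solver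
    y = n ∸ suc p
    W = (n ∸ cnt) * (2 + n + n) + d

  potential-split : ∀ {cnt} p a d {N} → cnt < n → N ≤ n →
                    potential (suc cnt) p 0 d + suc N ≤ potential cnt p a d
  potential-split {cnt} p a d {N} c<n N≤n rewrite suc-∸ c<n = begin
    suc n + (Y + (z * (2 + n + n) + d)) + suc N ≤⟨ +-monoʳ-≤ (suc n + (Y + (z * (2 + n + n) + d))) (s≤s N≤n) ⟩
    suc n + (Y + (z * (2 + n + n) + d)) + suc n ≡⟨ solve 4 (λ n Y z d →
        con 1 :+ n :+ (Y :+ (z :* (con 2 :+ n :+ n) :+ d)) :+ (con 1 :+ n) :=
        Y :+ ((con 1 :+ z) :* (con 2 :+ n :+ n) :+ d)) refl n Y z d ⟩
    Y + (suc z * (2 + n + n) + d) ≤⟨ m≤n+m _ (suc n ∸ a) ⟩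
    (suc n ∸ a) + (Y + (suc z * (2 + n + n) + d)) ∎
    where
    open ≤-Reasoning
    open +-*-Solver
    Y = (n ∸ p) * (2 + n)
    z = n ∸ suc cnt

  module _ {cnt p a size M rep done part pos} (R : Refining cnt p a size M rep done part pos) where
    open Refining R
    open Core core

    skip-refining : (part a ≡ suc p ⊎ (∀ {u} → u < n → part u ≡ suc p → done u a ≢ 0)) →
                    Refining cnt p (suc a) size M rep done part pos
    skip-refining why = record { core = core ; p≤cnt = p≤cnt ; finished = finished ; current = current′ why }
      where
      current′ : (part a ≡ suc p ⊎ (∀ {u} → u < n → part u ≡ suc p → done u a ≢ 0)) →
                 Finished part done p (suc a)
      current′ why {u} {b} u<n u∈p b≤a b≤n b∉p with b ≟ a
      current′ why u<n u∈p b≤a b≤n b∉p | no b≢a = current u<n u∈p (≤∧≢⇒< (s≤s⁻¹ b≤a) b≢a) b≤n b∉p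
      current′ (inj₁ a∈p) u<n u∈p b≤a b≤n b∉p | yes refl = contradiction a∈p b∉p
      current′ (inj₂ d)   u<n u∈p b≤a b≤n b∉p | yes refl = d u<n u∈p

    advance-refining : p < cnt → n < a → Refining cnt (suc p) 0 size M rep done part pos
    advance-refining p<c n<a = record
      { core = core ; p≤cnt = p<c ; finished = finished′ ; current = λ _ _ () }
      where
      finished′ : ∀ {q} → q < suc p → Finished part done q (suc n)
      finished′ {q} q≤p with q ≟ p
      ... | yes refl = λ u<n u∈p b≤n → current u<n u∈p (≤-trans b≤n n<a)
      ... | no q≢p = finished (≤∧≢⇒< (s≤s⁻¹ q≤p) q≢p)

    advanced-refining : ∀ {rep′} → Outside n κ σ part p a → Advanced n κ σ p a part rep rep′ →
                        Refining cnt p a size M rep′ done part pos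
    advanced-refining out adv′ = record
      { core = advance-core n κ σ core out adv′ ; p≤cnt = p≤cnt ; finished = finished ; current = current }

    unsplit-refining : ∀ {f f₀ j M′ part′ pos′} → p < cnt →
      Splitting n κ σ p cnt f f₀ size part (size p) j 0 M′ part′ pos′ →
      Refining cnt p a size M′ rep done part′ pos′
    unsplit-refining {part′ = part′} p<c S = record
      { core = trivial-split-core n κ σ core same (unsplit-cells n κ σ p<c S) part′-n
      ; p≤cnt = p≤cnt
      ; finished = λ {q} q<p → transport {q} (finished q<p)
      ; current = transport current }
      where
      open Splitting S using (part′-n)
      same : ∀ {u} → u < n → part′ u ≡ part u
      same = unsplit-part n κ σ p<c S
      same′ : ∀ {b} → b ≤ n → part′ b ≡ part b
      same′ b≤n with m≤n⇒m<n∨m≡n b≤n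
      ... | inj₁ b<n  = same b<n
      ... | inj₂ refl = trans part′-n (sym part-n)
      transport : ∀ {q a} → Finished part done q a → Finished part′ done q a
      transport F u<n u∈q b<a b≤n b∉q =
        F u<n (trans (sym (same u<n)) u∈q) b<a b≤n (subst (_≢ _) (same′ b≤n) b∉q)

    -- Only members of part `p` are relabelled, and never to a part before `p`, so finished parts
    -- keep both their members and their outside.
    split-refining : ∀ {j k M′ part′ pos′} (p<c : p < cnt) → Outside n κ σ part p a →
      let f = λ u → rep u (κ u a) in
      (S : Splitting n κ σ p cnt f (f (M p 0)) size part (size p) j k M′ part′ pos′) → 0 < k →
      Refining (suc cnt) p 0 (newSize n κ σ p<c S) M′ rep done part′ pos′
    split-refining {part′ = part′} p<c out S 0<k = record
      { core = split-core n κ σ core out (finished-split n κ σ p<c S) (split-cells n κ σ p<c S)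
          (split-inhabited n κ σ p<c S (member leader) (in-part leader) refl 0<k inhabited) part′-n
      ; p≤cnt = m≤n⇒m≤1+n p≤cnt
      ; finished = λ q<p u<n u∈q b<a b≤n b∉q →
          finished q<p u<n (back q<p u<n u∈q) b<a b≤n (b∉q ∘ forth q<p b≤n)
      ; current = λ _ _ () }
      where
      leader = p<c , inhabited p<c
      open Splitting S using (part′-n; is-fixed; is-moved)
      back : ∀ {q u} → q < p → u < n → part′ u ≡ suc q → part u ≡ suc q
      back q<p u<n eq = trans (sym (is-fixed u<n λ eq′ →
        <⇒≢ (<-trans q<p p<c) (suc-injective (trans (sym eq) eq′)))) eq
      forth : ∀ {q b} → q < p → b ≤ n → part b ≡ suc q → part′ b ≡ suc q
      forth q<p b≤n eq with m≤n⇒m<n∨m≡n b≤n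
      ... | inj₂ refl = contradiction (trans (sym part-n) eq) λ ()
      ... | inj₁ b<n = trans (is-fixed b<n λ eq′ →
              <⇒≢ q<p (suc-injective (trans (sym eq) (proj₁ (is-moved b<n eq′))))) eq

    mark-refining : ∀ {f₀ done′} → f₀ ≢ 0 → (∀ {u} → u < n → part u ≡ suc p → rep u (κ u a) ≡ f₀) →
      Marked n κ σ p a part done done′ → Refining cnt p (suc a) size M rep done′ part pos
    mark-refining {done′ = done′} f₀≢0 const mk = record
      { core = mark-core n κ σ core f₀≢0 const mk
      ; p≤cnt = p≤cnt
      ; finished = λ q<p u<n u∈q b<a b≤n b∉q → still u<n (finished q<p u<n u∈q b<a b≤n b∉q)
      ; current = current′ }
      where
      open Marked mk
      still : ∀ {u b} → u < n → done u b ≢ 0 → done′ u b ≢ 0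
      still {u} {b} u<n d with part u ≟ suc p | b ≟ a
      ... | yes u∈p | yes refl = subst (_≢ 0) (sym (marked u<n u∈p)) λ ()
      ... | no u∉p  | _ = subst (_≢ 0) (sym (unmarked u<n (inj₁ u∉p))) d
      ... | _ | no b≢a  = subst (_≢ 0) (sym (unmarked u<n (inj₂ b≢a))) d
      current′ : Finished part done′ p (suc a)
      current′ {u} {b} u<n u∈p b≤a b≤n b∉p with b ≟ a
      ... | yes refl = subst (_≢ 0) (sym (marked u<n u∈p)) λ ()
      ... | no b≢a = still u<n (current u<n u∈p (≤∧≢⇒< (s≤s⁻¹ b≤a) b≢a) b≤n b∉p)

-- The tail of `process` after `advance`, named because its run is stated separately, under the
-- assumption that `advance` has made all symbols of the part nonzero.
splitMark : Program
splitMark = splitPart ⨾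
  cond (reg rK == lit 0)
    (mark ⨾ next)
    (put aSize (lit 0) (reg rP) (reg rJ) ⨾
     put aSize (lit 0) (reg rC) (reg rK) ⨾
     set rC (inc (reg rC)) ⨾
     set rA (lit 0))

module _ (n : ℕ) (κ : ℕ → ℕ → ℕ) (σ : ℕ → ℕ) where

  partSize : State → ℕ
  partSize s = mem s aSize 0 (regs s rP)

  Progress : ℕ → State → State → Set
  Progress d s s′ = RefiningState n κ σ s′ × statePotential n κ σ s′ + d ≤ statePotential n κ σ s

  InPart : State → ℕ → Set
  InPart s u = u < n × mem s aPart 0 u ≡ suc (regs s rP)

  symbolOf : State → ℕ → ℕ
  symbolOf s u = mem s aRep u (κ u (regs s rA))

  Unprocessed : State → Set
  Unprocessed s = regs s rP < regs s rC × Outside n κ σ (mem s aPart 0) (regs s rP) (regs s rA) ×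
    (∀ {u} → InPart s u → mem s aDone u (regs s rA) ≡ 0)

  markNext-run : ∀ {s f₀} → RefiningState n κ σ s → Unprocessed s → f₀ ≢ 0 →
    (∀ {u} → InPart s u → symbolOf s u ≡ f₀) →
    Run (mark ⨾ next) s (10 + partSize s * 15) (Progress (suc (partSize s)) s)
  markNext-run {s} {f₀} (en , ek , R) (p<c , (a≤n , a∉p) , fresh) f₀≢0 const =
    weaken (≤-reflexive (arith (partSize s)))
      (seq-run (mark-run n κ σ locates p<c a≤n (λ u<n u∈p → fresh (u<n , u∈p)))
        (λ {s′} A (mk , count) → set-run (ready A mk count)))
    where
    open Refining R
    open Core core
    arith : ∀ N → 7 + N * 15 + 3 ≡ 10 + N * 15
    arith N = +-comm (7 + N * 15) 3
    ready : ∀ {s′} → Agree mark s s′ →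
      Marked n κ σ (regs s rP) (regs s rA) (mem s aPart 0) (mem s aDone) (mem s′ aDone) →
      undone n (mem s′ aDone) + partSize s ≤ undone n (mem s aDone) →
      Progress (suc (partSize s)) s (setReg rA (suc (regs s′ rA)) s′)
    ready {s′} A mk count
      rewrite same-regs A rN refl | same-regs A rC refl | same-regs A rP refl | same-regs A rA refl
            | same-mem A aKey refl | same-mem A aSize refl | same-mem A aMem refl | same-mem A aRep refl
            | same-mem A aPart refl | same-mem A aPos refl =
      (en , ek , mark-refining n κ σ R f₀≢0 (λ u<n u∈p → const (u<n , u∈p)) mk) ,
      potential-next n κ σ (regs s rC) (regs s rP) (s≤s a≤n) count

  splitMark-run : ∀ {s} → RefiningState n κ σ s → Unprocessed s →
    (∀ {u} → InPart s u → symbolOf s u ≢ 0) →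
    Run splitMark s (44 + partSize s * 80) (Progress (suc (partSize s)) s)
  splitMark-run {s} (en , ek , R) (p<c , out , fresh) active =
    weaken (≤-reflexive (arith N))
      (seq-run (split-run n κ σ ek locates part-n p<c)
        (λ {s′} A (_ , S) → cond-run {k = 20 + N * 15}
          (λ eq → unsplit A S (≡ᵇ-true⁻ eq))
          (λ eq → weaken (≤-trans (lit≤ tt) (m≤m+n 20 _)) (put-then (put-then (set-then (set-run
            (split A S (n≢0⇒n>0 (≡ᵇ-false⁻ eq)))))))) ))
    where
    open Refining R
    open Core core
    N = partSize s
    p = regs s rP
    M = mem s aMem
    leader = p<c , inhabited p<c
    f = symbolOf s
    f₀ = f (M p 0)
    arith : ∀ N → 21 + N * 65 + (3 + (20 + N * 15)) ≡ 44 + N * 80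
    arith = solve 1 (λ N → con 21 :+ N :* con 65 :+ (con 3 :+ (con 20 :+ N :* con 15)) := con 44 :+ N :* con 80) refl
      where open +-*-Solver
    SplittingState : State → ℕ → Set
    SplittingState s′ k = Splitting n κ σ p (regs s rC) f f₀ (mem s aSize 0) (mem s aPart 0) N
            (regs s′ rJ) k (mem s′ aMem) (mem s′ aPart 0) (mem s′ aPos 0)
    unsplit : ∀ {s′} → Agree splitPart s s′ → SplittingState s′ (regs s′ rK) → regs s′ rK ≡ 0 →
      Run (mark ⨾ next) s′ (20 + N * 15) (Progress (suc N) s)
    unsplit {s′} A S k≡0 = weaken bound
      (conseq (λ {s″} _ → back {s″}) (markNext-run {s′} R′ un′ (active (member leader , in-part leader)) const′))
      where
      S₀ = subst (SplittingState s′) k≡0 S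
      R′ : RefiningState n κ σ s′
      R′ rewrite same-regs A rN refl | same-regs A rC refl | same-regs A rP refl | same-regs A rA refl
            | same-mem A aKey refl | same-mem A aSize refl | same-mem A aRep refl | same-mem A aDone refl =
        en , ek , unsplit-refining n κ σ R p<c S₀
      same : ∀ {u} → u < n → mem s′ aPart 0 u ≡ mem s aPart 0 u
      same = unsplit-part n κ σ p<c S₀
      same′ : ∀ {b} → b ≤ n → mem s′ aPart 0 b ≡ mem s aPart 0 b
      same′ b≤n with m≤n⇒m<n∨m≡n b≤n
      ... | inj₁ b<n  = same b<n
      ... | inj₂ refl = trans (Splitting.part′-n S₀) (sym part-n)
      inPart : ∀ {u} → InPart s′ u → InPart s u
      inPart (u<n , u∈p) = u<n , trans (sym (same u<n)) (trans u∈p (cong suc (same-regs A rP refl)))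
      un′ : Unprocessed s′
      un′ = subst (_ <_) (sym (same-regs A rC refl)) (subst (_< regs s rC) (sym (same-regs A rP refl)) p<c)
          , (subst (_≤ n) (sym (same-regs A rA refl)) (proj₁ out)
            , λ eq → proj₂ out (trans (sym (same′ (proj₁ out)))
                (trans (cong (mem s′ aPart 0) (sym (same-regs A rA refl)))
                       (trans eq (cong suc (same-regs A rP refl))))))
          , λ {u} u∈ → trans (cong (λ m → m u (regs s′ rA)) (same-mem A aDone refl))
              (trans (cong (mem s aDone u) (same-regs A rA refl)) (fresh (inPart u∈)))
      const′ : ∀ {u} → InPart s′ u → symbolOf s′ u ≡ f₀
      const′ {u} u∈ = trans (cong (λ m → m u (κ u (regs s′ rA))) (same-mem A aRep refl))
        (trans (cong (λ a → mem s aRep u (κ u a)) (same-regs A rA refl))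
               (unsplit-const n κ σ p<c S₀ (proj₁ (inPart u∈)) (proj₂ (inPart u∈))))
      size≡ : partSize s′ ≡ N
      size≡ = trans (cong (λ m → m 0 (regs s′ rP)) (same-mem A aSize refl)) (cong (mem s aSize 0) (same-regs A rP refl))
      bound : 10 + partSize s′ * 15 ≤ 20 + N * 15
      bound rewrite size≡ = +-monoˡ-≤ (N * 15) {10} {20} (lit≤ tt)
      back : ∀ {s″} → Progress (suc (partSize s′)) s′ s″ → Progress (suc N) s s″
      back (R″ , le) rewrite size≡ | same-regs A rC refl | same-regs A rP refl | same-regs A rA refl
                           | same-mem A aDone refl = R″ , le
    split : ∀ {s′} → Agree splitPart s s′ → SplittingState s′ (regs s′ rK) → 0 < regs s′ rK →
      Progress (suc N) s (setReg rA 0 (setReg rC (suc (regs s′ rC))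
        (putMem aSize 0 (regs s′ rC) (regs s′ rK) (putMem aSize 0 (regs s′ rP) (regs s′ rJ) s′))))
    split {s′} A S 0<k
      rewrite same-regs A rN refl | same-regs A rC refl | same-regs A rP refl
            | same-mem A aKey refl | same-mem A aSize refl | same-mem A aRep refl | same-mem A aDone refl =
      (en , ek , R′) ,
      potential-split n κ σ p (regs s rA) (undone n (mem s aDone))
        -- Applied to the core after the split, `count-≤` says that the old count was below `n`, so
        -- a split was still available in the potential.
        (count-≤ n κ σ (Refining.core R′)) (size-≤ n κ σ core p<c)
      where
      R′ = split-refining n κ σ R p<c out S 0<k

  process-run : ∀ {s} → RefiningState n κ σ s → Unprocessed s →
    Run process s (51 + partSize s * 135) (Progress (suc (partSize s)) s)
  process-run {s} (en , ek , R) (p<c , out , fresh) =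
    weaken (≤-reflexive (arith N))
      (seq-run (advance-run n κ σ ek locates p<c) rest)
    where
    open Refining R
    open Core core
    N = partSize s
    arith : ∀ N → 7 + N * 55 + (44 + N * 80) ≡ 51 + N * 135
    arith = solve 1 (λ N → con 7 :+ N :* con 55 :+ (con 44 :+ N :* con 80) := con 51 :+ N :* con 135) refl
      where open +-*-Solver
    rest : ∀ {s′} → Agree advance s s′ →
      Advanced n κ σ (regs s rP) (regs s rA) (mem s aPart 0) (mem s aRep) (mem s′ aRep) →
      Run splitMark s′ (44 + N * 80) (Progress (suc N) s)
    rest {s′} A adv′ = weaken bound (conseq (λ {s″} _ → back {s″}) (splitMark-run {s′} R′ un′ active))
      where
      R′ : RefiningState n κ σ s′
      R′ rewrite same-regs A rN refl | same-regs A rC refl | same-regs A rP refl | same-regs A rA refl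
            | same-mem A aKey refl | same-mem A aSize refl | same-mem A aMem refl | same-mem A aDone refl
            | same-mem A aPart refl | same-mem A aPos refl =
        en , ek , advanced-refining n κ σ R out adv′
      un′ : Unprocessed s′
      un′ rewrite same-regs A rC refl | same-regs A rP refl | same-regs A rA refl
            | same-mem A aDone refl | same-mem A aPart refl = p<c , out , fresh
      active : ∀ {u} → InPart s′ u → symbolOf s′ u ≢ 0
      active {u} u∈ rewrite same-regs A rP refl | same-regs A rA refl | same-mem A aPart refl =
        subst (_≢ 0) (sym (Advanced.advanced adv′ (proj₁ u∈) (proj₂ u∈) _))
              (adv-hit (κ u (regs s rA)) (regs s rA) (mem s aRep u))
      size≡ : partSize s′ ≡ N
      size≡ = trans (cong (λ m → m 0 (regs s′ rP)) (same-mem A aSize refl)) (cong (mem s aSize 0) (same-regs A rP refl))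
      bound : 44 + partSize s′ * 80 ≤ 44 + N * 80
      bound rewrite size≡ = ≤-refl
      back : ∀ {s″} → Progress (suc (partSize s′)) s′ s″ → Progress (suc N) s s″
      back (R″ , le) rewrite size≡ | same-regs A rC refl | same-regs A rP refl | same-regs A rA refl
                           | same-mem A aDone refl = R″ , le

  -- Skipping a column or leaving a part is charged one credit, processing a part of `N` members
  -- `N + 1`. With the guards, processing takes at most 68 + 135 N steps, which 200 per credit
  -- covers.
  refineBody-run : ∀ {s} → RefiningState n κ σ s → regs s rP < regs s rC →
    ∃[ d ] (1 ≤ d × Run refineBody s (200 * d) (Progress d s))
  refineBody-run {s} (en , ek , R) p<c = go
    where
    open Refining R
    open Core core
    p = regs s rP
    a = regs s rA
    part = mem s aPart 0
    ℓ = mem s aMem p 0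
    leader = p<c , inhabited p<c
    skipped : (part a ≡ suc p ⊎ (∀ {u} → u < n → part u ≡ suc p → mem s aDone u a ≢ 0)) → a ≤ n →
              Progress 1 s (setReg rA (suc a) s)
    skipped why a≤n = (en , ek , skip-refining n κ σ R why) ,
      potential-next n κ σ (regs s rC) p (s≤s a≤n) (≤-reflexive (+-identityʳ _))
    uniform : ∀ {u} → u < n → part u ≡ suc p → mem s aDone ℓ a ≡ mem s aDone u a
    uniform u<n u∈p = done-cong (member leader) u<n (trans (in-part leader) (sym u∈p)) a
    go : ∃[ d ] (1 ≤ d × Run refineBody s (200 * d) (Progress d s))
    go with a ≤? n
    ... | no a≰n = 1 , ≤-refl , weaken (lit≤ tt) (else-run eq (set-then (set-run
            ((en , ek , advance-refining n κ σ R p<c (≰⇒> a≰n)) ,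
             potential-advance n κ σ (regs s rC) a _ (<-≤-trans p<c (count-≤ n κ σ core))))))
      where
      eq : test s (reg rA ≺ inc (reg rN)) ≡ false
      eq rewrite en = <ᵇ-false (≰⇒> a≰n)
    ... | yes a≤n with part a ≟ suc p
    ...   | yes a∈p = 1 , ≤-refl , weaken (lit≤ tt) (then-run eq (then-run eq′ (set-run (skipped (inj₁ a∈p) a≤n))))
      where
      eq : test s (reg rA ≺ inc (reg rN)) ≡ true
      eq rewrite en = <ᵇ-true (s≤s a≤n)
      eq′ : test s (get aPart (lit 0) (reg rA) == inc (reg rP)) ≡ true
      eq′ rewrite a∈p = ≡ᵇ-refl p
    ...   | no a∉p with mem s aDone ℓ a ≟ 0
    ...     | no d≢0 = 1 , ≤-refl , weaken (lit≤ tt) (then-run eq (else-run (≡ᵇ-false a∉p) (then-run (<ᵇ-true (n≢0⇒n>0 d≢0))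
                (set-run (skipped (inj₂ λ u<n u∈p → subst (_≢ 0) (uniform u<n u∈p) d≢0) a≤n)))))
      where
      eq : test s (reg rA ≺ inc (reg rN)) ≡ true
      eq rewrite en = <ᵇ-true (s≤s a≤n)
    ...     | yes d≡0 = suc (partSize s) , s≤s z≤n , weaken
                (affine-≤ {68} {135} {200} (partSize s) (lit≤ tt) (lit≤ tt))
                (then-run eq (else-run (≡ᵇ-false a∉p) (else-run (<ᵇ-false (≤-reflexive d≡0))
                  (process-run (en , ek , R)
                    (p<c , (a≤n , a∉p) , λ (u<n , u∈p) → trans (sym (uniform u<n u∈p)) d≡0)))))
      where
      eq : test s (reg rA ≺ inc (reg rN)) ≡ true
      eq rewrite en = <ᵇ-true (s≤s a≤n)

  refine-run : ∀ {s} → RefiningState n κ σ s →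
    Run refine s (4 + 204 * statePotential n κ σ s)
        (λ s′ → RefiningState n κ σ s′ × regs s′ rP ≡ regs s′ rC)
  refine-run {s} R = weaken (+-mono-≤ (lit≤ {3} {4} tt) (*-monoˡ-≤ (statePotential n κ σ s) (lit≤ {203} {204} tt)))
    (conseq finish (credit-run {k = 200}
      (λ m s → RefiningState n κ σ s × statePotential n κ σ s ≡ m) step (R , refl)))
    where
    step : ∀ {m s} → RefiningState n κ σ s × statePotential n κ σ s ≡ m → test s (reg rP ≺ reg rC) ≡ true →
      ∃[ d ] (1 ≤ d × Run refineBody s (200 * d)
        (λ s′ → ∃[ m′ ] (m′ + d ≤ m × (RefiningState n κ σ s′ × statePotential n κ σ s′ ≡ m′))))
    step {s = s} (R , refl) eq with refineBody-run {s} R (<ᵇ-true⁻ eq)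
    ... | d , 1≤d , r = d , 1≤d , conseq (λ _ (R′ , le) → _ , le , R′ , refl) r
    finish : ∀ {s′} → Agree refine s s′ →
      (test s′ (reg rP ≺ reg rC) ≡ false × ∃[ m′ ] (RefiningState n κ σ s′ × statePotential n κ σ s′ ≡ m′)) →
      RefiningState n κ σ s′ × regs s′ rP ≡ regs s′ rC
    finish _ (eq , _ , R′@(_ , _ , Rf) , _) = R′ , ≤-antisym (Refining.p≤cnt Rf) (<ᵇ-false⁻ eq)

aSubset aInput : Arr
aSubset = 0
aInput  = 1

-- Reading the listings into the key table.

readClassBody readClass readClassesBody readClasses loadRow load : Program
readClassBody =
  put aKey (reg rX) (get aInput (reg rX) (reg rO)) (reg rK) ⨾
  set rO (inc (reg rO)) ⨾
  set rE (dec (reg rE))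
readClass = while (lit 0 ≺ reg rE) readClassBody
readClassesBody =
  -- Incremented before the class is read: keys start at 1, and 0 stays free for the virtual column.
  set rK (inc (reg rK)) ⨾
  set rE (get aInput (reg rX) (reg rO)) ⨾
  set rO (inc (reg rO)) ⨾
  readClass
readClasses = while (reg rK ≺ get aInput (reg rX) (lit 0)) readClassesBody
loadRow =
  set rO (lit 1) ⨾
  set rK (lit 0) ⨾
  readClasses ⨾
  -- Key 0 belongs to the virtual column, whose symbol is the colour of the row.
  put aRep (reg rX) (lit 0) (inc (get aSubset (lit 0) (reg rX))) ⨾
  put aMem (lit 0) (reg rX) (reg rX) ⨾
  put aPart (lit 0) (reg rX) (lit 1) ⨾
  put aPos (lit 0) (reg rX) (reg rX) ⨾
  set rX (inc (reg rX))
load =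
  while (reg rX ≺ reg rN) loadRow ⨾
  -- When n = 0 there must be no part at all, since parts are nonempty.
  cond (lit 0 ≺ reg rN)
    (put aSize (lit 0) (lit 0) (reg rN) ⨾ set rC (lit 1))
    skip

module _ {n : ℕ} where

  classes : Listing n → List ℕ
  classes = concatMap (λ C → length C ∷ map toℕ C)

  Reads : State → List ℕ → Set
  Reads s zs = ∀ j → mem s aInput (regs s rX) (j + regs s rO) ≡ nth zs j

  reads-tail : ∀ (f : ℕ → ℕ) o {z zs} → (∀ j → f (j + o) ≡ nth (z ∷ zs) j) → ∀ j → f (j + suc o) ≡ nth zs j
  reads-tail f o h j = trans (cong f (+-suc j o)) (h (suc j))

  Avoids : List (Fin n) → ℕ → Set
  Avoids ys v = ∀ {y} → y ∈ ys → toℕ y ≢ v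

  record Writes (x c : ℕ) (ys : List (Fin n)) (f f′ : ℕ → ℕ → ℕ) : Set where
    field
      written   : ∀ {y} → y ∈ ys → f′ x (toℕ y) ≡ c
      untouched : ∀ {u v} → u ≢ x ⊎ Avoids ys v → f′ u v ≡ f u v

  readClass-run : ∀ ys {s zs} → Reads s (map toℕ ys ++ zs) → regs s rE ≡ length ys →
    Run readClass s (3 + length ys * 15)
      (λ s′ → Reads s′ zs × Writes (regs s rX) (regs s rK) ys (mem s aKey) (mem s′ aKey))
  readClass-run [] {s} rd e = stop-run eq (rd , record { written = λ () ; untouched = λ _ → refl })
    where
    eq : test s (lit 0 ≺ reg rE) ≡ false
    eq = <ᵇ-false (≤-reflexive e)
  readClass-run (y ∷ ys) {s} {zs} rd e = weaken (≤-reflexive (arith (length ys)))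
    (loop-run {j = 12} {k = 3 + length ys * 15} eq
      (weaken (lit≤ tt) (put-then (set-then (set-run {Q = λ s′ → s′ ≡ s₁} refl))))
      λ { _ refl → conseq (λ {s′} _ → finish {s′})
        (readClass-run ys {s₁} {zs} (reads-tail (mem s aInput x) (regs s rO) rd) (cong pred e)) })
    where
    x = regs s rX
    v = mem s aInput x (regs s rO)
    s₁ = setReg rE (pred (regs s rE)) (setReg rO (suc (regs s rO)) (putMem aKey x v (regs s rK) s))
    eq : test s (lit 0 ≺ reg rE) ≡ true
    eq rewrite e = refl
    arith : ∀ l → 3 + (12 + (3 + l * 15)) ≡ 3 + suc l * 15
    arith l = refl
    finish : ∀ {s′} → Reads s′ zs × Writes x (regs s rK) ys (upd₂ (mem s aKey) x v (regs s rK)) (mem s′ aKey) →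
      Reads s′ zs × Writes x (regs s rK) (y ∷ ys) (mem s aKey) (mem s′ aKey)
    finish {s′} (rd′ , w) = rd′ , record { written = written′ ; untouched = untouched′ }
      where
      open Writes w
      v≡ : v ≡ toℕ y
      v≡ = rd 0
      written′ : ∀ {z} → z ∈ y ∷ ys → mem s′ aKey x (toℕ z) ≡ regs s rK
      written′ (there z∈) = written z∈
      -- Should `y` occur again, the later write stores the same number.
      written′ (here refl) with any? (y Fin.≟_) ys
      ... | yes y∈ = written y∈
      ... | no y∉  = trans (untouched (inj₂ λ z∈ eq → y∉ (subst (_∈ ys) (toℕ-injective eq) z∈)))
              (trans (cong (upd₂ (mem s aKey) x v (regs s rK) x) (sym v≡)) (upd₂-hit (mem s aKey) x v (regs s rK)))
      untouched′ : ∀ {u w} → u ≢ x ⊎ Avoids (y ∷ ys) w → mem s′ aKey u w ≡ mem s aKey u w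
      untouched′ {u} {w} (inj₁ u≢x) = trans (untouched (inj₁ u≢x)) (upd₂-missˡ (mem s aKey) _ _ w u≢x)
      untouched′ {u} {w} (inj₂ av) = trans (untouched (inj₂ (av ∘ there)))
        (upd₂-missʳ (mem s aKey) x _ u λ eq → av (here refl) (trans (sym v≡) (sym eq)))

  record WritesAll (x c : ℕ) (Ls : Listing n) (f f′ : ℕ → ℕ → ℕ) : Set where
    field
      written   : ∀ i {y} → y ∈ lookup Ls i → f′ x (toℕ y) ≡ suc (toℕ i + c)
      untouched : ∀ {u v} → u ≢ x ⊎ All (λ C → Avoids C v) Ls → f′ u v ≡ f u v

  -- Each class contributes its own length entry to `classes`, and the 30 steps allotted to that
  -- entry absorb the overhead per class.
  readClasses-run : ∀ Ls {s c} → Reads s (classes Ls) → regs s rK ≡ c →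
    mem s aInput (regs s rX) 0 ≡ c + length Ls → AllPairs Disjoint Ls →
    Run readClasses s (5 + length (classes Ls) * 30)
      (λ s′ → WritesAll (regs s rX) c Ls (mem s aKey) (mem s′ aKey))
  readClasses-run [] {s} {c} rd eK eN _ = stop-run eq (record { written = λ () ; untouched = λ _ → refl })
    where
    eq : test s (reg rK ≺ get aInput (reg rX) (lit 0)) ≡ false
    eq = <ᵇ-false (≤-reflexive (trans eN (trans (+-identityʳ c) (sym eK))))
  readClasses-run (C ∷ Ls) {s} {c} rd refl eN (C# ∷ Ls#) = weaken bound
    (loop-run {j = 10 + (3 + length C * 15)} {k = 5 + length (classes Ls) * 30} eq
      (set-then (set-then (set-then
        (conseq (λ B (rd′ , w) → rd′ , w , same-regs B rK refl)
          (readClass-run C {s₁} {classes Ls} (reads-tail (mem s aInput x) (regs s rO) rd) (rd 0))))))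
      (λ {s′} A (rd′ , w , eK) → conseq (λ {s″} _ → finish {s′} {s″} A w)
        (readClasses-run Ls {s′} {suc (regs s rK)} rd′ eK (eN′ A) Ls#)))
    where
    x = regs s rX
    s₁ = setReg rO (suc (regs s rO)) (setReg rE (mem s aInput x (regs s rO)) (setReg rK (suc (regs s rK)) s))
    eq : test s (reg rK ≺ get aInput (reg rX) (lit 0)) ≡ true
    eq rewrite eN = <ᵇ-true (m<m+n (regs s rK) (s≤s z≤n))
    lc = length (classes Ls)
    bound : 5 + (10 + (3 + length C * 15) + (5 + lc * 30)) ≤ 5 + length (classes (C ∷ Ls)) * 30
    bound = +-monoʳ-≤ 5 (begin
      13 + length C * 15 + (5 + lc * 30)
        ≤⟨ +-mono-≤ (+-mono-≤ {13} {25} (lit≤ tt) (*-monoʳ-≤ (length C) {15} {30} (lit≤ tt))) (≤-refl {5 + lc * 30}) ⟩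
      25 + length C * 30 + (5 + lc * 30)
        ≡⟨ solve 2 (λ a b → con 25 :+ a :* con 30 :+ (con 5 :+ b :* con 30)
                      := (con 1 :+ (a :+ b)) :* con 30) refl (length C) lc ⟩
      suc (length C + lc) * 30               ≡⟨ cong (λ l → suc l * 30) (sym lengths) ⟩
      length (classes (C ∷ Ls)) * 30         ∎)
      where
      open ≤-Reasoning
      open +-*-Solver
      lengths : length (map toℕ C ++ classes Ls) ≡ length C + lc
      lengths = trans (length-++ (map toℕ C)) (cong (_+ lc) (length-map toℕ C))
    eN′ : ∀ {s′} → Agree readClassesBody s s′ → mem s′ aInput (regs s′ rX) 0 ≡ suc (regs s rK) + length Ls
    eN′ A rewrite same-regs A rX refl | same-mem A aInput refl = trans eN (+-suc (regs s rK) (length Ls))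
    finish : ∀ {s′ s″} → Agree readClassesBody s s′ →
      Writes x (suc (regs s rK)) C (mem s aKey) (mem s′ aKey) →
      WritesAll (regs s′ rX) (suc (regs s rK)) Ls (mem s′ aKey) (mem s″ aKey) →
      WritesAll x (regs s rK) (C ∷ Ls) (mem s aKey) (mem s″ aKey)
    finish {s′} {s″} A w ws rewrite same-regs A rX refl = record { written = written′ ; untouched = untouched′ }
      where
      module W = Writes w
      open WritesAll ws
      written′ : ∀ i {y} → y ∈ lookup (C ∷ Ls) i → mem s″ aKey x (toℕ y) ≡ suc (toℕ i + regs s rK)
      -- Later classes are disjoint from `C`, so reading them does not overwrite its keys.
      written′ fzero y∈ = trans
        (untouched (inj₂ (All.map (λ D# {z} z∈ eq → D# (subst (_∈ C) (sym (toℕ-injective eq)) y∈ , z∈)) C#)))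
        (W.written y∈)
      written′ (fsuc i) y∈ = trans (written i y∈) (cong suc (+-suc (toℕ i) (regs s rK)))
      untouched′ : ∀ {u v} → u ≢ x ⊎ All (λ D → Avoids D v) (C ∷ Ls) → mem s″ aKey u v ≡ mem s aKey u v
      untouched′ (inj₁ u≢x) = trans (untouched (inj₁ u≢x)) (W.untouched (inj₁ u≢x))
      untouched′ (inj₂ (av ∷ avs)) = trans (untouched (inj₂ avs)) (W.untouched (inj₂ av))

  record Loaded (L : Fin n → Listing n) (colour : ℕ → ℕ) (key rep M : ℕ → ℕ → ℕ) (part pos : ℕ → ℕ)
                (x : Fin n) : Set where
    field
      keys    : ∀ i {y} → y ∈ lookup (L x) i → key (toℕ x) (toℕ y) ≡ suc (toℕ i + 0)
      no-keys : ∀ {v} → All (λ C → Avoids C v) (L x) → key (toℕ x) v ≡ 0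
      rep-0   : rep (toℕ x) 0 ≡ suc (colour (toℕ x))
      member  : M 0 (toℕ x) ≡ toℕ x
      in-part : part (toℕ x) ≡ 1
      at-pos  : pos (toℕ x) ≡ toℕ x

  record Loading (L : Fin n → Listing n) (colour : ℕ → ℕ) (i : ℕ) (key rep M : ℕ → ℕ → ℕ)
                 (part pos : ℕ → ℕ) : Set where
    field
      loaded  : ∀ x → toℕ x < i → Loaded L colour key rep M part pos x
      no-key  : ∀ {u} → i ≤ u → ∀ v → key u v ≡ 0
      no-part : ∀ {u} → i ≤ u → part u ≡ 0
      no-rep  : ∀ u k → rep u (suc k) ≡ 0

  LoadingState : (Fin n → Listing n) → (ℕ → ℕ) → ℕ → State → Set
  LoadingState L colour i s = regs s rX ≡ i ×
    Loading L colour i (mem s aKey) (mem s aRep) (mem s aMem) (mem s aPart 0) (mem s aPos 0)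

  module _ (L : Fin n → Listing n) (W : ℕ) (small : ∀ x → length (classes (L x)) ≤ W)
           (disjoint : ∀ x → AllPairs Disjoint (L x)) where

    loadRow-run : ∀ {s} x → (∀ j → mem s aInput (toℕ x) j ≡ nth (encode (L x)) j) →
      LoadingState L (mem s aSubset 0) (toℕ x) s →
      Run loadRow s (31 + W * 30) (LoadingState L (mem s aSubset 0) (suc (toℕ x)))
    loadRow-run {s} x input ld = weaken bound
      (set-then (set-then (seq-run
        (readClasses-run (L x) {s₁} {0} reads refl size (disjoint x))
        λ {s′} A w → put-then (put-then (put-then (put-then (set-run (finish A w))))))))
      where
      counter = proj₁ ld
      open Loading (proj₂ ld)
      s₁ = setReg rK 0 (setReg rO 1 s)
      reads : Reads s₁ (classes (L x))
      reads j rewrite counter = trans (cong (mem s aInput (toℕ x)) (+-comm j 1)) (input (suc j))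
      size : mem s aInput (regs s rX) 0 ≡ length (L x)
      size rewrite counter = input 0
      bound : _ ≤ 31 + W * 30
      bound = ≤-trans (≤-reflexive (arith (length (classes (L x)) * 30)))
                (+-monoʳ-≤ 31 (*-monoˡ-≤ 30 (small x)))
        where
        arith : ∀ m → 4 + (5 + m + 22) ≡ 31 + m
        arith m = trans (cong (4 +_) (trans (+-assoc 5 m 22) (cong (5 +_) (+-comm m 22)))) refl
      finish : ∀ {s′} → Agree readClasses s₁ s′ →
        WritesAll (regs s rX) 0 (L x) (mem s aKey) (mem s′ aKey) →
        let v = regs s′ rX in
        suc v ≡ suc (toℕ x) ×
        Loading L (mem s aSubset 0) (suc (toℕ x)) (mem s′ aKey)
          (upd₂ (mem s′ aRep) v 0 (suc (mem s′ aSubset 0 v)))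
          (upd₂ (mem s′ aMem) 0 v v) (upd (mem s′ aPart 0) v 1) (upd (mem s′ aPos 0) v v)
      finish {s′} A w rewrite same-regs A rX refl | counter | same-mem A aSubset refl | same-mem A aRep refl
                            | same-mem A aMem refl | same-mem A aPart refl | same-mem A aPos refl = refl , record
        { loaded = loaded′
        ; no-key = λ x<u v → trans (untouched (inj₁ (>⇒≢ x<u))) (no-key (<⇒≤ x<u) v)
        ; no-part = λ x<u → trans (upd-miss (mem s aPart 0) 1 (>⇒≢ x<u)) (no-part (<⇒≤ x<u))
        ; no-rep = λ u k → trans (upd₂-missʳ (mem s aRep) (toℕ x) {0} _ u λ ()) (no-rep u k) }
        where
        open WritesAll w
        loaded′ : ∀ y → toℕ y < suc (toℕ x) → Loaded L (mem s aSubset 0) (mem s′ aKey)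
          (upd₂ (mem s aRep) (toℕ x) 0 (suc (mem s aSubset 0 (toℕ x))))
          (upd₂ (mem s aMem) 0 (toℕ x) (toℕ x)) (upd (mem s aPart 0) (toℕ x) 1) (upd (mem s aPos 0) (toℕ x) (toℕ x)) y
        loaded′ y y≤x with y Fin.≟ x
        ... | yes refl = record
          { keys = written
          ; no-keys = λ av → trans (untouched (inj₂ av)) (no-key ≤-refl _)
          ; rep-0 = upd₂-hit (mem s aRep) (toℕ x) 0 _
          ; member = upd₂-hit (mem s aMem) 0 (toℕ x) _
          ; in-part = upd-hit (mem s aPart 0) (toℕ x) 1
          ; at-pos = upd-hit (mem s aPos 0) (toℕ x) (toℕ x) }
        ... | no y≢x = record
          { keys = λ i y∈ → trans (untouched (inj₁ ne)) (Loaded.keys old i y∈)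
          ; no-keys = λ av → trans (untouched (inj₁ ne)) (Loaded.no-keys old av)
          ; rep-0 = trans (upd₂-missˡ (mem s aRep) 0 _ 0 ne) (Loaded.rep-0 old)
          ; member = trans (upd₂-missʳ (mem s aMem) 0 _ 0 ne) (Loaded.member old)
          ; in-part = trans (upd-miss (mem s aPart 0) 1 ne) (Loaded.in-part old)
          ; at-pos = trans (upd-miss (mem s aPos 0) _ ne) (Loaded.at-pos old) }
          where
          ne : toℕ y ≢ toℕ x
          ne = y≢x ∘ toℕ-injective
          old = loaded y (≤∧≢⇒< (s≤s⁻¹ y≤x) ne)

    load-run : ∀ {s} → regs s rN ≡ n → (∀ x j → mem s aInput (toℕ x) j ≡ nth (encode (L x)) j) →
      LoadingState L (mem s aSubset 0) 0 s →
      Run load s (20 + n * (40 + W * 30))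
        (λ s′ → LoadingState L (mem s aSubset 0) n s′ × regs s′ rN ≡ n ×
          (0 < n → regs s′ rC ≡ 1 × mem s′ aSize 0 0 ≡ n) × (n ≡ 0 → regs s′ rC ≡ regs s rC))
    load-run {s} en input start = weaken bound
      (seq-run
        (for-run {k = 31 + W * 30} {N = n} (LoadingState L (mem s aSubset 0)) guard step start)
        (λ {s′} A ld → cond-run {k = 6}
          (λ eq → put-then (set-run (ld , trans (same-regs A rN refl) en ,
            (λ _ → refl , trans (same-regs A rN refl) en) ,
            λ n≡0 → contradiction (subst (0 <_) (trans (same-regs A rN refl) (trans en n≡0)) (<ᵇ-true⁻ eq)) λ ())))
          (λ eq → weaken (lit≤ tt) (skip-run (ld , trans (same-regs A rN refl) en ,
            (λ 0<n → contradiction (subst (0 <_) (sym (trans (same-regs A rN refl) en)) 0<n) (≤⇒≯ (<ᵇ-false⁻ eq))) ,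
            λ _ → same-regs A rC refl)))))
      where
      bound : 3 + n * (3 + (31 + W * 30)) + (3 + 6) ≤ 20 + n * (40 + W * 30)
      bound = begin
        3 + n * (34 + W * 30) + 9    ≡⟨ +-comm (3 + n * (34 + W * 30)) 9 ⟩
        12 + n * (34 + W * 30)       ≤⟨ +-mono-≤ {12} {20} (lit≤ tt) (*-monoʳ-≤ n (+-monoˡ-≤ (W * 30) {34} {40} (lit≤ tt))) ⟩
        20 + n * (40 + W * 30)       ∎
        where open ≤-Reasoning
      guard : ∀ {i s′} → Agree loadRow s s′ → LoadingState L (mem s aSubset 0) i s′ → test s′ (reg rX ≺ reg rN) ≡ (i <ᵇ n)
      guard A ld rewrite proj₁ ld | same-regs A rN refl | en = refl
      step : ∀ {i s′} → Agree loadRow s s′ → i < n → LoadingState L (mem s aSubset 0) i s′ →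
             Run loadRow s′ (31 + W * 30) (LoadingState L (mem s aSubset 0) (suc i))
      step {i} {s′} A i<n ld =
        subst (λ m → Run loadRow s′ (31 + W * 30) (LoadingState L (mem s aSubset 0) (suc m))) (toℕ-fromℕ< i<n)
          (subst (λ m → Run loadRow s′ (31 + W * 30) (LoadingState L (m 0) (suc (toℕ x)))) (same-mem A aSubset refl)
            (loadRow-run x
              (λ j → trans (cong (λ m → m (toℕ x) j) (same-mem A aInput refl)) (input x j))
              (subst (λ m → LoadingState L (m 0) (toℕ x) s′) (sym (same-mem A aSubset refl))
                (subst (λ m → LoadingState L (mem s aSubset 0) m s′) (sym (toℕ-fromℕ< i<n)) ld))))
        where x = fromℕ< i<n

-- Writing the output.

aOut : Arr
aOut = 2

emitPartBody emitPart emitBody emit : Program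
emitPartBody =
  put aOut (lit 0) (reg rO) (get aMem (reg rP) (reg rI)) ⨾
  set rO (inc (reg rO)) ⨾
  set rI (inc (reg rI))
emitPart = while (reg rI ≺ sizeₑ) emitPartBody
emitBody =
  put aOut (lit 0) (reg rO) sizeₑ ⨾
  set rO (inc (reg rO)) ⨾
  set rI (lit 0) ⨾
  emitPart ⨾
  set rP (inc (reg rP))
emit =
  put aOut (lit 0) (lit 0) (reg rC) ⨾
  set rO (lit 1) ⨾
  set rP (lit 0) ⨾
  while (reg rP ≺ reg rC) emitBody

Begins : (ℕ → ℕ) → List ℕ → Set
Begins f w = ∀ {j} → j < length w → f j ≡ nth w j

nth-++ˡ : ∀ w {v j} → j < length w → nth (w ++ v) j ≡ nth w j
nth-++ˡ (x ∷ w) {j = zero}  _         = refl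
nth-++ˡ (x ∷ w) {j = suc j} (s≤s j<w) = nth-++ˡ w j<w

nth-last : ∀ w {x} → nth (w ++ x ∷ []) (length w) ≡ x
nth-last []      = refl
nth-last (_ ∷ w) = nth-last w

length-∷ʳ : ∀ (w : List ℕ) {x} → length (w ++ x ∷ []) ≡ suc (length w)
length-∷ʳ w = trans (length-++ w) (+-comm (length w) 1)

begins-∷ʳ : ∀ {f} w {x} → Begins f w → Begins (upd f (length w) x) (w ++ x ∷ [])
begins-∷ʳ {f} w {x} B {j} j< with j ≟ length w
... | yes refl = trans (upd-hit f j x) (sym (nth-last w))
... | no j≢ = trans (upd-miss f x j≢) (trans (B j<w) (sym (nth-++ˡ w j<w)))
  where j<w = ≤∧≢⇒< (s≤s⁻¹ (subst (j <_) (length-∷ʳ w) j<)) j≢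

lookup-nth : ∀ (w : List ℕ) j → lookup w j ≡ nth w (toℕ j)
lookup-nth (x ∷ w) fzero    = refl
lookup-nth (x ∷ w) (fsuc j) = lookup-nth w j

Written : List ℕ → State → Set
Written w s = regs s rO ≡ length w × Begins (mem s aOut 0) w

written-∷ʳ : ∀ {w s x} → Written w s → suc (regs s rO) ≡ length (w ++ x ∷ []) ×
             Begins (upd (mem s aOut 0) (regs s rO) x) (w ++ x ∷ [])
written-∷ʳ {w} (e , B) rewrite e = sym (length-∷ʳ w) , begins-∷ʳ w B

emitPart-run : ∀ xs {s w} → Written w s →
  (∀ {j} → j < length xs → mem s aMem (regs s rP) (j + regs s rI) ≡ nth xs j) →
  mem s aSize 0 (regs s rP) ≡ length xs + regs s rI →
  Run emitPart s (5 + length xs * 20) (Written (w ++ xs))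
emitPart-run [] {s} {w} W _ eN = stop-run eq (subst (λ v → Written v s) (sym (++-identityʳ w)) W)
  where
  eq : test s (reg rI ≺ sizeₑ) ≡ false
  eq = <ᵇ-false (≤-reflexive eN)
emitPart-run (x ∷ xs) {s} {w} W rd eN =
  loop-run {j = 15} {k = 5 + length xs * 20} eq
    (weaken (lit≤ tt) (put-then (set-then (set-run {Q = λ s′ → s′ ≡ s₁} refl))))
    λ { _ refl → conseq (λ {s′} _ → subst (λ v → Written v s′) (++-assoc w (x ∷ []) xs))
      (emitPart-run xs {s₁} {w ++ x ∷ []} W₁
        (λ {j} j< → trans (cong (mem s aMem (regs s rP)) (+-suc j (regs s rI))) (rd (s≤s j<)))
        (trans eN (sym (+-suc (length xs) (regs s rI))))) }
  where
  v = mem s aMem (regs s rP) (regs s rI)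
  s₁ = setReg rI (suc (regs s rI)) (setReg rO (suc (regs s rO)) (putMem aOut 0 (regs s rO) v s))
  eq : test s (reg rI ≺ sizeₑ) ≡ true
  eq rewrite eN = <ᵇ-true (s≤s (m≤n+m (regs s rI) (length xs)))
  W₁ : Written (w ++ x ∷ []) s₁
  W₁ = subst (λ z → suc (regs s rO) ≡ length (w ++ x ∷ []) × Begins (upd (mem s aOut 0) (regs s rO) z) (w ++ x ∷ []))
         (sym (rd {0} (s≤s z≤n))) (written-∷ʳ {w} {s} W)

module _ {n : ℕ} where

  data Rows (size : ℕ → ℕ) (M : ℕ → ℕ → ℕ) : ℕ → Listing n → Set where
    []  : ∀ {p} → Rows size M p []
    _∷_ : ∀ {p C Ls} → size p ≡ length C × Begins (M p) (map toℕ C) → Rows size M (suc p) Ls →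
          Rows size M p (C ∷ Ls)

  emitAll-run : ∀ Ls {s w} → Written w s → regs s rC ≡ length Ls + regs s rP →
    Rows (mem s aSize 0) (mem s aMem) (regs s rP) Ls →
    Run (while (reg rP ≺ reg rC) emitBody) s (3 + length (classes Ls) * 30) (Written (w ++ classes Ls))
  emitAll-run [] {s} {w} W eC _ =
    stop-run eq (subst (λ v → Written v s) (sym (++-identityʳ w)) W)
    where
    eq : test s (reg rP ≺ reg rC) ≡ false
    eq = <ᵇ-false (≤-reflexive eC)
  emitAll-run (C ∷ Ls) {s} {w} W eC ((eN , B) ∷ rows) = weaken bound
    (loop-run {j = 11 + (5 + length C * 20 + 3)}
      {Q = λ s′ → Written ((w ++ length C ∷ []) ++ map toℕ C) s′ × regs s′ rP ≡ suc (regs s rP)}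
      {k = 3 + length (classes Ls) * 30} eq
      (put-then (set-then (set-then (seq-run
        (subst (λ l → Run emitPart s₁ (5 + l * 20) (Written ((w ++ length C ∷ []) ++ map toℕ C))) (length-map toℕ C)
          (emitPart-run (map toℕ C) {s₁} {w ++ length C ∷ []} W₁
            (λ {j} j< → trans (cong (mem s aMem p) (+-identityʳ j)) (B j<))
            (trans eN (trans (sym (length-map toℕ C)) (sym (+-identityʳ _))))))
        (λ {s′} A W′ → set-run (W′ , cong suc (same-regs A rP refl)))))))
      (λ {s′} A (W′ , eP) → conseq (λ {s″} _ → subst (λ v → Written v s″)
          (trans (++-assoc (w ++ length C ∷ []) (map toℕ C) (classes Ls)) (++-assoc w (length C ∷ []) _)))
        (emitAll-run Ls {s′} {(w ++ length C ∷ []) ++ map toℕ C} W′ (eC′ A eP) (rows′ A eP))))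
    where
    p = regs s rP
    N = mem s aSize 0 p
    s₁ = setReg rI 0 (setReg rO (suc (regs s rO)) (putMem aOut 0 (regs s rO) N s))
    eC′ : ∀ {s′} → Agree emitBody s s′ → regs s′ rP ≡ suc p → regs s′ rC ≡ length Ls + regs s′ rP
    eC′ A e rewrite e | same-regs A rC refl = trans eC (sym (+-suc (length Ls) p))
    rows′ : ∀ {s′} → Agree emitBody s s′ → regs s′ rP ≡ suc p → Rows (mem s′ aSize 0) (mem s′ aMem) (regs s′ rP) Ls
    rows′ A e rewrite e | same-mem A aSize refl | same-mem A aMem refl = rows
    eq : test s (reg rP ≺ reg rC) ≡ true
    eq rewrite eC = <ᵇ-true (s≤s (m≤n+m p (length Ls)))
    W₁ : Written (w ++ length C ∷ []) s₁
    W₁ = subst (λ z → suc (regs s rO) ≡ length (w ++ length C ∷ []) ×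
                     Begins (upd (mem s aOut 0) (regs s rO) z) (w ++ length C ∷ []))
           (sym eN) (written-∷ʳ {w} {s} W)
    lc = length (classes Ls)
    bound : 3 + (11 + (5 + length C * 20 + 3) + (3 + lc * 30)) ≤ 3 + length (classes (C ∷ Ls)) * 30
    bound = +-monoʳ-≤ 3 (begin
      11 + (5 + length C * 20 + 3) + (3 + lc * 30)
        ≡⟨ solve 2 (λ a b → con 11 :+ (con 5 :+ a :* con 20 :+ con 3) :+ (con 3 :+ b :* con 30)
                      := con 22 :+ a :* con 20 :+ b :* con 30) refl (length C) lc ⟩
      22 + length C * 20 + lc * 30
        ≤⟨ +-monoˡ-≤ (lc * 30) (+-mono-≤ {22} {30} (lit≤ tt) (*-monoʳ-≤ (length C) {20} {30} (lit≤ tt))) ⟩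
      30 + length C * 30 + lc * 30
        ≡⟨ solve 2 (λ a b → con 30 :+ a :* con 30 :+ b :* con 30 := (con 1 :+ (a :+ b)) :* con 30) refl (length C) lc ⟩
      suc (length C + lc) * 30               ≡⟨ cong (λ l → suc l * 30) (sym lengths) ⟩
      length (classes (C ∷ Ls)) * 30         ∎)
      where
      open ≤-Reasoning
      open +-*-Solver
      lengths : length (map toℕ C ++ classes Ls) ≡ length C + lc
      lengths = trans (length-++ (map toℕ C)) (cong (_+ lc) (length-map toℕ C))

  emit-run : ∀ Ls {s} → regs s rC ≡ length Ls → Rows (mem s aSize 0) (mem s aMem) 0 Ls →
    Run emit s (11 + length (classes Ls) * 30) (λ s′ → Outputs s′ Ls)
  emit-run Ls {s} eC rows = put-then (set-then (set-then
    (conseq (λ {s′} _ (_ , B) j → trans (B (toℕ<n j)) (sym (lookup-nth (encode Ls) j)))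
      (emitAll-run Ls {s₁} {length Ls ∷ []}
        (refl , λ { {zero} _ → eC ; {suc j} (s≤s ()) })
        (trans eC (sym (+-identityʳ _))) rows))))
    where
    s₁ = setReg rP 0 (setReg rO 1 (putMem aOut 0 0 (regs s rC) s))

-- Listings, partitions and keys.

open Equivalence using (to; from)

unique-lookup : ∀ {A : Set} {xs : List A} → Unique xs → ∀ {i j} → lookup xs i ≡ lookup xs j → i ≡ j
unique-lookup (_ ∷ _)  {fzero}  {fzero}  _  = refl
unique-lookup (x∉ ∷ _) {fzero}  {fsuc j} eq = contradiction eq (All.lookup x∉ (∈-lookup j))
unique-lookup (x∉ ∷ _) {fsuc i} {fzero}  eq = contradiction (sym eq) (All.lookup x∉ (∈-lookup i))
unique-lookup (_ ∷ u)  {fsuc i} {fsuc j} eq = cong fsuc (unique-lookup u eq)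

module _ where

  private variable
    n : ℕ
    Ls : Listing n
    P : List (Subset n)
    x y z : Fin n

  unique-length : {xs : List (Fin n)} → Unique xs → length xs ≤ n
  unique-length u = injective⇒≤ (unique-lookup u)

  ∈⋃⁻ : ∀ P → x ∈ₛ ⋃ P → Any (x ∈ₛ_) P
  ∈⋃⁻ []      x∈ = contradiction x∈ ∉⊥
  ∈⋃⁻ (U ∷ P) x∈ with x∈p∪q⁻ U (⋃ P) x∈
  ... | inj₁ x∈U = here x∈U
  ... | inj₂ x∈P = there (∈⋃⁻ P x∈P)

  ∈⋃⁺ : Any (x ∈ₛ_) P → x ∈ₛ ⋃ P
  ∈⋃⁺ (here x∈U)  = x∈p∪q⁺ (inj₁ x∈U)
  ∈⋃⁺ (there x∈P) = x∈p∪q⁺ (inj₂ (∈⋃⁺ x∈P))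

  lists-unique : ListsPartition Ls P → All Unique Ls
  lists-unique []            = []
  lists-unique ((u , _) ∷ r) = u ∷ lists-unique r

  lists-disjoint : ListsPartition Ls P → AllPairs (λ U V → Empty (U ∩ V)) P → AllPairs Disjoint Ls
  lists-disjoint [] [] = []
  lists-disjoint (l ∷ r) (d ∷ ds) = go l r d ∷ lists-disjoint r ds
    where
    go : ∀ {n} {C : List (Fin n)} {U Ls P} → Lists C U → ListsPartition Ls P →
         All (λ V → Empty (U ∩ V)) P → All (Disjoint C) Ls
    go l [] [] = []
    go l@(_ , e) ((_ , e′) ∷ r) (d ∷ ds) =
      (λ (y∈C , y∈D) → d (_ , x∈p∩q⁺ (to (e _) y∈C , to (e′ _) y∈D))) ∷ go l r ds

  lists-nonempty : ListsPartition Ls P → All Nonempty P → All (λ C → 1 ≤ length C) Ls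
  lists-nonempty [] [] = []
  lists-nonempty ((_ , e) ∷ r) ((x , x∈) ∷ ne) with from (e x) x∈
  ... | here _  = s≤s z≤n ∷ lists-nonempty r ne
  ... | there _ = s≤s z≤n ∷ lists-nonempty r ne

  -- No class is empty, so there are at most as many length entries as elements.
  classes-length : {Ls : Listing n} → All (λ C → 1 ≤ length C) Ls →
                   length (classes Ls) ≤ length (concat Ls) + length (concat Ls)
  classes-length [] = z≤n
  classes-length {Ls = C ∷ Ls} (p ∷ ps) = begin
    suc (length (map toℕ C ++ classes Ls))
    ≡⟨ cong suc (trans (length-++ (map toℕ C)) (cong (_+ length (classes Ls)) (length-map toℕ C))) ⟩
    1 + (c + length (classes Ls))           ≤⟨ +-mono-≤ p (+-monoʳ-≤ c (classes-length ps)) ⟩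
    c + (c + (r + r))                       ≡⟨ solve 2 (λ c r → c :+ (c :+ (r :+ r)) := (c :+ r) :+ (c :+ r)) refl c r ⟩
    (c + r) + (c + r)                       ≡⟨ cong₂ _+_ (sym (length-++ C)) (sym (length-++ C)) ⟩
    length (C ++ concat Ls) + length (C ++ concat Ls) ∎
    where
    open ≤-Reasoning
    open +-*-Solver
    c = length C
    r = length (concat Ls)

  classes-≤ : ∀ {A} {Ls : Listing n} → ListsPartition Ls P → IsPartition A P → length (classes Ls) ≤ n + n
  classes-≤ {Ls = Ls} r p = ≤-trans (classes-length (lists-nonempty r nonempty)) (+-mono-≤ le le)
    where
    open IsPartition p
    le : length (concat Ls) ≤ _
    le = unique-length (Unique.concat⁺ (lists-unique r) (lists-disjoint r disjoint))

  shared⁺ : ListsPartition Ls P → Any (λ C → y ∈ₛ C × z ∈ₛ C) P →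
            ∃[ i ] (y ∈ lookup Ls i × z ∈ lookup Ls i)
  shared⁺ ((_ , e) ∷ _) (here (y∈ , z∈)) = fzero , from (e _) y∈ , from (e _) z∈
  shared⁺ (_ ∷ r)       (there a) with shared⁺ r a
  ... | i , h = fsuc i , h

  shared⁻ : ListsPartition Ls P → ∀ i → y ∈ lookup Ls i → z ∈ lookup Ls i → Any (λ C → y ∈ₛ C × z ∈ₛ C) P
  shared⁻ ((_ , e) ∷ _) fzero    y∈ z∈ = here (to (e _) y∈ , to (e _) z∈)
  shared⁻ (_ ∷ r)       (fsuc i) y∈ z∈ = there (shared⁻ r i y∈ z∈)

  module _ {L : Fin n → Listing n} (H : HomogeneousRelation n) (pres : Presents L H) where

    presents-disjoint : ∀ x → AllPairs Disjoint (L x)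
    presents-disjoint x = let P , (part , _) , r = pres x in lists-disjoint r (IsPartition.disjoint part)

    presents-≤ : ∀ x → length (classes (L x)) ≤ n + n
    presents-≤ x = let P , (part , _) , r = pres x in classes-≤ r part

    presents-covers : ∀ {x y} → y ≢ x → ∃[ i ] (y ∈ lookup (L x) i)
    presents-covers {x} {y} y≢x with pres x
    ... | P , (part , _) , r with shared⁺ {y = y} {z = y} r (Any.map (λ h → h , h)
            (∈⋃⁻ P (subst (y ∈ₛ_) (sym (IsPartition.covers part)) (x∉p⇒x∈∁p (y≢x ∘ x∈⁅y⁆⇒x≡y x)))))
    ...   | i , y∈ , _ = i , y∈

    module _ (κ : ℕ → ℕ → ℕ)
             (keys : ∀ x i {y} → y ∈ lookup (L x) i → κ (toℕ x) (toℕ y) ≡ suc (toℕ i + 0)) where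

      key-suc : ∀ {x y} → y ≢ x → κ (toℕ x) (toℕ y) ≢ 0
      key-suc {x} y≢x eq with presents-covers {x} y≢x
      ... | i , y∈ with trans (sym (keys x i y∈)) eq
      ...   | ()

      -- Keys name the position of a class in the listing, and `presents-covers` gives every other
      -- element such a position. The proof inside `Other` is irrelevant, so the inequalities come
      -- as separate arguments.
      holds⇔key : ∀ {x} (y z : Other x) → value y ≢ x → value z ≢ x →
                  T (holds H x y z) ⇔ (κ (toℕ x) (toℕ (value y)) ≡ κ (toℕ x) (toℕ (value z)))
      holds⇔key {x} y z y≢x z≢x with pres x
      ... | P , (part , classOf) , r = mk⇔ ⇒ ⇐
        where
        ⇒ : T (holds H x y z) → κ (toℕ x) (toℕ (value y)) ≡ κ (toℕ x) (toℕ (value z))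
        ⇒ h with shared⁺ r (to (classOf y z) h)
        ... | i , y∈ , z∈ = trans (keys x i y∈) (sym (keys x i z∈))
        ⇐ : κ (toℕ x) (toℕ (value y)) ≡ κ (toℕ x) (toℕ (value z)) → T (holds H x y z)
        ⇐ eq with presents-covers y≢x | presents-covers z≢x
        ... | i , y∈ | j , z∈ with toℕ-injective (+-cancelʳ-≡ 0 _ _ (suc-injective
                  (trans (sym (keys x i y∈)) (trans eq (keys x j z∈)))))
        ...   | refl = from (classOf y z) (shared⁻ r i y∈ z∈)

-- Subsets and colours as functions on numbers.

-- False from `n` on, which puts the virtual element outside every subset.
inSet : ∀ {n} → Subset n → ℕ → Bool
inSet []      _       = false
inSet (b ∷ U) zero    = b
inSet (b ∷ U) (suc k) = inSet U k

inSet-lookup : ∀ {n} (U : Subset n) x → inSet U (toℕ x) ≡ Vec.lookup U x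
inSet-lookup (b ∷ U) fzero    = refl
inSet-lookup (b ∷ U) (fsuc x) = inSet-lookup U x

inSet-< : ∀ {n} (U : Subset n) {k} → inSet U k ≡ true → k < n
inSet-< (b ∷ U) {zero}  _  = s≤s z≤n
inSet-< (b ∷ U) {suc k} eq = s≤s (inSet-< U eq)

inSet⁺ : ∀ {n} {U : Subset n} {x} → x ∈ₛ U → inSet U (toℕ x) ≡ true
inSet⁺ {U = U} {x} x∈U = trans (inSet-lookup U x) ([]=⇒lookup x∈U)

inSet⁻ : ∀ {n} {U : Subset n} {x} → inSet U (toℕ x) ≡ true → x ∈ₛ U
inSet⁻ {U = U} {x} eq = lookup⇒[]= x U (trans (sym (inSet-lookup U x)) eq)

inSet-∉ : ∀ {n} {U : Subset n} {x} → inSet U (toℕ x) ≡ false → x ∉ₛ U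
inSet-∉ eq x∈U with trans (sym (inSet⁺ x∈U)) eq
... | ()

colourOf : ∀ {n} → Subset n → ℕ → ℕ
colourOf S = nth (map bit (toList S))

colour-lookup : ∀ {n} (S : Subset n) x → colourOf S (toℕ x) ≡ bit (Vec.lookup S x)
colour-lookup (b ∷ S) fzero    = refl
colour-lookup (b ∷ S) (fsuc x) = colour-lookup S x

Within : ∀ {n} → Subset n → Subset n → Set
Within S U = U ⊆ₛ S ⊎ U ⊆ₛ ∁ S

colour-∈ : ∀ {n} {S : Subset n} {x} → x ∈ₛ S → colourOf S (toℕ x) ≡ 1
colour-∈ {S = S} {x} x∈S = trans (colour-lookup S x) (cong bit ([]=⇒lookup x∈S))

colour-∉ : ∀ {n} {S : Subset n} {x} → x ∉ₛ S → colourOf S (toℕ x) ≡ 0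
colour-∉ {S = S} {x} x∉S = trans (colour-lookup S x) (go (Vec.lookup S x) refl)
  where
  go : ∀ b → Vec.lookup S x ≡ b → bit b ≡ 0
  go true  eq = contradiction (lookup⇒[]= x S eq) x∉S
  go false _  = refl

colour-within : ∀ {n} {S U : Subset n} → Within S U → ∀ {x y} → x ∈ₛ U → y ∈ₛ U →
                colourOf S (toℕ x) ≡ colourOf S (toℕ y)
colour-within (inj₁ U⊆) x∈ y∈ = trans (colour-∈ (U⊆ x∈)) (sym (colour-∈ (U⊆ y∈)))
colour-within (inj₂ U⊆) x∈ y∈ = trans (colour-∉ (x∈∁p⇒x∉p (U⊆ x∈))) (sym (colour-∉ (x∈∁p⇒x∉p (U⊆ y∈))))

within-colour : ∀ {n} {S U : Subset n} → Nonempty U →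
                (∀ {x y} → x ∈ₛ U → y ∈ₛ U → colourOf S (toℕ x) ≡ colourOf S (toℕ y)) → Within S U
within-colour {S = S} {U} (x , x∈U) same with x ∈? S
... | no x∉S = inj₂ λ y∈U → x∉p⇒x∈∁p λ y∈S →
      contradiction (trans (sym (colour-∉ x∉S)) (trans (same x∈U y∈U) (colour-∈ y∈S))) λ ()
... | yes x∈S = inj₁ λ {y} y∈U → inside y∈U
  where
  inside : ∀ {y} → y ∈ₛ U → y ∈ₛ S
  inside {y} y∈U with y ∈? S
  ... | yes y∈S = y∈S
  ... | no y∉S = contradiction (trans (sym (colour-∈ x∈S)) (trans (same x∈U y∈U) (colour-∉ y∉S))) λ ()

as-fin : ∀ {n} (P : ℕ → Set) → (∀ (x : Fin n) → P (toℕ x)) → ∀ {u} → u < n → P u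
as-fin P f u<n = subst P (toℕ-fromℕ< u<n) (f (fromℕ< u<n))

begins-tabulate : ∀ {m f} (g : Fin m → ℕ) → (∀ i → f (toℕ i) ≡ g i) → Begins f (tabulate g)
begins-tabulate {suc m} g h {zero}  _         = h fzero
begins-tabulate {suc m} {f} g h {suc j} (s≤s j<) = begins-tabulate {m} {f ∘ suc} (g ∘ fsuc) (h ∘ fsuc) j<

rows-tabulate : ∀ {n m size M p} (g : Fin m → List (Fin n)) →
  (∀ q → size (toℕ q + p) ≡ length (g q) × Begins (M (toℕ q + p)) (map toℕ (g q))) →
  Rows size M p (tabulate g)
rows-tabulate {m = zero}  g h = []
rows-tabulate {m = suc m} {size} {M} {p} g h = h fzero ∷
  rows-tabulate (g ∘ fsuc) λ q →
    subst (λ k → size k ≡ length (g (fsuc q)) × Begins (M k) (map toℕ (g (fsuc q)))) (sym (+-suc (toℕ q) p)) (h (fsuc q))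

-- From the loaded state to MU(S): initial invariant and correctness of the final parts.

module _ {n : ℕ} {L : Fin n → Listing n} (H : HomogeneousRelation n) (pres : Presents L H) (S : Subset n)
         {κ : ℕ → ℕ → ℕ}
         (keys : ∀ x i {y} → y ∈ lookup (L x) i → κ (toℕ x) (toℕ y) ≡ suc (toℕ i + 0))
         (key-n : ∀ (x : Fin n) → κ (toℕ x) n ≡ 0) where

  private
    σ : ℕ → ℕ
    σ = colourOf S

  -- Every element other than `x` lies in a listed class and so has a positive key.
  key-0 : ∀ {x : Fin n} {b} → b ≤ n → b ≢ toℕ x → κ (toℕ x) b ≡ 0 → b ≡ n
  key-0 {x} b≤n b≢x z with m≤n⇒m<n∨m≡n b≤n
  ... | inj₂ b≡n = b≡n
  ... | inj₁ b<n = contradiction z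
    (as-fin (λ b → b ≢ toℕ x → κ (toℕ x) b ≢ 0) (λ y y≢x → key-suc H pres κ keys (y≢x ∘ cong toℕ)) b<n b≢x)

  -- The virtual column does no harm to uniformity: if one of the two columns is `n`, their common
  -- key is 0, and by `key-0` the other column is `n` as well.
  umodular : ∀ {U} → IsUmodule H U → Within S U → Umodular n κ σ (inSet U)
  umodular {U} mod win = record
    { bounded = inSet-< U
    ; uniform = λ {u} {u′} {b} {b′} Uu Uu′ b≤n b′≤n b∉ b′∉ →
        as-fin (λ u → inSet U u ≡ true → κ u b ≡ κ u b′ → κ u′ b ≡ κ u′ b′)
          (λ x Ux → as-fin (λ u′ → inSet U u′ ≡ true → κ (toℕ x) b ≡ κ (toℕ x) b′ → κ u′ b ≡ κ u′ b′)
            (λ x′ Ux′ → uniform′ (inSet⁻ Ux) (inSet⁻ Ux′) b≤n b′≤n b∉ b′∉)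
            (inSet-< U Uu′) Uu′)
          (inSet-< U Uu) Uu
    ; colour = λ {u} {u′} Uu Uu′ →
        as-fin (λ u → inSet U u ≡ true → σ u ≡ σ u′)
          (λ x Ux → as-fin (λ u′ → inSet U u′ ≡ true → σ (toℕ x) ≡ σ u′)
            (λ x′ Ux′ → colour-within win (inSet⁻ Ux) (inSet⁻ Ux′)) (inSet-< U Uu′) Uu′)
          (inSet-< U Uu) Uu }
    where
    ∉⇒≢ : ∀ {x b} → x ∈ₛ U → inSet U b ≡ false → b ≢ toℕ x
    ∉⇒≢ x∈U b∉ refl = inSet-∉ b∉ x∈U
    uniform′ : ∀ {x x′ b b′} → x ∈ₛ U → x′ ∈ₛ U → b ≤ n → b′ ≤ n → inSet U b ≡ false → inSet U b′ ≡ false →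
               κ (toℕ x) b ≡ κ (toℕ x) b′ → κ (toℕ x′) b ≡ κ (toℕ x′) b′
    uniform′ {x} {x′} {b} {b′} x∈ x′∈ b≤n b′≤n b∉ b′∉ eq with m≤n⇒m<n∨m≡n b≤n | m≤n⇒m<n∨m≡n b′≤n
    ... | inj₂ refl | _ = cong (κ (toℕ x′)) (sym (key-0 b′≤n (∉⇒≢ x∈ b′∉) (trans (sym eq) (key-n x))))
    ... | _ | inj₂ refl = cong (κ (toℕ x′)) (key-0 b≤n (∉⇒≢ x∈ b∉) (trans eq (key-n x)))
    ... | inj₁ b<n | inj₁ b′<n =
      as-fin (λ b → inSet U b ≡ false → κ (toℕ x) b ≡ κ (toℕ x) b′ → κ (toℕ x′) b ≡ κ (toℕ x′) b′)
        (λ y y∉ → as-fin (λ b′ → inSet U b′ ≡ false → κ (toℕ x) (toℕ y) ≡ κ (toℕ x) b′ → κ (toℕ x′) (toℕ y) ≡ κ (toℕ x′) b′)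
          (λ y′ y′∉ → transfer (inSet-∉ y∉) (inSet-∉ y′∉)) b′<n b′∉)
        b<n b∉ eq
      where
      transfer : ∀ {y y′} → y ∉ₛ U → y′ ∉ₛ U → κ (toℕ x) (toℕ y) ≡ κ (toℕ x) (toℕ y′) →
                 κ (toℕ x′) (toℕ y) ≡ κ (toℕ x′) (toℕ y′)
      transfer {y} {y′} y∉ y′∉ =
        to (holds⇔key H pres κ keys _ _ (ne x′∈ y∉) (ne x′∈ y′∉)) ∘
        to (mod x∈ x′∈ y∉ y′∉) ∘
        from (holds⇔key H pres κ keys _ _ (ne x∈ y∉) (ne x∈ y′∉))
        where
        ne : ∀ {x y} → x ∈ₛ U → y ∉ₛ U → y ≢ x
        ne x∈ y∉ refl = y∉ x∈

  -- Representatives exist only at key 0. A column outside `U` reaches that key only if it is `n`,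
  -- and there the symbol is the colour, which is constant on `U`; all other symbols are 0.
  start-core : ∀ {cnt size M rep done part pos} →
    Loading L σ n κ rep M part pos → (∀ u b → done u b ≡ 0) →
    (0 < n → cnt ≡ 1 × size 0 ≡ n) → (n ≡ 0 → cnt ≡ 0) →
    Core n κ σ cnt size M rep done part pos
  start-core {cnt} {size} {M} {rep} {done} {part} {pos} ld undone₀ one none = record
    { locates = record
        { member  = λ c → subst (_< n) (sym (member′ c)) (proj₂ (only c))
        ; in-part = λ c → trans (cong part (member′ c)) (trans (partOf (proj₂ (only c))) (cong suc (sym (proj₁ (only c)))))
        ; at-pos  = λ c → trans (cong pos (member′ c)) (posOf (proj₂ (only c)))
        ; located = λ u<n → 0 , partOf u<n ,
            (subst (0 <_) (sym (proj₁ (one (pos< u<n)))) (s≤s z≤n) ,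
             subst₂′ (sym (posOf u<n)) (sym (proj₂ (one (pos< u<n)))) u<n) ,
            trans (cong (M 0) (posOf u<n)) (memberOf u<n) }
    ; inhabited = λ {q} q<c → let 0<n = nonempty q<c ; c≡1 , s≡n = one 0<n in
        subst (λ q → 0 < size q) (sym (n<1⇒n≡0 (subst (q <_) c≡1 q<c))) (subst (0 <_) (sym s≡n) 0<n)
    ; part-n = no-part ≤-refl
    ; closed = λ mod Uu Uu′ → let open Umodular mod in trans (partOf (bounded Uu)) (sym (partOf (bounded Uu′)))
    ; symbol = symbol′
    ; rep-key = λ {u} {k} u<n eq → contradiction (trans (sym eq) (no-rep u k)) λ ()
    ; rep-0 = rep-0′
    ; done-cong = λ {u} {u′} _ _ _ b → trans (undone₀ u b) (sym (undone₀ u′ b))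
    ; done-rep = λ {u} {b} _ d → contradiction (undone₀ u b) d
    ; done-sym = λ {u} {u′} {b} _ _ _ d → contradiction (undone₀ u b) d }
    where
    open Loading ld
    loadedRow : ∀ x → Loaded L σ κ rep M part pos x
    loadedRow x = loaded x (toℕ<n x)
    pos< : ∀ {u} → u < n → 0 < n
    pos< u<n = ≤-<-trans z≤n u<n
    nonempty : ∀ {q} → q < cnt → 0 < n
    nonempty {q} q<c with n ≟ 0
    ... | no n≢0 = n≢0⇒n>0 n≢0
    ... | yes n≡0 = contradiction (subst (q <_) (none n≡0) q<c) λ ()
    subst₂′ : ∀ {a b c d} → a ≡ b → c ≡ d → a < c → b < d
    subst₂′ refl refl h = h
    only : ∀ {q x} → Cell n cnt size q x → q ≡ 0 × x < n
    only {q} {x} (q<c , x<) with one (nonempty q<c)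
    ... | c≡1 , s≡n with n<1⇒n≡0 (subst (q <_) c≡1 q<c)
    ...   | refl = refl , subst (x <_) s≡n x<
    partOf : ∀ {u} → u < n → part u ≡ 1
    partOf = as-fin (λ u → part u ≡ 1) (λ x → Loaded.in-part (loadedRow x))
    posOf : ∀ {u} → u < n → pos u ≡ u
    posOf = as-fin (λ u → pos u ≡ u) (λ x → Loaded.at-pos (loadedRow x))
    memberOf : ∀ {u} → u < n → M 0 u ≡ u
    memberOf = as-fin (λ u → M 0 u ≡ u) (λ x → Loaded.member (loadedRow x))
    rep-0′ : ∀ {u} → u < n → rep u 0 ≡ suc (σ u)
    rep-0′ = as-fin (λ u → rep u 0 ≡ suc (σ u)) (λ x → Loaded.rep-0 (loadedRow x))
    member′ : ∀ {q x} → Cell n cnt size q x → M q x ≡ x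
    member′ c with only c
    ... | refl , x<n = memberOf x<n
    symbol′ : ∀ {U u u′ b} → Umodular n κ σ U → U u ≡ true → U u′ ≡ true → b ≤ n → U b ≡ false →
              rep u (κ u b) ≡ rep u′ (κ u′ b)
    symbol′ {U} {u} {u′} {b} mod Uu Uu′ b≤n b∉ with m≤n⇒m<n∨m≡n b≤n
    ... | inj₂ refl = trans (cong (rep u) (key-n′ (bounded Uu))) (trans (rep-0′ (bounded Uu))
           (trans (cong suc (colour Uu Uu′)) (sym (trans (cong (rep u′) (key-n′ (bounded Uu′))) (rep-0′ (bounded Uu′))))))
      where
      open Umodular mod
      key-n′ : ∀ {u} → u < n → κ u n ≡ 0
      key-n′ = as-fin (λ u → κ u n ≡ 0) key-n
    ... | inj₁ b<n = trans (zero-rep Uu) (sym (zero-rep Uu′))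
      where
      open Umodular mod
      zero-rep : ∀ {u} → U u ≡ true → rep u (κ u b) ≡ 0
      zero-rep {u} Uu with κ u b in eq
      ... | suc k = no-rep u k
      -- The column of `u` itself also has key 0 in row `u`, but it lies inside `U` while `b` does
      -- not.
      ... | zero  = contradiction
        (as-fin (λ u → U u ≡ true → κ u b ≡ 0 → b ≡ n)
          (λ x Ux → key-0 b≤n λ { refl → contradiction (trans (sym Ux) b∉) λ () }) (bounded Uu) Uu eq)
        (<⇒≢ b<n)

  module _ {cnt size M rep done part pos} (C : Core n κ σ cnt size M rep done part pos)
           (finished : ∀ {q} → q < cnt → Finished n κ σ part done q (suc n)) where
    open Core C

    partSet : ℕ → Subset n
    partSet q = Vec.tabulate λ x → part (toℕ x) ≡ᵇ suc q

    ∈partSet⁺ : ∀ {q x} → part (toℕ x) ≡ suc q → x ∈ₛ partSet q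
    ∈partSet⁺ {q} {x} eq = lookup⇒[]= x (partSet q) (trans (lookup∘tabulate _ x) (trans (cong (_≡ᵇ suc q) eq) (≡ᵇ-refl q)))

    ∈partSet⁻ : ∀ {q x} → x ∈ₛ partSet q → part (toℕ x) ≡ suc q
    ∈partSet⁻ {q} {x} x∈ = ≡ᵇ-true⁻ (trans (sym (lookup∘tabulate (λ x → part (toℕ x) ≡ᵇ suc q) x)) ([]=⇒lookup x∈))

    partSet-nonempty : ∀ {q} → q < cnt → Nonempty (partSet q)
    partSet-nonempty {q} q<c = fromℕ< (member cell) , ∈partSet⁺ (trans (cong part (toℕ-fromℕ< (member cell))) (in-part cell))
      where
      cell : Cell n cnt size q 0
      cell = q<c , inhabited q<c

    -- Both columns are done, so their representatives agree between the rows `u` and `u′`; equal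
    -- keys in row `u` thus give equal representatives in row `u′`. By `rep-key` a representative
    -- knows its own class, so the keys in row `u′` are equal too.
    transfer : ∀ {q} → q < cnt → ∀ {u u′ x x′ : Fin n} → u ∈ₛ partSet q → u′ ∈ₛ partSet q → x ∉ₛ partSet q → x′ ∉ₛ partSet q →
               κ (toℕ u) (toℕ x) ≡ κ (toℕ u) (toℕ x′) → κ (toℕ u′) (toℕ x) ≡ κ (toℕ u′) (toℕ x′)
    transfer q<c {u} {u′} {x} {x′} u∈ u′∈ x∉ x′∉ eq = same-key key≢ key′≢ (done-rep (toℕ<n u′) (done-at u′∈ x∉))
      (trans (sym (sym′ x∉)) (trans (cong (rep (toℕ u)) eq) (sym′ x′∉)))
      where
      done-at : ∀ {u x} → u ∈ₛ partSet _ → x ∉ₛ partSet _ → done (toℕ u) (toℕ x) ≢ 0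
      done-at {u} {x} u∈ x∉ = finished q<c (toℕ<n u) (∈partSet⁻ u∈) (m<n⇒m<1+n (toℕ<n x)) (<⇒≤ (toℕ<n x)) (x∉ ∘ ∈partSet⁺)
      sym′ : ∀ {x} → x ∉ₛ partSet _ → rep (toℕ u) (κ (toℕ u) (toℕ x)) ≡ rep (toℕ u′) (κ (toℕ u′) (toℕ x))
      sym′ x∉ = done-sym (toℕ<n u) (toℕ<n u′) (trans (∈partSet⁻ u∈) (sym (∈partSet⁻ u′∈))) (done-at u∈ x∉)
      key≢ : κ (toℕ u′) (toℕ x) ≢ 0
      key≢ = key-suc H pres κ keys λ { refl → x∉ u′∈ }
      key′≢ : κ (toℕ u′) (toℕ x′) ≢ 0
      key′≢ = key-suc H pres κ keys λ { refl → x′∉ u′∈ }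
      same-key : ∀ {k k′} → k ≢ 0 → k′ ≢ 0 → rep (toℕ u′) k ≢ 0 → rep (toℕ u′) k ≡ rep (toℕ u′) k′ → k ≡ k′
      same-key {zero} k≢0 _ _ _ = contradiction refl k≢0
      same-key {_} {zero} _ k′≢0 _ _ = contradiction refl k′≢0
      same-key {suc k} {suc k′} _ _ r≢0 e with rep (toℕ u′) (suc k) in r
      ... | zero  = contradiction refl r≢0
      ... | suc v = trans (sym (rep-key (toℕ<n u′) r)) (rep-key (toℕ<n u′) (sym e))

    partSet-umodule : ∀ {q} → q < cnt → IsUmodule H (partSet q)
    partSet-umodule {q} q<c u∈ u′∈ x∉ x′∉ = mk⇔ (move′ u∈ u′∈ x∉ x′∉) (move′ u′∈ u∈ x∉ x′∉)
      where
      ne : ∀ {x y} → x ∈ₛ partSet q → y ∉ₛ partSet q → y ≢ x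
      ne x∈ y∉ refl = y∉ x∈
      move′ : ∀ {u u′ x x′} (u∈ : u ∈ₛ partSet q) (u′∈ : u′ ∈ₛ partSet q) (x∉ : x ∉ₛ partSet q) (x′∉ : x′ ∉ₛ partSet q) →
        T (holds H u (outsider u∈ x∉) (outsider u∈ x′∉)) → T (holds H u′ (outsider u′∈ x∉) (outsider u′∈ x′∉))
      move′ u∈ u′∈ x∉ x′∉ = from (holds⇔key H pres κ keys _ _ (ne u′∈ x∉) (ne u′∈ x′∉)) ∘
        transfer q<c u∈ u′∈ x∉ x′∉ ∘
        to (holds⇔key H pres κ keys _ _ (ne u∈ x∉) (ne u∈ x′∉))

    -- Column `n` lies outside every part, hence is done for this one, and its symbol is the colour.
    partSet-within : ∀ {q} → q < cnt → Within S (partSet q)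
    partSet-within {q} q<c = within-colour (partSet-nonempty q<c) λ {x} {y} x∈ y∈ →
      suc-injective (trans (sym (col x)) (trans
        (done-sym (toℕ<n x) (toℕ<n y) (trans (∈partSet⁻ x∈) (sym (∈partSet⁻ y∈)))
          (finished q<c (toℕ<n x) (∈partSet⁻ x∈) ≤-refl ≤-refl λ eq → contradiction (trans (sym part-n) eq) λ ()))
        (col y)))
      where
      col : ∀ x → rep (toℕ x) (κ (toℕ x) n) ≡ suc (σ (toℕ x))
      col x = trans (cong (rep (toℕ x)) (key-n x)) (rep-0 (toℕ<n x))

    -- This is `closed` for actual umodules; both maximality of the parts and coarseness of the
    -- partition are drawn from it.
    contained : ∀ {U x q} → IsUmodule H U → Within S U → x ∈ₛ U → part (toℕ x) ≡ suc q → U ⊆ₛ partSet q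
    contained mod win x∈U eq y∈U = ∈partSet⁺ (trans (closed (umodular mod win) (inSet⁺ y∈U) (inSet⁺ x∈U)) eq)

    parts : List (Subset n)
    parts = tabulate {n = cnt} (partSet ∘ toℕ)

    parts-any : ∀ {Q : Subset n → Set} {q} → q < cnt → Q (partSet q) → Any Q parts
    parts-any {Q} q<c h = Any.tabulate⁺ (fromℕ< q<c) (subst (Q ∘ partSet) (sym (toℕ-fromℕ< q<c)) h)

    parts-partition : IsPartition ⊤ parts
    parts-partition = record
      { nonempty = All.tabulate⁺ (λ q → partSet-nonempty (toℕ<n q))
      ; disjoint = AllPairs.tabulate⁺ λ {i} {j} i≢j (x , x∈) →
          let x∈i , x∈j = x∈p∩q⁻ (partSet (toℕ i)) (partSet (toℕ j)) x∈ in
          i≢j (toℕ-injective (suc-injective (trans (sym (∈partSet⁻ x∈i)) (∈partSet⁻ x∈j))))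
      ; covers = ⊆-antisym (λ _ → ∈⊤) λ {x} _ →
          let q , eq , (q<c , _) , _ = located (toℕ<n x) in ∈⋃⁺ {P = parts} (parts-any q<c (∈partSet⁺ eq)) }

    parts-MU : IsMU H S parts
    parts-MU = record
      { maximal = λ U → mk⇔ (maximal⁺ U) (maximal⁻ U)
      ; within = record
          { partition = parts-partition
          ; umodules = All.tabulate⁺ (λ q → partSet-umodule (toℕ<n q))
          ; thinner = All.tabulate⁺ (λ q → thin (partSet-within (toℕ<n q))) }
      ; coarsest = λ Q W → coarse W }
      where
      thin : ∀ {U} → Within S U → Any (U ⊆ₛ_) (S ∷ ∁ S ∷ [])
      thin (inj₁ h) = here h
      thin (inj₂ h) = there (here h)
      thin⁻ : ∀ {U} → Any (U ⊆ₛ_) (S ∷ ∁ S ∷ []) → Within S U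
      thin⁻ (here h)         = inj₁ h
      thin⁻ (there (here h)) = inj₂ h
      maximal⁺ : ∀ U → U ∈ parts → MaximalUmoduleWithin H S U
      maximal⁺ U U∈ with ∈-tabulate⁻ U∈
      ... | q , refl = (partSet-nonempty q<c , partSet-umodule q<c , partSet-within q<c) ,
          λ V (_ , mod , win) U⊆V → let x , x∈ = partSet-nonempty q<c in
            contained mod win (U⊆V x∈) (∈partSet⁻ x∈)
        where q<c = toℕ<n q
      maximal⁻ : ∀ U → MaximalUmoduleWithin H S U → U ∈ parts
      maximal⁻ U (((x , x∈) , mod , win) , max) with located (toℕ<n x)
      ... | q , eq , (q<c , _) , _ = parts-any {Q = U ≡_} q<c (⊆-antisym U⊆
              (max (partSet q) (partSet-nonempty q<c , partSet-umodule q<c , partSet-within q<c) U⊆))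
        where
        U⊆ : U ⊆ₛ partSet q
        U⊆ = contained mod win x∈ eq
      coarse : ∀ {Q} → IsUmodulePartitionWithin H S Q → Thinner Q parts
      coarse {Q} W = All.tabulate λ {U} U∈ →
        let x , x∈ = All.lookup (IsPartition.nonempty partition) U∈
            q , eq , (q<c , _) , _ = located (toℕ<n x) in
        parts-any q<c (contained (All.lookup umodules U∈) (thin⁻ (All.lookup thinner U∈)) x∈ eq)
        where open IsUmodulePartitionWithin W

    memberAt : ∀ (q : Fin cnt) → Fin (size (toℕ q)) → Fin n
    memberAt q i = fromℕ< (member (toℕ<n q , toℕ<n i))

    toℕ-memberAt : ∀ q i → toℕ (memberAt q i) ≡ M (toℕ q) (toℕ i)
    toℕ-memberAt q i = toℕ-fromℕ< (member (toℕ<n q , toℕ<n i))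

    partListing : Listing n
    partListing = tabulate λ q → tabulate (memberAt q)

    lists-parts : ListsPartition partListing parts
    lists-parts = Pointwise.tabulate⁺ λ q →
      Unique.tabulate⁺ (λ {i} {j} eq → toℕ-injective (trans (sym (at-pos (toℕ<n q , toℕ<n i)))
        (trans (cong pos (trans (sym (toℕ-memberAt q i)) (trans (cong toℕ eq) (toℕ-memberAt q j))))
               (at-pos (toℕ<n q , toℕ<n j))))) ,
      λ y → mk⇔ (⇒ q) (⇐ q)
      where
      ⇒ : ∀ q {y} → y ∈ tabulate (memberAt q) → y ∈ₛ partSet (toℕ q)
      ⇒ q y∈ with ∈-tabulate⁻ y∈
      ... | i , refl = ∈partSet⁺ (trans (cong part (toℕ-memberAt q i)) (in-part (toℕ<n q , toℕ<n i)))
      ⇐ : ∀ q {y} → y ∈ₛ partSet (toℕ q) → y ∈ tabulate (memberAt q)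
      ⇐ q {y} y∈ with located-in (toℕ<n y) (∈partSet⁻ y∈)
      ... | (_ , lt) , eq = subst (_∈ tabulate (memberAt q))
        (toℕ-injective (trans (toℕ-memberAt q (fromℕ< lt)) (trans (cong (M (toℕ q)) (toℕ-fromℕ< lt)) eq)))
        (∈-tabulate⁺ (fromℕ< lt))

    rows : Rows size M 0 partListing
    rows = rows-tabulate (λ q → tabulate (memberAt q)) λ q →
      subst (λ k → size k ≡ length (tabulate (memberAt q)) × Begins (M k) (map toℕ (tabulate (memberAt q))))
        (sym (+-identityʳ (toℕ q)))
        (sym (length-tabulate (memberAt q)) ,
         subst (Begins (M (toℕ q))) (sym (map-tabulate (memberAt q) toℕ))
           (begins-tabulate (toℕ ∘ memberAt q) (λ i → sym (toℕ-memberAt q i))))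

-- Assembly and the time bound.

program : Program
program = load ⨾ refine ⨾ emit

row-toℕ : ∀ {n} (f : Fin n → List ℕ) x → row f (toℕ x) ≡ f x
row-toℕ f fzero    = refl
row-toℕ f (fsuc x) = row-toℕ (λ k → f (fsuc k)) x

-- `maxPotential` is `potential` at `cnt = p = a = 0` with the largest possible `undone`. The factor
-- `n + n` bounds the length of an encoded partition without its leading count.
maxPotential loadTime refineTime emitTime totalTime : ℕ → ℕ
maxPotential n = suc n + (n * (2 + n) + (n * (2 + n + n) + n * suc n))
loadTime n   = 20 + n * (40 + (n + n) * 30)
refineTime n = 4 + 204 * maxPotential n
emitTime n   = 11 + (n + n) * 30
totalTime n  = loadTime n + (refineTime n + emitTime n)

quadratic-≤ : ∀ {n} a b c → 1 ≤ n → a + b * n + c * (n * n) ≤ (a + b + c) * (n * n)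
quadratic-≤ {n} a b c 1≤n = begin
  a + b * n + c * (n * n)                       ≡⟨ cong (λ k → k + b * n + c * (n * n)) (sym (*-identityʳ a)) ⟩
  a * 1 + b * n + c * (n * n)                   ≤⟨ +-monoˡ-≤ (c * (n * n)) (+-mono-≤
      (*-monoʳ-≤ a (*-mono-≤ 1≤n 1≤n))
      (*-monoʳ-≤ b (m≤m*n n n {{>-nonZero 1≤n}}))) ⟩
  a * (n * n) + b * (n * n) + c * (n * n)       ≡⟨ cong (_+ c * (n * n)) (sym (*-distribʳ-+ (n * n) a b)) ⟩
  (a + b) * (n * n) + c * (n * n)               ≡⟨ sym (*-distribʳ-+ (n * n) (a + b) c) ⟩
  (a + b + c) * (n * n)                         ∎
  where open ≤-Reasoning

totalTime-≡ : ∀ n → totalTime n ≡ 239 + 1324 * n + 876 * (n * n)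
totalTime-≡ = solve 1 (λ n →
    con 20 :+ n :* (con 40 :+ (n :+ n) :* con 30) :+
    ((con 4 :+ con 204 :* (con 1 :+ n :+ (n :* (con 2 :+ n) :+ (n :* (con 2 :+ n :+ n) :+ n :* (con 1 :+ n))))) :+
     (con 11 :+ (n :+ n) :* con 30))
    := con 239 :+ con 1324 :* n :+ con 876 :* (n :* n)) refl
  where open +-*-Solver

-- The constant is 239 + 1324 + 876, every term being raised to n². The logarithm enters only
-- through being at least 1, which is where the threshold 2 comes from.
totalTime-≤ : ∀ {n} → 2 ≤ n → totalTime n ≤ 2439 * (n * n * ⌊log₂ n ⌋)
totalTime-≤ {n} 2≤n = begin
  totalTime n                      ≡⟨ totalTime-≡ n ⟩
  239 + 1324 * n + 876 * (n * n)   ≤⟨ quadratic-≤ 239 1324 876 (<⇒≤ 2≤n) ⟩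
  2439 * (n * n)                   ≡⟨ cong (2439 *_) (sym (*-identityʳ (n * n))) ⟩
  2439 * (n * n * 1)               ≤⟨ *-monoʳ-≤ 2439 (*-monoʳ-≤ (n * n) (⌊log₂⌋-mono-≤ {2} 2≤n)) ⟩
  2439 * (n * n * ⌊log₂ n ⌋)       ∎
  where open ≤-Reasoning

module _ (n : ℕ) (H : HomogeneousRelation n) (L : Fin n → Listing n) (pres : Presents L H) (S : Subset n) where

  Solved : State → Set
  Solved s = ∃[ M ] ∃[ P ] (Outputs s M × ListsPartition M P × IsMU H S P)

  private
    σ : ℕ → ℕ
    σ = colourOf S

  record Ready (s : State) : Set where
    field
      keys      : ∀ x i {y} → y ∈ lookup (L x) i → mem s aKey (toℕ x) (toℕ y) ≡ suc (toℕ i + 0)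
      key-n     : ∀ (x : Fin n) → mem s aKey (toℕ x) n ≡ 0
      refining  : RefiningState n (mem s aKey) σ s
      affordable : statePotential n (mem s aKey) σ s ≤ maxPotential n

  start-run : Run load (initial S L) (loadTime n) Ready
  start-run = conseq (λ {s} → ready {s})
    (load-run L (n + n) (presents-≤ H pres) (presents-disjoint H pres) refl
      (λ x j → cong (λ l → nth l j) (row-toℕ (λ x → encode (L x)) x))
      (refl , record { loaded = λ _ () ; no-key = λ _ _ → refl ; no-part = λ _ → refl ; no-rep = λ _ _ → refl }))
    where
    ready : ∀ {s} → Agree load (initial S L) s →
      LoadingState L σ n s × regs s rN ≡ n × (0 < n → regs s rC ≡ 1 × mem s aSize 0 0 ≡ n) × (n ≡ 0 → regs s rC ≡ 0) →
      Ready s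
    ready {s} A ((_ , ld) , en , one , none) = record
      { keys = keys
      ; key-n = key-n
      ; refining = en , refl , R
      ; affordable = +-mono-≤ (m∸n≤m (suc n) (regs s rA)) (+-mono-≤ (*-monoˡ-≤ (2 + n) (m∸n≤m n (regs s rP)))
          (+-mono-≤ (*-monoˡ-≤ (2 + n + n) (m∸n≤m n (regs s rC))) (undone-≤ n (mem s aDone)))) }
      where
      keys : ∀ x i {y} → y ∈ lookup (L x) i → mem s aKey (toℕ x) (toℕ y) ≡ suc (toℕ i + 0)
      keys x = Loaded.keys (Loading.loaded ld x (toℕ<n x))
      key-n : ∀ (x : Fin n) → mem s aKey (toℕ x) n ≡ 0
      key-n x = Loaded.no-keys (Loading.loaded ld x (toℕ<n x))
        (All.tabulate λ _ {y} _ → <⇒≢ (toℕ<n y))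
      R : Refining n (mem s aKey) σ (regs s rC) (regs s rP) (regs s rA) (mem s aSize 0) (mem s aMem) (mem s aRep)
            (mem s aDone) (mem s aPart 0) (mem s aPos 0)
      R rewrite same-regs A rP refl | same-regs A rA refl = record
        { core = start-core H pres S keys key-n ld (λ u b → cong (λ f → f u b) (same-mem A aDone refl)) one none
        ; p≤cnt = z≤n ; finished = λ () ; current = λ _ _ () }

  solve-run : Run program (initial S L) (totalTime n) Solved
  solve-run = seq-run start-run λ {s} _ ready → let open Ready ready in
    seq-run (weaken (+-monoʳ-≤ 4 (*-monoʳ-≤ 204 affordable)) (refine-run n (mem s aKey) σ refining))
      λ {s′} _ → finish keys key-n {s′}
    where
    finish : ∀ {κ} (keys : ∀ x i {y} → y ∈ lookup (L x) i → κ (toℕ x) (toℕ y) ≡ suc (toℕ i + 0))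
      (key-n : ∀ (x : Fin n) → κ (toℕ x) n ≡ 0) →
      ∀ {s} → RefiningState n κ σ s × regs s rP ≡ regs s rC → Run emit s (emitTime n) Solved
    finish {κ} keys key-n {s} ((_ , _ , R) , p≡c) =
      weaken (+-monoʳ-≤ 11 (*-monoˡ-≤ 30 (classes-≤ lists (parts-partition H pres S keys key-n core finished′))))
        (conseq (λ _ out → M , P , out , lists , parts-MU H pres S keys key-n core finished′)
          (emit-run M (sym (length-tabulate _)) (rows H pres S keys key-n core finished′)))
      where
      open Refining R
      finished′ : ∀ {q} → q < regs s rC → Finished n κ σ (mem s aPart 0) (mem s aDone) q (suc n)
      finished′ q<c = finished (subst (_ <_) (sym p≡c) q<c)
      M = partListing H pres S keys key-n core finished′
      P = parts H pres S keys key-n core finished′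
      lists : ListsPartition M P
      lists = lists-parts H pres S keys key-n core finished′

theorem1 : ∃[ prog ] ∃[ c ] ∃[ n₀ ]
    (∀ (n : ℕ) (H : HomogeneousRelation n) (L : Fin n → Listing n) →
    Presents L H → (S : Subset n) →
    ∃[ s ] ∃[ t ]
    ( ⟨ prog , initial S L ⟩⇓⟨ s , t ⟩
    × (∃[ M ] ∃[ P ] (Outputs s M × ListsPartition M P × IsMU H S P))
    × (n₀ ≤ n → t ≤ c * (n * n * ⌊log₂ n ⌋))))
theorem1 = program , 2439 , 2 , λ n H L pres S →
  let r = solve-run n H L pres S in
  Run.final r , Run.time r , Run.runs r , Run.post r , λ 2≤n → ≤-trans (Run.time≤ r) (totalTime-≤ 2≤n)
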